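{- There exists an absolute constant $C>0$ such that every connected rainbow graph $R$ with $k$ vertices and minimum degree at least $C\log k$ is a fractalizer and satisfies \[ \operatorname{ind}(R) = \frac{k!}{k^k-k}. \]
   Context: A rainbow graph is a graph whose edges receive pairwise distinct colors. A colored graph $R$ on vertex set $[k]$ is viewed as a colored complete graph by giving all non-edges a single new color (here denoted $\emptyset$); so with $T = E(R)\cup\{\emptyset\}$, $R$ is the $T$-colored complete graph with $\chi_R(ij)=\{i,j\}$ if $ij\in E(R)$ and $\chi_R(ij)=\emptyset$ otherwise. Connectedness and minimum degree refer to the underlying graph $R$ (non-edges are not edges). Two colored complete graphs are isomorphic if there is a bijection of their vertex sets preserving all edge colors. For a $T$-colored complete graph $F$ on $k$ vertices and a $T$-colored complete graph $G$ on $n>k$ vertices, $I(F,G)$ is the number of $k$-subsets $S\subseteq V(G)$ with $G[S]\cong F$ as colored graphs, and $\varrho(F,G)=I(F,G)/\binom nk$. $I(F,n)$ is the maximum of $I(F,G)$ over all $T$-colored complete graphs $G$ on $n$ vertices, $\operatorname{ind}(F,n)=I(F,n)/\binom nk$, and $\operatorname{ind}(F)=\lim_{n\to\infty}\operatorname{ind}(F,n)$ (the inducibility). Iterated balanced blow-up: label $V(F)=[k]$; define $\mathcal{G}_F(n)$ inductively: for $n<k$ it consists of a $T$-colored complete graph on $n$ vertices (coloring irrelevant); for $n\ge k$, $G\in\mathcal{G}_F(n)$ if $V(G)=V_1\cup\cdots\cup V_k$ with $||V_i|-|V_j||\le1$, $G[V_i]\in\mathcal{G}_F(|V_i|)$,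 and for $v\in V_i,w\in V_j$, $i\neq j$, the color of $vw$ equals the color of $ij$ in $F$. $F$ is a fractalizer if $\operatorname{ind}(F)=\lim_{n\to\infty}\max_{G\in\mathcal{G}_F(n)}\varrho(F,G)$. -}

module Defs where

open import Data.Nat.Base as ℕ using (ℕ; zero; suc; _+_; _*_; _∸_; _^_; _!)
open import Data.Nat.Combinatorics using (_C_)
open import Data.Bool.Base using (Bool; true; false; if_then_else_)
open import Data.Maybe.Base using (Maybe; just; nothing)
import Data.Maybe.Properties as MaybeP
open import Data.Product.Base using (Σ; ∃; _×_; _,_; proj₁; proj₂)
import Data.Product.Properties as ProdP
open import Data.Sum.Base using (_⊎_; inj₁; inj₂)
open import Data.Fin.Base using (Fin; zero; suc; toℕ)
open import Data.Fin.Properties using (_≟_; any?; all?)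
open import Data.Fin.Subset using (Subset; inside; outside; _∈_; ∣_∣)
open import Data.Fin.Subset.Properties using (_∈?_)
open import Data.Vec.Base using (Vec; []; _∷_; lookup; tabulate)
open import Data.Integer.Base using (+_)
open import Data.Rational.Base using (ℚ; _/_; 0ℚ)
open import Relation.Nullary.Negation.Core using (¬_)
open import Relation.Nullary.Decidable.Core
  using (Dec; yes; no; ⌊_⌋; _×-dec_; _→-dec_; ¬?; map′)
open import Relation.Unary using (Decidable)
open import Relation.Binary.PropositionalEquality.Core using (_≡_; _≢_; refl; cong)
import Relation.Binary.PropositionalEquality.Properties as ≡P

record Graph (k : ℕ) : Set where
  field
    adj    : Fin k → Fin k → Bool
    sym    : ∀ i j → adj i j ≡ adj j i
    irrefl : ∀ i → adj i i ≡ false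
open Graph public

degree : ∀ {k} → Graph k → Fin k → ℕ
degree R v = ∣ tabulate (adj R v) ∣

data Reach {k} (R : Graph k) : Fin k → Fin k → Set where
  here : ∀ {i} → Reach R i i
  step : ∀ {i j l} → adj R i j ≡ true → Reach R j l → Reach R i l

Connected : ∀ {k} → Graph k → Set
Connected {k} R = ∀ (i j : Fin k) → Reach R i j

-- Colours.  A graph R on [k] is viewed as a rainbow colored complete
-- graph: edge ij gets the colour {i,j} (encoded as the ordered pair
-- (min,max)), non-edges get the colour ∅ (encoded as nothing).
-- Colours are elements of Col k; the palette T = E(R) ∪ {∅} is the
-- predicate InT R below.

Col : ℕ → Set
Col k = Maybe (Fin k × Fin k)

_≟Col_ : ∀ {k} (c d : Col k) → Dec (c ≡ d)
_≟Col_ = MaybeP.≡-dec (ProdP.≡-dec _≟_ _≟_)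

upair : ∀ {k} → Fin k → Fin k → Fin k × Fin k
upair i j = if ⌊ Data.Fin.Properties._≤?_ i j ⌋ then (i , j) else (j , i)
  where import Data.Fin.Properties

χ : ∀ {k} → Graph k → Fin k → Fin k → Col k
χ R i j = if adj R i j then just (upair i j) else nothing

InT : ∀ {k} → Graph k → Col k → Set
InT {k} R c =
  c ≡ nothing ⊎ Σ (Fin k) λ i → Σ (Fin k) λ j → adj R i j ≡ true × c ≡ χ R i j

-- T-colored complete graphs on n vertices (the colour of the "diagonal"
-- col x x is irrelevant and never used)
record TGraph {k} (R : Graph k) (n : ℕ) : Set where
  field
    col     : Fin n → Fin n → Col k
    col-sym : ∀ x y → col x y ≡ col y x
    col-T   : ∀ x y → x ≢ y → InT R (col x y)
open TGraph public

IsIso : ∀ {k n} (R : Graph k) (G : TGraph R n) → Subset n → Vec (Fin n) k → Set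
IsIso {k} {n} R G S σ =
    (∀ (i j : Fin k) → lookup σ i ≡ lookup σ j → i ≡ j)
  × (∀ (i : Fin k) → lookup σ i ∈ S)
  × (∀ (x : Fin n) → x ∈ S → ∃ λ i → lookup σ i ≡ x)
  × (∀ (i j : Fin k) → i ≢ j → col G (lookup σ i) (lookup σ j) ≡ χ R i j)

IsCopy : ∀ {k n} (R : Graph k) (G : TGraph R n) → Subset n → Set
IsCopy {k} {n} R G S = ∣ S ∣ ≡ k × ∃ λ (σ : Vec (Fin n) k) → IsIso R G S σ

anyVec? : ∀ {n} k {P : Vec (Fin n) k → Set} → (∀ v → Dec (P v)) → Dec (∃ P)
anyVec? zero P? = map′ (λ p → [] , p) (λ { ([] , p) → p }) (P? [])
anyVec? (suc k) P? =
  map′ (λ { (x , v , p) → (x ∷ v) , p }) (λ { ((x ∷ v) , p) → x , v , p })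
       (any? λ x → anyVec? k (λ v → P? (x ∷ v)))

isIso? : ∀ {k n} (R : Graph k) (G : TGraph R n) S σ → Dec (IsIso R G S σ)
isIso? R G S σ =
     all? (λ i → all? (λ j → (lookup σ i ≟ lookup σ j) →-dec (i ≟ j)))
  ×-dec all? (λ i → lookup σ i ∈? S)
  ×-dec all? (λ x → (x ∈? S) →-dec any? (λ i → lookup σ i ≟ x))
  ×-dec all? (λ i → all? (λ j →
          ¬? (i ≟ j) →-dec (col G (lookup σ i) (lookup σ j) ≟Col χ R i j)))

isCopy? : ∀ {k n} (R : Graph k) (G : TGraph R n) → Decidable (IsCopy R G)
isCopy? {k} R G S =
  (∣ S ∣ Data.Nat.Properties.≟ k) ×-dec anyVec? k (isIso? R G S)
  where import Data.Nat.Properties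

countSub : ∀ {n} {P : Subset n → Set} → Decidable P → ℕ
countSub {zero}  P? = if ⌊ P? [] ⌋ then 1 else 0
countSub {suc n} P? = countSub (λ S → P? (inside ∷ S)) + countSub (λ S → P? (outside ∷ S))

I : ∀ {k n} (R : Graph k) → TGraph R n → ℕ
I R G = countSub (isCopy? R G)

-- a / b as a rational (b = 0 is never used below)
ratio : ℕ → ℕ → ℚ
ratio a zero    = 0ℚ
ratio a (suc b) = + a / suc b

ρ : ∀ {k n} (R : Graph k) → TGraph R n → ℚ
ρ {k} {n} R G = ratio (I R G) (n C k)

pull : ∀ {k n m} {R : Graph k} (G : TGraph R n) (e : Fin m → Fin n) →
       (∀ a b → e a ≡ e b → a ≡ b) → TGraph R m
pull G e inj = record
  { col     = λ a b → col G (e a) (e b)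
  ; col-sym = λ a b → col-sym G (e a) (e b)
  ; col-T   = λ a b a≢b → col-T G (e a) (e b) (λ eq → a≢b (inj a b eq))
  }

-- IsBlowUp R G  ⇔  G ∈ 𝒢_R(n).  In the case n ≥ k the vertex set is
-- partitioned by `part` into classes V_i = part⁻¹(i); e i : Fin (m i) → Fin n
-- enumerates V_i bijectively, and G[V_i] (ordered by e i) is again in 𝒢_R.
data IsBlowUp {k} (R : Graph k) : ∀ {n} → TGraph R n → Set where
  small : ∀ {n} (G : TGraph R n) → n ℕ.< k → IsBlowUp R G
  blow  : ∀ {n} (G : TGraph R n) → k ℕ.≤ n →
          (part : Fin n → Fin k)
          (m : Fin k → ℕ)
          (e : (i : Fin k) → Fin (m i) → Fin n)
          (e-inj : ∀ i a b → e i a ≡ e i b → a ≡ b)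
          (e-in  : ∀ i a → part (e i a) ≡ i)
          (e-onto : ∀ x → ∃ λ a → e (part x) a ≡ x)
          (balanced : ∀ i j → m i ℕ.≤ suc (m j))
          (cross : ∀ x y → part x ≢ part y → col G x y ≡ χ R (part x) (part y))
          (rec : ∀ i → IsBlowUp R (pull G (e i) (e-inj i))) →
          IsBlowUp R G

-- Convergence of maxima.  MaxTendsTo R P L says
--   lim_{n→∞} max { ρ(R,G) : G a T-colored complete graph on n vertices, P G } = L,
-- written without naming the maximum: for every ε > 0, for all large n,
-- every admissible G has ρ ≤ L + ε and some admissible G has ρ ≥ L - ε.

MaxTendsTo : ∀ {k} (R : Graph k) (P : ∀ {n} → TGraph R n → Set) → ℚ → Set
MaxTendsTo R P L =
  ∀ (ε : ℚ) → 0ℚ Data.Rational.Base.< ε →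
  ∃ λ (N : ℕ) → ∀ (n : ℕ) → N ℕ.≤ n →
      (∀ (G : TGraph R n) → P G → ρ R G Data.Rational.Base.≤ L Data.Rational.Base.+ ε)
    × (∃ λ (G : TGraph R n) → P G × L Data.Rational.Base.- ε Data.Rational.Base.≤ ρ R G)
  where import Data.Rational.Base

IndEq : ∀ {k} → Graph k → ℚ → Set
IndEq R L = MaxTendsTo R (λ _ → Data.Unit.Base.⊤) L
  where import Data.Unit.Base

Fractalizer : ∀ {k} → Graph k → Set
Fractalizer R = ∃ λ L → IndEq R L × MaxTendsTo R (IsBlowUp R) L

{-# OPTIONS --safe #-}
-- Count embeddings of R by h(w), the sum over embeddings σ of ∏ w(σ l), for vertex weights w on
-- a fixed coloured graph, and call P/Q valid if Q h(w) ≤ P (∑ w)^k for all w.  Testing a valid bound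
-- on modified weights (erase a set, double a set, or add weight at one or two vertices) shows that a
-- vertex lying in a typical number of copies plays all but a k^{-C} fraction of them in one role:
-- the neighbours of its role carry far too much weight for copies in which it has another role to
-- avoid them.  The roles partition the vertices into V_1, ..., V_k.  A pair between two parts with
-- the wrong colour lies in far fewer copies than the transversal tuples it spoils, and an embedding
-- without such a pair is transversal or inside one part, so h(w) ≤ ∏ |V_i| + ∑ h(w|V_i).  With AM-GM
-- this replaces a valid M by k^{-k} + M k^{1-k}, and iteration gives the fixed point 1/(k^k - k).
-- The matching lower bound comes from comparing base-k digits.
module Submission where

open import Defs hiding (I; sym)
import Defs
open import Data.Nat.Base
open import Data.Nat.Properties hiding (_≟_)
open import Data.Nat.Combinatorics using (nCk≡nPk/k!) renaming (_C_ to _choose_; _P_ to _permute_)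
open import Data.Nat.Combinatorics.Base using () renaming (_P′_ to _permute′_)
open import Data.Nat.Combinatorics.Specification using (k!∣nP′k; nPk≡n!/[n∸k]!; nP′k≡n!/[n∸k]!)
open import Data.Nat.DivMod
open import Data.Nat.Divisibility using (n∣m*n)
open import Data.Nat.Tactic.RingSolver using (solve-∀)
import Data.Integer.Base as ℤ
import Data.Integer.Properties as ℤP
import Data.Rational.Base as ℚ
import Data.Rational.Properties as ℚP
import Data.Rational.Unnormalised.Base as ℚᵘ
import Data.Rational.Unnormalised.Properties as ℚᵘP
open import Data.Bool.Base using (Bool; true; false; if_then_else_)
open import Data.Bool.Properties using () renaming (_≟_ to _Bool≟_)
open import Data.Empty using (⊥-elim)
open import Data.Fin.Base using (Fin; zero; suc; toℕ; fromℕ<)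
import Data.Fin.Properties as FinP
open import Data.Fin.Properties using (_≟_; any?; all?)
open import Data.Fin.Subset using (Subset; inside; outside; _∈_; ∣_∣)
open import Data.Fin.Subset.Properties using (∣p∣≤n; ⊆-antisym)
open import Data.List.Base using (List; []; _∷_; map; concatMap; _++_)
open import Data.Maybe.Base using (just; nothing)
open import Data.Maybe.Properties using (just-injective)
open import Data.Product.Base using (_,_; _×_; ∃; proj₁; proj₂)
open import Data.Sum.Base using (_⊎_; inj₁; inj₂)
open import Data.Unit.Base using (⊤; tt)
open import Data.Vec.Base using (Vec; []; _∷_; lookup; tabulate)
import Data.Vec.Properties as VecP
open import Function.Base using (_∘_)
open import Relation.Binary.Definitions using (DecidableEquality)
open import Relation.Binary.PropositionalEquality
open import Relation.Nullary.Decidable using (dec-true)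
open import Relation.Nullary.Decidable.Core using (Dec; yes; no; does; isYes; _×-dec_; _→-dec_; ¬?)
open import Relation.Nullary.Negation.Core using (¬_)
open import Relation.Unary using (Decidable)

open ≤-Reasoning

-- Power inequalities

-- Natural-number weights keep every inequality free of division, and homogeneity of `h` lets any
-- additive error be scaled away. The obstacle is that a valid bound far above the truth says little
-- about a single vertex. So a bound is lowered by at most a factor 4 at a time: a unit of weight
-- worth less than its share of the new bound is deleted, and if no such unit is left, every vertex
-- is typical even for the old bound, up to the factor 16 in `Heavy`. The logarithm in the degree
-- condition balances two tests. Suppressing the wrong roles by a power of k takes a neighbourhood
-- of weight about (log k)/k of the total; if it were lighter, doubling it would cost only a power
-- of k, whereas the copies gain 2^degree. Once the roles are known, only a numerical inequality in
-- the part sizes is left. As long as the new bound is at least 3 k^-k, AM-GM alone rules out a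
-- large product of part sizes, so halving is free. Below that, what unequal parts lose in the
-- product must outweigh what they gain in the sum of k-th powers, and this is where k^k has to beat
-- k^3 8^k.

*-swap-inner : ∀ a b c d → (a * b) * (c * d) ≡ (a * c) * (b * d)
*-swap-inner = solve-∀

^-distrib-* : ∀ a b m → (a * b) ^ m ≡ a ^ m * b ^ m
^-distrib-* a b zero    = refl
^-distrib-* a b (suc m) = trans (cong (a * b *_) (^-distrib-* a b m)) (*-swap-inner a b (a ^ m) (b ^ m))

1≤m^n : ∀ {m} n → 1 ≤ m → 1 ≤ m ^ n
1≤m^n {suc m} n _ = m^n>0 (suc m) n

1≤k^k : ∀ k → 1 ≤ k ^ k
1≤k^k zero    = ≤-refl
1≤k^k (suc k) = m^n>0 (suc k) (suc k)

cancel-≤ : ∀ c {a b} → 1 ≤ c → c * a ≤ c * b → a ≤ b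
cancel-≤ (suc c) _ = *-cancelˡ-≤ (suc c)

private

  rearrange : ∀ a b c d → a ≤ b → c ≤ d → a * d + b * c ≤ a * c + b * d
  rearrange a b c d a≤b c≤d with m≤n⇒∃[o]m+o≡n a≤b | m≤n⇒∃[o]m+o≡n c≤d
  ... | p , refl | q , refl = begin
    a * (c + q) + (a + p) * c           ≤⟨ m≤m+n _ (p * q) ⟩
    a * (c + q) + (a + p) * c + p * q   ≡⟨ identity a p c q ⟩
    a * c + (a + p) * (c + q)           ∎
    where
    identity : ∀ a p c q → a * (c + q) + (a + p) * c + p * q ≡ a * c + (a + p) * (c + q)
    identity = solve-∀

rearrangement-^ : ∀ y c m → y ^ m * c + y * c ^ m ≤ y * y ^ m + c * c ^ m
rearrangement-^ y c m with ≤-total y c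
... | inj₁ y≤c = begin
  y ^ m * c + y * c ^ m   ≡⟨ trans (+-comm (y ^ m * c) _) (cong (y * c ^ m +_) (*-comm (y ^ m) c)) ⟩
  y * c ^ m + c * y ^ m   ≤⟨ rearrange y c (y ^ m) (c ^ m) y≤c (^-monoˡ-≤ m y≤c) ⟩
  y * y ^ m + c * c ^ m   ∎
... | inj₂ c≤y = begin
  y ^ m * c + y * c ^ m   ≡⟨ cong (_+ y * c ^ m) (*-comm (y ^ m) c) ⟩
  c * y ^ m + y * c ^ m   ≤⟨ rearrange c y (c ^ m) (y ^ m) c≤y (^-monoˡ-≤ m c≤y) ⟩
  c * c ^ m + y * y ^ m   ≡⟨ +-comm (c * c ^ m) _ ⟩
  y * y ^ m + c * c ^ m   ∎

-- Bernoulli's inequality (y/c)^(m+1) ≥ 1 + (m+1)(y/c - 1), cleared of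
-- denominators and subtractions.
bernoulli : ∀ y c m → suc m * (y * c ^ m) ≤ y ^ suc m + m * c ^ suc m
bernoulli y c zero    = ≤-reflexive (identity y)
  where
  identity : ∀ y → 1 * (y * 1) ≡ y * 1 + 0
  identity = solve-∀
bernoulli y c (suc m) = begin
  suc (suc m) * (y * (c * c ^ m))                           ≡⟨ e₁ y c m (c ^ m) ⟩
  c * (suc m * (y * c ^ m)) + y * (c * c ^ m)               ≤⟨ +-monoˡ-≤ _ (*-monoʳ-≤ c (bernoulli y c m)) ⟩
  c * (y * y ^ m + m * (c * c ^ m)) + y * (c * c ^ m)       ≡⟨ e₂ y c m (y ^ m) (c ^ m) ⟩
  (y * y ^ m * c + y * (c * c ^ m)) + m * (c * (c * c ^ m)) ≤⟨ +-monoˡ-≤ _ (rearrangement-^ y c (suc m)) ⟩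
  (y * (y * y ^ m) + c * (c * c ^ m)) + m * (c * (c * c ^ m)) ≡⟨ e₃ y c m (y ^ m) (c ^ m) ⟩
  y * (y * y ^ m) + suc m * (c * (c * c ^ m))               ∎
  where
  e₁ : ∀ y c m C → suc (suc m) * (y * (c * C)) ≡ c * (suc m * (y * C)) + y * (c * C)
  e₁ = solve-∀
  e₂ : ∀ y c m Y C → c * (y * Y + m * (c * C)) + y * (c * C) ≡ (y * Y * c + y * (c * C)) + m * (c * (c * C))
  e₂ = solve-∀
  e₃ : ∀ y c m Y C → (y * (y * Y) + c * (c * C)) + m * (c * (c * C)) ≡ y * (y * Y) + suc m * (c * (c * C))
  e₃ = solve-∀

bernoulli-+ : ∀ m d j → m ^ suc j + suc j * (d * m ^ j) ≤ (m + d) ^ suc j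
bernoulli-+ m d j = +-cancelʳ-≤ (j * m ^ suc j) _ _ (begin
  m * m ^ j + suc j * (d * m ^ j) + j * (m * m ^ j)  ≡⟨ e m d j (m ^ j) ⟩
  suc j * ((m + d) * m ^ j)                          ≤⟨ bernoulli (m + d) m j ⟩
  (m + d) ^ suc j + j * m ^ suc j                    ∎)
  where
  e : ∀ m d j M → m * M + suc j * (d * M) + j * (m * M) ≡ suc j * ((m + d) * M)
  e = solve-∀

double-^ : ∀ m d j → m ≤ suc j * d → 2 * m ^ suc j ≤ (m + d) ^ suc j
double-^ m d j m≤ = begin
  2 * (m * m ^ j)                   ≡⟨ e₁ m (m ^ j) ⟩
  m * m ^ j + m * m ^ j             ≤⟨ +-monoʳ-≤ (m * m ^ j) (*-monoˡ-≤ (m ^ j) m≤) ⟩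
  m * m ^ j + suc j * d * m ^ j     ≡⟨ cong (m * m ^ j +_) (*-assoc (suc j) d (m ^ j)) ⟩
  m ^ suc j + suc j * (d * m ^ j)   ≤⟨ bernoulli-+ m d j ⟩
  (m + d) ^ suc j                   ∎
  where
  e₁ : ∀ m M → 2 * (m * M) ≡ m * M + m * M
  e₁ = solve-∀

-- Each increase by `d` doubles the power, since `double-^` applies while the base is at most
-- `suc j * d`. Read backwards: a total weight that falls short of `k * W` by `g * W` divides the
-- `k`-th power by at least `2 ^ g`.
power-gain : ∀ m d j g → m + g * d ≤ suc j * d → 2 ^ g * m ^ suc j ≤ (m + g * d) ^ suc j
power-gain m d j zero    _ = ≤-reflexive (trans (+-identityʳ _) (cong (_^ suc j) (sym (+-identityʳ m))))
power-gain m d j (suc g) le = begin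
  2 * 2 ^ g * m ^ suc j               ≡⟨ *-assoc 2 (2 ^ g) _ ⟩
  2 * (2 ^ g * m ^ suc j)             ≤⟨ *-monoʳ-≤ 2 (power-gain m d j g le′) ⟩
  2 * (m + g * d) ^ suc j             ≤⟨ double-^ (m + g * d) d j le′ ⟩
  (m + g * d + d) ^ suc j             ≡⟨ cong (_^ suc j) (e m d g) ⟩
  (m + suc g * d) ^ suc j             ∎
  where
  e : ∀ m d g → m + g * d + d ≡ m + suc g * d
  e = solve-∀
  le′ : m + g * d ≤ suc j * d
  le′ = ≤-trans (≤-trans (m≤m+n _ d) (≤-reflexive (e m d g))) le

private
  -- Bernoulli gives `(m / suc m) ^ j ≥ 1 - j / suc m`, which is at least one half here.
  half-power : ∀ m j → 2 * j ≤ suc m → suc m ^ j ≤ 2 * m ^ j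
  half-power m zero    _ = s≤s z≤n
  half-power m (suc j) le = +-cancelʳ-≤ (2 * (j * suc m ^ suc j)) _ _ (begin
    suc m * c + 2 * (j * (suc m * c))      ≡⟨ e₁ m j c ⟩
    (suc m + 2 * j * suc m) * c            ≤⟨ *-monoˡ-≤ c le′ ⟩
    (2 * (suc j * m)) * c                  ≡⟨ e₂ m j c ⟩
    2 * (suc j * (m * c))                  ≤⟨ *-monoʳ-≤ 2 (bernoulli m (suc m) j) ⟩
    2 * (m * m ^ j + j * (suc m * c))      ≡⟨ *-distribˡ-+ 2 (m * m ^ j) _ ⟩
    2 * (m * m ^ j) + 2 * (j * (suc m * c)) ∎)
    where
    c = suc m ^ j
    e₁ : ∀ m j c → suc m * c + 2 * (j * (suc m * c)) ≡ (suc m + 2 * j * suc m) * c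
    e₁ = solve-∀
    e₂ : ∀ m j c → (2 * (suc j * m)) * c ≡ 2 * (suc j * (m * c))
    e₂ = solve-∀
    le″ : suc (2 * j) ≤ m
    le″ = s≤s⁻¹ (subst (_≤ suc m) (f j) le)
      where
      f : ∀ j → 2 * suc j ≡ suc (suc (2 * j))
      f = solve-∀
    le′ : suc m + 2 * j * suc m ≤ 2 * (suc j * m)
    le′ = begin
      suc m + 2 * j * suc m       ≡⟨ f m j ⟩
      m + 2 * j * m + suc (2 * j) ≤⟨ +-monoʳ-≤ (m + 2 * j * m) le″ ⟩
      m + 2 * j * m + m           ≡⟨ f′ m j ⟩
      2 * (suc j * m)             ∎
      where
      f : ∀ m j → suc m + 2 * j * suc m ≡ m + 2 * j * m + suc (2 * j)
      f = solve-∀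
      f′ : ∀ m j → m + 2 * j * m + m ≡ 2 * (suc j * m)
      f′ = solve-∀

  2⌊n/2⌋≤n : ∀ n → 2 * ⌊ n /2⌋ ≤ n
  2⌊n/2⌋≤n n = begin
    2 * ⌊ n /2⌋           ≡⟨ cong (⌊ n /2⌋ +_) (+-identityʳ _) ⟩
    ⌊ n /2⌋ + ⌊ n /2⌋     ≤⟨ +-monoʳ-≤ ⌊ n /2⌋ (⌊n/2⌋≤⌈n/2⌉ n) ⟩
    ⌊ n /2⌋ + ⌈ n /2⌉     ≡⟨ ⌊n/2⌋+⌈n/2⌉≡n n ⟩
    n                     ∎

-- The factor 4 is (m/(m+1))^k ≥ 1/4, by Bernoulli applied to both halves of k.
suc-power≤4 : ∀ m k → k ≤ m → suc m ^ k ≤ 4 * m ^ k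
suc-power≤4 m k k≤m = begin
  suc m ^ k                               ≡⟨ cong (suc m ^_) (sym (⌊n/2⌋+⌈n/2⌉≡n k)) ⟩
  suc m ^ (a + b)                         ≡⟨ ^-distribˡ-+-* (suc m) a b ⟩
  suc m ^ a * suc m ^ b                   ≤⟨ *-mono-≤ (half-power m a (≤-trans (2⌊n/2⌋≤n k) (m≤n⇒m≤1+n k≤m)))
                                                      (half-power m b (≤-trans (2⌊n/2⌋≤n (suc k)) (s≤s k≤m))) ⟩
  2 * m ^ a * (2 * m ^ b)                 ≡⟨ e (m ^ a) (m ^ b) ⟩
  4 * (m ^ a * m ^ b)                     ≡⟨ cong (4 *_) (sym (^-distribˡ-+-* m a b)) ⟩
  4 * m ^ (a + b)                         ≡⟨ cong (λ z → 4 * m ^ z) (⌊n/2⌋+⌈n/2⌉≡n k) ⟩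
  4 * m ^ k                               ∎
  where
  a = ⌊ k /2⌋
  b = ⌈ k /2⌉
  e : ∀ A B → 2 * A * (2 * B) ≡ 4 * (A * B)
  e = solve-∀

power≤4^ : ∀ k x → (k + x) ^ k ≤ 4 ^ x * k ^ k
power≤4^ k zero    = ≤-reflexive (trans (cong (_^ k) (+-identityʳ k)) (sym (+-identityʳ _)))
power≤4^ k (suc x) = begin
  (k + suc x) ^ k           ≡⟨ cong (_^ k) (+-suc k x) ⟩
  suc (k + x) ^ k           ≤⟨ suc-power≤4 (k + x) k (m≤m+n k x) ⟩
  4 * (k + x) ^ k           ≤⟨ *-monoʳ-≤ 4 (power≤4^ k x) ⟩
  4 * (4 ^ x * k ^ k)       ≡⟨ sym (*-assoc 4 (4 ^ x) _) ⟩
  4 ^ suc x * k ^ k         ∎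

-- Second-order Taylor remainder of the power function at W, with d = (y - W)².
taylor-^ : ∀ y W B d m → y ≤ B → W ≤ B → d + 2 * (y * W) ≡ y * y + W * W →
           B * B * (y ^ suc m + m * W ^ suc m) ≤ B * B * (suc m * (y * W ^ m)) + suc m * suc m * (B ^ suc m * d)
taylor-^ y W B d zero _ _ _ = begin
  B * B * (y * 1 + 0)                             ≡⟨ e B y ⟩
  B * B * (1 * (y * 1))                           ≤⟨ m≤m+n _ _ ⟩
  B * B * (1 * (y * 1)) + 1 * 1 * (B * 1 * d)     ∎
  where
  e : ∀ B y → B * B * (y * 1 + 0) ≡ B * B * (1 * (y * 1))
  e = solve-∀
-- The remainder `r m = y ^ suc m + m * W ^ suc m - suc m * y * W ^ m` satisfies `r (suc m) = y * r
-- m + suc m * W ^ m * (y - W)²`; the term added on both sides avoids subtraction.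
taylor-^ y W B d (suc m) y≤B W≤B d-eq = +-cancelʳ-≤ (B * B * (suc m * Wm * (2 * (y * W)))) _ _ (begin
  B * B * (y * (y * Ym) + suc m * (W * (W * Wm))) + B * B * (suc m * Wm * (2 * (y * W)))
    ≤⟨ m≤m+n _ _ ⟩
  B * B * (y * (y * Ym) + suc m * (W * (W * Wm))) + B * B * (suc m * Wm * (2 * (y * W))) + 0
    ≡⟨ e₁ B y Ym m W Wm ⟩
  y * (B * B * (y * Ym + m * (W * Wm))) + B * B * (suc m * Wm * (W * W)) + B * B * (Wm * (y * W) * (2 + m))
    ≤⟨ +-monoˡ-≤ _ (+-monoˡ-≤ _ (*-monoʳ-≤ y (taylor-^ y W B d m y≤B W≤B d-eq))) ⟩
  y * (B * B * (suc m * (y * Wm)) + suc m * suc m * (B * Bm * d)) + B * B * (suc m * Wm * (W * W)) + B * B * (Wm * (y * W) * (2 + m))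
    ≡⟨ e₂ B y m W Wm Bm d ⟩
  B * B * (suc m * Wm * (y * y + W * W)) + y * (suc m * suc m * (B * Bm * d)) + B * B * (Wm * (y * W) * (2 + m))
    ≡⟨ cong (λ z → B * B * (suc m * Wm * z) + y * (suc m * suc m * (B * Bm * d)) + B * B * (Wm * (y * W) * (2 + m))) (sym d-eq) ⟩
  B * B * (suc m * Wm * (d + 2 * (y * W))) + y * (suc m * suc m * (B * Bm * d)) + B * B * (Wm * (y * W) * (2 + m))
    ≤⟨ +-monoˡ-≤ _ (+-mono-≤ (≤-reflexive (e₃ B m Wm d (y * W))) (*-monoˡ-≤ (suc m * suc m * (B * Bm * d)) y≤B)) ⟩
  (B * B * (suc m * (Wm * d)) + B * B * (suc m * Wm * (2 * (y * W)))) + B * (suc m * suc m * (B * Bm * d)) + B * B * (Wm * (y * W) * (2 + m))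
    ≤⟨ +-monoˡ-≤ _ (+-monoˡ-≤ _ (+-monoˡ-≤ _ (*-monoʳ-≤ (B * B) (*-monoʳ-≤ (suc m) (*-monoˡ-≤ d (^-monoˡ-≤ m W≤B)))))) ⟩
  (B * B * (suc m * (Bm * d)) + B * B * (suc m * Wm * (2 * (y * W)))) + B * (suc m * suc m * (B * Bm * d)) + B * B * (Wm * (y * W) * (2 + m))
    ≤⟨ m≤m+n _ (B * B * (Bm * d) * (2 + m)) ⟩
  (B * B * (suc m * (Bm * d)) + B * B * (suc m * Wm * (2 * (y * W)))) + B * (suc m * suc m * (B * Bm * d)) + B * B * (Wm * (y * W) * (2 + m)) + B * B * (Bm * d) * (2 + m)
    ≡⟨ e₄ B y m W Wm Bm d ⟩
  (B * B * (suc (suc m) * (y * (W * Wm))) + suc (suc m) * suc (suc m) * (B * (B * Bm) * d)) + B * B * (suc m * Wm * (2 * (y * W))) ∎)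
  where
  Ym = y ^ m
  Wm = W ^ m
  Bm = B ^ m
  e₁ : ∀ B y Ym m W Wm → B * B * (y * (y * Ym) + suc m * (W * (W * Wm))) + B * B * (suc m * Wm * (2 * (y * W))) + 0
       ≡ y * (B * B * (y * Ym + m * (W * Wm))) + B * B * (suc m * Wm * (W * W)) + B * B * (Wm * (y * W) * (2 + m))
  e₁ = solve-∀
  e₂ : ∀ B y m W Wm Bm d → y * (B * B * (suc m * (y * Wm)) + suc m * suc m * (B * Bm * d)) + B * B * (suc m * Wm * (W * W)) + B * B * (Wm * (y * W) * (2 + m))
       ≡ B * B * (suc m * Wm * (y * y + W * W)) + y * (suc m * suc m * (B * Bm * d)) + B * B * (Wm * (y * W) * (2 + m))
  e₂ = solve-∀
  e₃ : ∀ B m Wm d z → B * B * (suc m * Wm * (d + 2 * z)) ≡ B * B * (suc m * (Wm * d)) + B * B * (suc m * Wm * (2 * z))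
  e₃ = solve-∀
  e₄ : ∀ B y m W Wm Bm d → (B * B * (suc m * (Bm * d)) + B * B * (suc m * Wm * (2 * (y * W)))) + B * (suc m * suc m * (B * Bm * d)) + B * B * (Wm * (y * W) * (2 + m)) + B * B * (Bm * d) * (2 + m)
       ≡ (B * B * (suc (suc m) * (y * (W * Wm))) + suc (suc m) * suc (suc m) * (B * (B * Bm) * d)) + B * B * (suc m * Wm * (2 * (y * W)))
  e₄ = solve-∀

-- Finite sums and products

private variable
  Ix Jx Pr : Set

𝟙 : Dec Pr → ℕ
𝟙 d = if does d then 1 else 0

𝟙-yes : (d : Dec Pr) → Pr → 𝟙 d ≡ 1
𝟙-yes (yes _) _ = refl
𝟙-yes (no ¬p) p = ⊥-elim (¬p p)

𝟙-no : (d : Dec Pr) → ¬ Pr → 𝟙 d ≡ 0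
𝟙-no (yes p) ¬p = ⊥-elim (¬p p)
𝟙-no (no _)  _  = refl

𝟙-*-≤ : (d : Dec Pr) {a b : ℕ} → (Pr → a ≤ b) → 𝟙 d * a ≤ b
𝟙-*-≤ (yes p) le = ≤-trans (≤-reflexive (+-identityʳ _)) (le p)
𝟙-*-≤ (no _)  _  = z≤n

𝟙-*-mono : (d : Dec Pr) {a b : ℕ} → (Pr → a ≤ b) → 𝟙 d * a ≤ 𝟙 d * b
𝟙-*-mono (yes p) le = *-monoʳ-≤ 1 (le p)
𝟙-*-mono (no _)  _  = z≤n

≤-𝟙-* : (d : Dec Pr) {a : ℕ} → Pr → a ≤ 𝟙 d * a
≤-𝟙-* d {a} p = ≤-reflexive (sym (trans (cong (_* a) (𝟙-yes d p)) (+-identityʳ a)))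

∑ : List Ix → (Ix → ℕ) → ℕ
∑ []       f = 0
∑ (x ∷ xs) f = f x + ∑ xs f

syntax ∑ xs (λ x → e) = ∑[ x ∈ xs ] e

∑-mono : ∀ (xs : List Ix) {f g : Ix → ℕ} → (∀ x → f x ≤ g x) → ∑ xs f ≤ ∑ xs g
∑-mono []       le = z≤n
∑-mono (x ∷ xs) le = +-mono-≤ (le x) (∑-mono xs le)

∑-cong : ∀ (xs : List Ix) {f g : Ix → ℕ} → (∀ x → f x ≡ g x) → ∑ xs f ≡ ∑ xs g
∑-cong []       eq = refl
∑-cong (x ∷ xs) eq = cong₂ _+_ (eq x) (∑-cong xs eq)

∑-zero : ∀ (xs : List Ix) → ∑[ x ∈ xs ] 0 ≡ 0
∑-zero []       = refl
∑-zero (x ∷ xs) = ∑-zero xs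

+-interchange : ∀ a b c d → (a + b) + (c + d) ≡ (a + c) + (b + d)
+-interchange = solve-∀

∑-+ : ∀ (xs : List Ix) (f g : Ix → ℕ) → ∑[ x ∈ xs ] (f x + g x) ≡ ∑ xs f + ∑ xs g
∑-+ []       f g = refl
∑-+ (x ∷ xs) f g = trans (cong (f x + g x +_) (∑-+ xs f g)) (+-interchange (f x) (g x) (∑ xs f) (∑ xs g))

∑-*ˡ : ∀ (xs : List Ix) c (f : Ix → ℕ) → ∑[ x ∈ xs ] (c * f x) ≡ c * ∑ xs f
∑-*ˡ []       c f = sym (*-zeroʳ c)
∑-*ˡ (x ∷ xs) c f = trans (cong (c * f x +_) (∑-*ˡ xs c f)) (sym (*-distribˡ-+ c (f x) (∑ xs f)))

∑-*ʳ : ∀ (xs : List Ix) c (f : Ix → ℕ) → ∑[ x ∈ xs ] (f x * c) ≡ ∑ xs f * c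
∑-*ʳ xs c f = trans (∑-cong xs (λ x → *-comm (f x) c)) (trans (∑-*ˡ xs c f) (*-comm c _))

∑-swap : ∀ (xs : List Ix) (ys : List Jx) (f : Ix → Jx → ℕ) →
         ∑[ x ∈ xs ] ∑[ y ∈ ys ] f x y ≡ ∑[ y ∈ ys ] ∑[ x ∈ xs ] f x y
∑-swap []       ys f = sym (∑-zero ys)
∑-swap (x ∷ xs) ys f = trans (cong (∑ ys (f x) +_) (∑-swap xs ys f)) (sym (∑-+ ys (f x) _))

∑-++ : ∀ (xs ys : List Ix) (f : Ix → ℕ) → ∑ (xs ++ ys) f ≡ ∑ xs f + ∑ ys f
∑-++ []       ys f = refl
∑-++ (x ∷ xs) ys f = trans (cong (f x +_) (∑-++ xs ys f)) (sym (+-assoc (f x) _ _))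

∑-map : ∀ (h : Ix → Jx) xs (f : Jx → ℕ) → ∑ (map h xs) f ≡ ∑ xs (f ∘ h)
∑-map h []       f = refl
∑-map h (x ∷ xs) f = cong (f (h x) +_) (∑-map h xs f)

∑-concatMap : ∀ (h : Ix → List Jx) xs (f : Jx → ℕ) → ∑ (concatMap h xs) f ≡ ∑[ x ∈ xs ] ∑ (h x) f
∑-concatMap h []       f = refl
∑-concatMap h (x ∷ xs) f = trans (∑-++ (h x) (concatMap h xs) f) (cong (∑ (h x) f +_) (∑-concatMap h xs f))

fins : ∀ n → List (Fin n)
fins zero    = []
fins (suc n) = zero ∷ map suc (fins n)

vecs : List Ix → ∀ k → List (Vec Ix k)
vecs xs zero    = [] ∷ []
vecs xs (suc k) = concatMap (λ x → map (x ∷_) (vecs xs k)) xs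

∑-fins-suc : ∀ n (f : Fin (suc n) → ℕ) → ∑ (fins (suc n)) f ≡ f zero + ∑ (fins n) (f ∘ suc)
∑-fins-suc n f = cong (f zero +_) (∑-map suc (fins n) f)

∑-vecs-suc : ∀ (xs : List Ix) k (f : Vec Ix (suc k) → ℕ) →
             ∑ (vecs xs (suc k)) f ≡ ∑[ x ∈ xs ] ∑[ v ∈ vecs xs k ] f (x ∷ v)
∑-vecs-suc xs k f = trans (∑-concatMap (λ x → map (x ∷_) (vecs xs k)) xs f)
                          (∑-cong xs (λ x → ∑-map (x ∷_) (vecs xs k) f))

∑-const : ∀ n c → ∑[ x ∈ fins n ] c ≡ n * c
∑-const zero    c = refl
∑-const (suc n) c = trans (∑-fins-suc n (λ _ → c)) (cong (c +_) (∑-const n c))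

∑-δ : ∀ n (y : Fin n) (f : Fin n → ℕ) → ∑[ x ∈ fins n ] (𝟙 (x ≟ y) * f x) ≡ f y
∑-δ (suc n) zero f =
  trans (∑-fins-suc n (λ x → 𝟙 (x ≟ zero) * f x)) (trans (cong (1 * f zero +_) (∑-zero (fins n))) (lemma (f zero)))
  where
  lemma : ∀ a → 1 * a + 0 ≡ a
  lemma = solve-∀
∑-δ (suc n) (suc y) f =
  trans (∑-fins-suc n (λ x → 𝟙 (x ≟ suc y) * f x)) (trans (∑-cong (fins n) (λ x → cong (_* f (suc x)) (shift x))) (∑-δ n y (f ∘ suc)))
  where
  shift : ∀ x → 𝟙 (Fin.suc x ≟ suc y) ≡ 𝟙 (x ≟ y)
  shift x with x ≟ y
  ... | yes _ = refl
  ... | no  _ = refl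

∑-term : ∀ n (y : Fin n) (f : Fin n → ℕ) → f y ≤ ∑ (fins n) f
∑-term n y f = begin
  f y                                 ≡⟨ sym (∑-δ n y f) ⟩
  ∑[ x ∈ fins n ] (𝟙 (x ≟ y) * f x)   ≤⟨ ∑-mono (fins n) (λ x → 𝟙-*-≤ (x ≟ y) (λ _ → ≤-refl)) ⟩
  ∑ (fins n) f                        ∎

∏ : ∀ k → (Fin k → ℕ) → ℕ
∏ zero    f = 1
∏ (suc k) f = f zero * ∏ k (f ∘ suc)

∏-mono : ∀ k {f g : Fin k → ℕ} → (∀ i → f i ≤ g i) → ∏ k f ≤ ∏ k g
∏-mono zero    le = ≤-refl
∏-mono (suc k) le = *-mono-≤ (le zero) (∏-mono k (le ∘ suc))

∏-cong : ∀ k {f g : Fin k → ℕ} → (∀ i → f i ≡ g i) → ∏ k f ≡ ∏ k g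
∏-cong zero    eq = refl
∏-cong (suc k) eq = cong₂ _*_ (eq zero) (∏-cong k (eq ∘ suc))

∏-* : ∀ k (f g : Fin k → ℕ) → ∏ k (λ i → f i * g i) ≡ ∏ k f * ∏ k g
∏-* zero    f g = refl
∏-* (suc k) f g = trans (cong (f zero * g zero *_) (∏-* k (f ∘ suc) (g ∘ suc)))
                        (*-swap-inner (f zero) (g zero) (∏ k (f ∘ suc)) (∏ k (g ∘ suc)))

∏-const : ∀ k c → ∏ k (λ _ → c) ≡ c ^ k
∏-const zero    c = refl
∏-const (suc k) c = cong (c *_) (∏-const k c)

∏-scale : ∀ k c (f : Fin k → ℕ) → ∏ k (λ i → c * f i) ≡ c ^ k * ∏ k f
∏-scale k c f = trans (∏-* k (λ _ → c) f) (cong (_* ∏ k f) (∏-const k c))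

∏-𝟙 : ∀ k {Pr : Fin k → Set} (d : ∀ i → Dec (Pr i)) (e : Dec (∀ i → Pr i)) → ∏ k (λ i → 𝟙 (d i)) ≡ 𝟙 e
∏-𝟙 zero    d e = sym (𝟙-yes e (λ ()))
∏-𝟙 (suc k) d e with d zero
... | no ¬p = sym (𝟙-no e (λ all → ¬p (all zero)))
... | yes p with all? (d ∘ suc)
...   | yes ps = trans (+-identityʳ _) (trans (∏-𝟙 k (d ∘ suc) (yes ps)) (sym (𝟙-yes e λ { zero → p ; (suc i) → ps i })))
...   | no ¬ps = trans (+-identityʳ _) (trans (∏-𝟙 k (d ∘ suc) (no ¬ps)) (sym (𝟙-no e (λ all → ¬ps (all ∘ suc)))))

infixl 8 _∖_
-- Setting the factor at `i` to 1 stands for omitting it: the index type stays `Fin k`, and `∏` of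
-- the result is the derivative of the product by its `i`-th factor.
_∖_ : ∀ {k} → (Fin k → ℕ) → Fin k → (Fin k → ℕ)
(f ∖ i) l = if does (l ≟ i) then 1 else f l

∖-same : ∀ {k} (f : Fin k → ℕ) i → (f ∖ i) i ≡ 1
∖-same f i with i ≟ i
... | yes _ = refl
... | no ≢  = ⊥-elim (≢ refl)

∖-other : ∀ {k} (f : Fin k → ℕ) {i l} → l ≢ i → (f ∖ i) l ≡ f l
∖-other f {i} {l} l≢i with l ≟ i
... | yes eq = ⊥-elim (l≢i eq)
... | no _   = refl

∏-split : ∀ k (f : Fin k → ℕ) i → ∏ k f ≡ f i * ∏ k (f ∖ i)
∏-split (suc k) f zero    = cong (f zero *_) (sym (+-identityʳ _))
∏-split (suc k) f (suc i) =
  trans (cong (f zero *_) (trans (∏-split k (f ∘ suc) i) (cong (f (suc i) *_) (∏-cong k shift))))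
        (lemma (f zero) (f (suc i)) (∏ k (λ l → (f ∖ suc i) (suc l))))
  where
  shift : ∀ l → ((f ∘ suc) ∖ i) l ≡ (f ∖ suc i) (suc l)
  shift l with l ≟ i
  ... | yes _ = refl
  ... | no _  = refl
  lemma : ∀ a b c → a * (b * c) ≡ b * (a * c)
  lemma = solve-∀

∏-split₂ : ∀ k (f : Fin k → ℕ) {i j} → i ≢ j → ∏ k f ≡ f i * (f j * ∏ k (f ∖ i ∖ j))
∏-split₂ k f {i} {j} i≢j =
  trans (∏-split k f i)
        (cong (f i *_) (trans (∏-split k (f ∖ i) j) (cong (_* ∏ k (f ∖ i ∖ j)) (∖-other f (i≢j ∘ sym)))))

∖-cong : ∀ {k} {f g : Fin k → ℕ} i → (∀ l → l ≢ i → f l ≡ g l) → ∀ l → (f ∖ i) l ≡ (g ∖ i) l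
∖-cong i eq l with l ≟ i
... | yes _  = refl
... | no l≢i = eq l l≢i

∖-mono : ∀ {k} {f g : Fin k → ℕ} i → (∀ l → l ≢ i → f l ≤ g l) → ∀ l → (f ∖ i) l ≤ (g ∖ i) l
∖-mono i le l with l ≟ i
... | yes _  = ≤-refl
... | no l≢i = le l l≢i

∑-∏ : ∀ n k (u : Fin k → Fin n → ℕ) →
      ∑[ σ ∈ vecs (fins n) k ] ∏ k (λ l → u l (lookup σ l)) ≡ ∏ k (λ l → ∑ (fins n) (u l))
∑-∏ n zero    u = refl
∑-∏ n (suc k) u = begin-equality
  ∑[ σ ∈ vecs (fins n) (suc k) ] ∏ (suc k) (λ l → u l (lookup σ l))
    ≡⟨ ∑-vecs-suc (fins n) k _ ⟩
  ∑[ x ∈ fins n ] ∑[ σ ∈ vecs (fins n) k ] (u zero x * ∏ k (λ l → u (suc l) (lookup σ l)))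
    ≡⟨ ∑-cong (fins n) (λ x → ∑-*ˡ (vecs (fins n) k) (u zero x) _) ⟩
  ∑[ x ∈ fins n ] (u zero x * ∑[ σ ∈ vecs (fins n) k ] ∏ k (λ l → u (suc l) (lookup σ l)))
    ≡⟨ ∑-cong (fins n) (λ x → cong (u zero x *_) (∑-∏ n k (u ∘ suc))) ⟩
  ∑[ x ∈ fins n ] (u zero x * ∏ k (λ l → ∑ (fins n) (u (suc l))))
    ≡⟨ ∑-*ʳ (fins n) _ (u zero) ⟩
  ∑ (fins n) (u zero) * ∏ k (λ l → ∑ (fins n) (u (suc l)))
    ∎

-- The inequality of the arithmetic and geometric means

private
  -- Bernoulli with `y = k * (x + S)` and `c = suc k * S`: their difference `k * x - S` vanishes
  -- when `x` is the mean of the other `k` numbers. The case `k = 0` is separate because a factor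
  -- `k` is cancelled.
  amgm-step : ∀ k x S → suc k ^ suc k * (x * S ^ k) ≤ k ^ k * (x + S) ^ suc k
  amgm-step zero    x S = begin
    1 * (x * 1)           ≤⟨ m≤m+n _ S ⟩
    1 * (x * 1) + S       ≡⟨ e x S ⟩
    1 * ((x + S) * 1)     ∎
    where
    e : ∀ x S → 1 * (x * 1) + S ≡ 1 * ((x + S) * 1)
    e = solve-∀
  amgm-step k@(suc _) x S = *-cancelˡ-≤ k (+-cancelʳ-≤ (k * c ^ suc k) _ _ (begin
    k * (suc k ^ suc k * (x * S ^ k)) + k * c ^ suc k
      ≡⟨ cong (λ z → k * (suc k ^ suc k * (x * S ^ k)) + k * (c * z)) (^-distrib-* (suc k) S k) ⟩
    k * (suc k * suc k ^ k * (x * S ^ k)) + k * (suc k * S * (suc k ^ k * S ^ k))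
      ≡⟨ e₁ k x S (suc k ^ k) (S ^ k) ⟩
    suc k * (k * (x + S) * (suc k ^ k * S ^ k))
      ≡⟨ cong (λ z → suc k * (y * z)) (sym (^-distrib-* (suc k) S k)) ⟩
    suc k * (y * c ^ k)
      ≤⟨ bernoulli y c k ⟩
    y ^ suc k + k * c ^ suc k
      ≡⟨ cong (_+ k * c ^ suc k) (trans (^-distrib-* k (x + S) (suc k)) (*-assoc k (k ^ k) _)) ⟩
    k * (k ^ k * (x + S) ^ suc k) + k * c ^ suc k ∎))
    where
    y = k * (x + S)
    c = suc k * S
    e₁ : ∀ k x S K T → k * (suc k * K * (x * T)) + k * (suc k * S * (K * T)) ≡ suc k * (k * (x + S) * (K * T))
    e₁ = solve-∀

am-gm : ∀ k (f : Fin k → ℕ) → k ^ k * ∏ k f ≤ (∑ (fins k) f) ^ k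
am-gm zero    f = ≤-refl
am-gm (suc k) f = cancel-≤ (k ^ k) (1≤k^k k) (begin
  k ^ k * (suc k ^ suc k * (x * p))   ≡⟨ e₁ (k ^ k) (suc k ^ suc k) x p ⟩
  suc k ^ suc k * (x * (k ^ k * p))   ≤⟨ *-monoʳ-≤ (suc k ^ suc k) (*-monoʳ-≤ x (am-gm k (f ∘ suc))) ⟩
  suc k ^ suc k * (x * S ^ k)         ≤⟨ amgm-step k x S ⟩
  k ^ k * (x + S) ^ suc k             ≡⟨ cong (λ z → k ^ k * z ^ suc k) (sym (∑-fins-suc k f)) ⟩
  k ^ k * (∑ (fins (suc k)) f) ^ suc k ∎)
  where
  x = f zero
  p = ∏ k (f ∘ suc)
  S = ∑ (fins k) (f ∘ suc)
  e₁ : ∀ a b x p → a * (b * (x * p)) ≡ b * (x * (a * p))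
  e₁ = solve-∀

-- Nearly equal parts

∏-∖-scale : ∀ k c (f : Fin k → ℕ) i → c * ∏ k ((λ l → c * f l) ∖ i) ≡ c ^ k * ∏ k (f ∖ i)
∏-∖-scale k c f i = sym (begin-equality
  c ^ k * ∏ k (f ∖ i)                                        ≡⟨ sym (∏-scale k c (f ∖ i)) ⟩
  ∏ k (λ l → c * (f ∖ i) l)                                  ≡⟨ ∏-split k _ i ⟩
  c * (f ∖ i) i * ∏ k ((λ l → c * (f ∖ i) l) ∖ i)            ≡⟨ cong₂ _*_ (trans (cong (c *_) (∖-same f i)) (*-identityʳ c))
                                                                          (∏-cong k (∖-cong i (λ l l≢i → cong (c *_) (∖-other f l≢i)))) ⟩
  c * ∏ k ((λ l → c * f l) ∖ i)                              ∎)

∏-∖∖-scale : ∀ k c (f : Fin k → ℕ) {i j} → i ≢ j →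
             c * c * ∏ k ((λ l → c * f l) ∖ i ∖ j) ≡ c ^ k * ∏ k (f ∖ i ∖ j)
∏-∖∖-scale k c f {i} {j} i≢j = sym (begin-equality
  c ^ k * ∏ k (f ∖ i ∖ j)                            ≡⟨ sym (∏-scale k c (f ∖ i ∖ j)) ⟩
  ∏ k (λ l → c * (f ∖ i ∖ j) l)                      ≡⟨ ∏-split₂ k _ i≢j ⟩
  c * (f ∖ i ∖ j) i * (c * (f ∖ i ∖ j) j * ∏ k ((λ l → c * (f ∖ i ∖ j) l) ∖ i ∖ j))
    ≡⟨ cong₂ (λ a b → c * a * (c * b * ∏ k ((λ l → c * (f ∖ i ∖ j) l) ∖ i ∖ j)))
             (trans (∖-other (f ∖ i) i≢j) (∖-same f i)) (∖-same (f ∖ i) j) ⟩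
  c * 1 * (c * 1 * ∏ k ((λ l → c * (f ∖ i ∖ j) l) ∖ i ∖ j))
    ≡⟨ cong (λ z → c * 1 * (c * 1 * z)) (∏-cong k pointwise) ⟩
  c * 1 * (c * 1 * ∏ k ((λ l → c * f l) ∖ i ∖ j))    ≡⟨ e c _ ⟩
  c * c * ∏ k ((λ l → c * f l) ∖ i ∖ j)              ∎)
  where
  e : ∀ c p → c * 1 * (c * 1 * p) ≡ c * c * p
  e = solve-∀
  pointwise : ∀ l → ((λ l → c * (f ∖ i ∖ j) l) ∖ i ∖ j) l ≡ ((λ l → c * f l) ∖ i ∖ j) l
  pointwise l with l ≟ j | l ≟ i
  ... | yes _ | _     = refl
  ... | no _  | yes _ = refl
  ... | no _  | no _  = refl

sq : ℕ → ℕ → ℕ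
sq x y = ∣ x - y ∣ * ∣ x - y ∣

sq-comm : ∀ x y → sq x y ≡ sq y x
sq-comm x y = cong₂ _*_ (∣-∣-comm x y) (∣-∣-comm x y)

private
  sq-≤ : ∀ x d → sq x (x + d) + 2 * (x * (x + d)) ≡ x * x + (x + d) * (x + d)
  sq-≤ x d = trans (cong (λ z → z * z + 2 * (x * (x + d))) (∣m-m+n∣≡n x d)) (e x d)
    where
    e : ∀ x d → d * d + 2 * (x * (x + d)) ≡ x * x + (x + d) * (x + d)
    e = solve-∀

sq-expand : ∀ x y → sq x y + 2 * (x * y) ≡ x * x + y * y
sq-expand x y with ≤-total x y
... | inj₁ x≤y with m≤n⇒∃[o]m+o≡n x≤y
...   | d , refl = sq-≤ x d
sq-expand x y | inj₂ y≤x with m≤n⇒∃[o]m+o≡n y≤x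
...   | d , refl = trans (cong₂ (λ a b → a + 2 * b) (sq-comm (y + d) y) (*-comm (y + d) y))
                         (trans (sq-≤ y d) (+-comm (y * y) _))

-- Stability of AM-GM. Replacing two numbers by their mean keeps the sum and raises the product by
-- an amount that grows with their difference, so a product close to its maximum `W ^ k` forces all
-- numbers close to `W`.
module Balanced (k : ℕ) (1≤k : 1 ≤ k) (y : Fin k → ℕ) (W : ℕ) (1≤W : 1 ≤ W)
                (mean : ∑ (fins k) y ≡ k * W) (large : W ^ k ≤ 2 * ∏ k y) where

  rest : Fin k → Fin k → ℕ
  rest i j = ∏ k (y ∖ i ∖ j)

  -- AM-GM after replacing both y i and y j by their mean (all values doubled).
  averaged : ∀ {i j} → i ≢ j → (y i + y j) * ((y i + y j) * rest i j) ≤ 4 * W ^ k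
  averaged {i} {j} i≢j = cancel-≤ (k ^ k * 2 ^ k) (*-mono-≤ (1≤k^k k) (1≤m^n k (s≤s z≤n))) (begin
    k ^ k * 2 ^ k * (s * (s * rest i j))             ≡⟨ e₁ (k ^ k) (2 ^ k) s (rest i j) ⟩
    k ^ k * (s * (s * (2 ^ k * rest i j)))           ≡⟨ cong (λ a → k ^ k * (s * (s * a))) (sym (∏-∖∖-scale k 2 y i≢j)) ⟩
    k ^ k * (s * (s * (4 * ∏ k ((λ l → 2 * y l) ∖ i ∖ j)))) ≡⟨ e₂ (k ^ k) s _ ⟩
    4 * (k ^ k * (s * (s * ∏ k ((λ l → 2 * y l) ∖ i ∖ j)))) ≡⟨ cong (λ a → 4 * (k ^ k * a)) (sym ∏z) ⟩
    4 * (k ^ k * ∏ k z)                              ≤⟨ *-monoʳ-≤ 4 (am-gm k z) ⟩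
    4 * (∑ (fins k) z) ^ k                           ≡⟨ cong (λ a → 4 * a ^ k) ∑z ⟩
    4 * (k * 2 * W) ^ k                              ≡⟨ cong (4 *_) (trans (^-distrib-* (k * 2) W k) (cong (_* W ^ k) (^-distrib-* k 2 k))) ⟩
    4 * (k ^ k * 2 ^ k * W ^ k)                      ≡⟨ e₃ (k ^ k * 2 ^ k) (W ^ k) ⟩
    k ^ k * 2 ^ k * (4 * W ^ k)                      ∎)
    where
    s = y i + y j
    z : Fin k → ℕ
    z l = if does (l ≟ i) then s else (if does (l ≟ j) then s else 2 * y l)
    e₁ : ∀ K T s r → K * T * (s * (s * r)) ≡ K * (s * (s * (T * r)))
    e₁ = solve-∀
    e₂ : ∀ K s r → K * (s * (s * (4 * r))) ≡ 4 * (K * (s * (s * r)))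
    e₂ = solve-∀
    e₃ : ∀ a w → 4 * (a * w) ≡ a * (4 * w)
    e₃ = solve-∀
    zi : z i ≡ s
    zi with i ≟ i
    ... | yes _ = refl
    ... | no ≢  = ⊥-elim (≢ refl)
    zj : z j ≡ s
    zj with j ≟ i
    ... | yes _ = refl
    ... | no _ with j ≟ j
    ...   | yes _ = refl
    ...   | no ≢  = ⊥-elim (≢ refl)
    z-other : ∀ l → l ≢ j → (z ∖ i) l ≡ ((λ l → 2 * y l) ∖ i) l
    z-other l l≢j with l ≟ i
    ... | yes _ = refl
    ... | no _ with l ≟ j
    ...   | yes eq = ⊥-elim (l≢j eq)
    ...   | no _   = refl
    ∏z : ∏ k z ≡ s * (s * ∏ k ((λ l → 2 * y l) ∖ i ∖ j))
    ∏z = trans (∏-split₂ k z i≢j)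
               (trans (cong₂ (λ a b → a * (b * ∏ k (z ∖ i ∖ j))) zi zj)
                      (cong (λ a → s * (s * a)) (∏-cong k (∖-cong j z-other))))
    pointwise : ∀ l → z l + (𝟙 (l ≟ i) * (2 * y l) + 𝟙 (l ≟ j) * (2 * y l))
                    ≡ 2 * y l + (𝟙 (l ≟ i) * s + 𝟙 (l ≟ j) * s)
    pointwise l with l ≟ i | l ≟ j
    ... | yes refl | yes refl = ⊥-elim (i≢j refl)
    ... | yes refl | no _     = p (y i) s
      where
      p : ∀ a s → s + (1 * (2 * a) + 0) ≡ 2 * a + (1 * s + 0)
      p = solve-∀
    ... | no _     | yes refl = p (y j) s
      where
      p : ∀ a s → s + (0 + 1 * (2 * a)) ≡ 2 * a + (0 + 1 * s)
      p = solve-∀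
    ... | no _     | no _     = refl
    ∑z : ∑ (fins k) z ≡ k * 2 * W
    ∑z = +-cancelʳ-≡ (2 * y i + 2 * y j) _ _ (begin-equality
      ∑ (fins k) z + (2 * y i + 2 * y j)
        ≡⟨ cong (∑ (fins k) z +_) (cong₂ _+_ (sym (∑-δ k i (λ l → 2 * y l))) (sym (∑-δ k j (λ l → 2 * y l)))) ⟩
      ∑ (fins k) z + (∑[ l ∈ fins k ] (𝟙 (l ≟ i) * (2 * y l)) + ∑[ l ∈ fins k ] (𝟙 (l ≟ j) * (2 * y l)))
        ≡⟨ trans (cong (∑ (fins k) z +_) (sym (∑-+ (fins k) _ _))) (sym (∑-+ (fins k) z _)) ⟩
      ∑[ l ∈ fins k ] (z l + (𝟙 (l ≟ i) * (2 * y l) + 𝟙 (l ≟ j) * (2 * y l)))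
        ≡⟨ ∑-cong (fins k) pointwise ⟩
      ∑[ l ∈ fins k ] (2 * y l + (𝟙 (l ≟ i) * s + 𝟙 (l ≟ j) * s))
        ≡⟨ trans (∑-+ (fins k) _ _) (cong (∑ (fins k) (λ l → 2 * y l) +_) (∑-+ (fins k) _ _)) ⟩
      ∑[ l ∈ fins k ] (2 * y l) + (∑[ l ∈ fins k ] (𝟙 (l ≟ i) * s) + ∑[ l ∈ fins k ] (𝟙 (l ≟ j) * s))
        ≡⟨ cong₂ _+_ (∑-*ˡ (fins k) 2 y) (cong₂ _+_ (∑-δ k i (λ _ → s)) (∑-δ k j (λ _ → s))) ⟩
      2 * ∑ (fins k) y + (s + s)
        ≡⟨ cong (λ a → 2 * a + (s + s)) mean ⟩
      2 * (k * W) + (s + s)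
        ≡⟨ p k W (y i) (y j) ⟩
      k * 2 * W + (2 * y i + 2 * y j) ∎)
      where
      p : ∀ k W a b → 2 * (k * W) + ((a + b) + (a + b)) ≡ k * 2 * W + (2 * a + 2 * b)
      p = solve-∀

  product-eq : ∀ {i j} → i ≢ j → ∏ k y ≡ y i * (y j * rest i j)
  product-eq = ∏-split₂ k y

  1≤product : 1 ≤ ∏ k y
  1≤product with ∏ k y
  ... | zero  = ⊥-elim (<⇒≱ (1≤m^n k 1≤W) large)
  ... | suc _ = s≤s z≤n

  -- The 8 is the 4 of `averaged` times the 2 of `large`.
  comparable : ∀ i j → y i ≤ 8 * y j
  comparable i j with i ≟ j
  ... | yes refl = m≤m+n (y i) _
  ... | no i≢j   = cancel-≤ (y i * rest i j) 1≤ (begin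
    y i * rest i j * y i                          ≡⟨ e₁ (y i) (rest i j) ⟩
    y i * (y i * rest i j)                        ≤⟨ *-mono-≤ (m≤m+n (y i) (y j)) (*-monoˡ-≤ (rest i j) (m≤m+n (y i) (y j))) ⟩
    (y i + y j) * ((y i + y j) * rest i j)        ≤⟨ averaged i≢j ⟩
    4 * W ^ k                                     ≤⟨ *-monoʳ-≤ 4 large ⟩
    4 * (2 * ∏ k y)                               ≡⟨ cong (λ a → 4 * (2 * a)) (product-eq i≢j) ⟩
    4 * (2 * (y i * (y j * rest i j)))            ≡⟨ e₂ (y i) (y j) (rest i j) ⟩
    y i * rest i j * (8 * y j)                    ∎)
    where
    e₁ : ∀ a r → a * r * a ≡ a * (a * r)
    e₁ = solve-∀
    e₂ : ∀ a b r → 4 * (2 * (a * (b * r))) ≡ a * r * (8 * b)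
    e₂ = solve-∀
    e₃ : ∀ a b r → a * (b * r) ≡ a * r * b
    e₃ = solve-∀
    1≤ : 1 ≤ y i * rest i j
    1≤ with y i * rest i j | trans (product-eq i≢j) (e₃ (y i) (y j) (rest i j))
    ... | zero  | eq = ⊥-elim (<⇒≢ 1≤product (sym eq))
    ... | suc _ | _  = s≤s z≤n

  bounded : ∀ i → y i ≤ 8 * W
  bounded i = cancel-≤ k 1≤k (begin
    k * y i                        ≡⟨ sym (∑-const k (y i)) ⟩
    ∑[ j ∈ fins k ] y i            ≤⟨ ∑-mono (fins k) (comparable i) ⟩
    ∑[ j ∈ fins k ] (8 * y j)      ≡⟨ ∑-*ˡ (fins k) 8 y ⟩
    8 * ∑ (fins k) y               ≡⟨ cong (8 *_) mean ⟩
    8 * (k * W)                    ≡⟨ e k W ⟩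
    k * (8 * W)                    ∎)
    where
    e : ∀ k W → 8 * (k * W) ≡ k * (8 * W)
    e = solve-∀

  module _ (Δ : ℕ) (deficit : Δ + ∏ k y ≡ W ^ k) where

    -- Averaging gains `(y i + y j)² - 4 * y i * y j = (y i - y j)²` times `rest i
    -- j`, which `averaged` limits to `4 * Δ`; and `rest i j` is at least `W ^ k / (128 * W²)`
    -- because both omitted factors are at most `8 * W`.
    pair-deviation : ∀ i j → sq (y i) (y j) * W ^ k ≤ 512 * (W * W) * Δ
    pair-deviation i j with i ≟ j
    ... | yes refl = subst (λ z → z * z * W ^ k ≤ 512 * (W * W) * Δ) (sym (∣n-n∣≡0 (y i))) z≤n
    ... | no i≢j   = begin
      sq (y i) (y j) * W ^ k                          ≤⟨ *-monoʳ-≤ (sq (y i) (y j)) rest-large ⟩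
      sq (y i) (y j) * (128 * (W * W) * rest i j)     ≡⟨ e₁ (sq (y i) (y j)) (W * W) (rest i j) ⟩
      128 * (W * W) * (sq (y i) (y j) * rest i j)     ≤⟨ *-monoʳ-≤ (128 * (W * W)) d-rest ⟩
      128 * (W * W) * (4 * Δ)                         ≡⟨ e₂ (W * W) Δ ⟩
      512 * (W * W) * Δ                               ∎
      where
      e₁ : ∀ d w r → d * (128 * w * r) ≡ 128 * w * (d * r)
      e₁ = solve-∀
      e₂ : ∀ w D → 128 * w * (4 * D) ≡ 512 * w * D
      e₂ = solve-∀
      rest-large : W ^ k ≤ 128 * (W * W) * rest i j
      rest-large = begin
        W ^ k                                   ≤⟨ large ⟩
        2 * ∏ k y                               ≡⟨ cong (2 *_) (product-eq i≢j) ⟩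
        2 * (y i * (y j * rest i j))            ≤⟨ *-monoʳ-≤ 2 (*-mono-≤ (bounded i) (*-monoˡ-≤ (rest i j) (bounded j))) ⟩
        2 * (8 * W * (8 * W * rest i j))        ≡⟨ e W (rest i j) ⟩
        128 * (W * W) * rest i j                ∎
        where
        e : ∀ W r → 2 * (8 * W * (8 * W * r)) ≡ 128 * (W * W) * r
        e = solve-∀
      d-rest : sq (y i) (y j) * rest i j ≤ 4 * Δ
      d-rest = +-cancelʳ-≤ (4 * ∏ k y) _ _ (begin
        sq (y i) (y j) * rest i j + 4 * ∏ k y
          ≡⟨ cong (λ z → sq (y i) (y j) * rest i j + 4 * z) (product-eq i≢j) ⟩
        sq (y i) (y j) * rest i j + 4 * (y i * (y j * rest i j))
          ≡⟨ e₃ (sq (y i) (y j)) (y i) (y j) (rest i j) ⟩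
        (sq (y i) (y j) + 2 * (y i * y j) + 2 * (y i * y j)) * rest i j
          ≡⟨ cong (λ z → (z + 2 * (y i * y j)) * rest i j) (sq-expand (y i) (y j)) ⟩
        (y i * y i + y j * y j + 2 * (y i * y j)) * rest i j
          ≡⟨ e₄ (y i) (y j) (rest i j) ⟩
        (y i + y j) * ((y i + y j) * rest i j)
          ≤⟨ averaged i≢j ⟩
        4 * W ^ k
          ≡⟨ trans (cong (4 *_) (sym deficit)) (*-distribˡ-+ 4 Δ _) ⟩
        4 * Δ + 4 * ∏ k y ∎)
        where
        e₃ : ∀ d a b r → d * r + 4 * (a * (b * r)) ≡ (d + 2 * (a * b) + 2 * (a * b)) * r
        e₃ = solve-∀
        e₄ : ∀ a b r → (a * a + b * b + 2 * (a * b)) * r ≡ (a + b) * ((a + b) * r)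
        e₄ = solve-∀

    some-below : ∃ λ j → y j ≤ W
    some-below with any? (λ j → y j ≤? W)
    ... | yes p = p
    ... | no ¬p = ⊥-elim (<⇒≱ (*-monoʳ-< k {{>-nonZero 1≤k}} (n<1+n W)) (begin
      k * suc W                     ≡⟨ sym (∑-const k (suc W)) ⟩
      ∑[ j ∈ fins k ] suc W         ≤⟨ ∑-mono (fins k) (λ j → ≰⇒> (λ le → ¬p (j , le))) ⟩
      ∑ (fins k) y                  ≡⟨ mean ⟩
      k * W                         ∎))

    some-above : ∃ λ j → W ≤ y j
    some-above with any? (λ j → W ≤? y j)
    ... | yes p = p
    ... | no ¬p = ⊥-elim (<⇒≱ 1≤k (+-cancelʳ-≤ (k * W) _ _ (begin
      k + k * W                     ≡⟨ cong (k +_) (sym mean) ⟩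
      k + ∑ (fins k) y              ≡⟨ cong (_+ ∑ (fins k) y) (sym (trans (∑-const k 1) (*-identityʳ k))) ⟩
      ∑[ j ∈ fins k ] 1 + ∑ (fins k) y ≡⟨ sym (∑-+ (fins k) (λ _ → 1) y) ⟩
      ∑[ j ∈ fins k ] suc (y j)     ≤⟨ ∑-mono (fins k) (λ j → ≰⇒> (λ le → ¬p (j , le))) ⟩
      ∑[ j ∈ fins k ] W             ≡⟨ ∑-const k W ⟩
      k * W                         ∎)))

    -- As the mean is `W`, some `y j` is `W` or lies on the other side of it from `y i`, hence at
    -- least as far from `y i` as `W` is.
    deviation : ∀ i → sq (y i) W * W ^ k ≤ 512 * (W * W) * Δ
    deviation i with ≤-total W (y i)
    ... | inj₁ W≤y with some-below
    ...   | j , yj≤W = ≤-trans (*-monoˡ-≤ (W ^ k) (*-mono-≤ le le)) (pair-deviation i j)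
      where
      le : ∣ y i - W ∣ ≤ ∣ y i - y j ∣
      le = begin
        ∣ y i - W ∣     ≡⟨ m≤n⇒∣n-m∣≡n∸m W≤y ⟩
        y i ∸ W         ≤⟨ ∸-monoʳ-≤ (y i) yj≤W ⟩
        y i ∸ y j       ≤⟨ m∸n≤∣m-n∣ (y i) (y j) ⟩
        ∣ y i - y j ∣   ∎
    deviation i | inj₂ y≤W with some-above
    ...   | j , W≤yj = ≤-trans (*-monoˡ-≤ (W ^ k) (*-mono-≤ le le)) (pair-deviation i j)
      where
      le : ∣ y i - W ∣ ≤ ∣ y i - y j ∣
      le = begin
        ∣ y i - W ∣     ≡⟨ m≤n⇒∣m-n∣≡n∸m y≤W ⟩
        W ∸ y i         ≤⟨ ∸-monoˡ-≤ (y i) W≤yj ⟩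
        y j ∸ y i       ≤⟨ m∸n≤∣m-n∣ (y j) (y i) ⟩
        ∣ y j - y i ∣   ≡⟨ ∣-∣-comm (y j) (y i) ⟩
        ∣ y i - y j ∣   ∎

-- The linear Taylor terms at `W` cancel in the sum because `W` is the mean, so only squared
-- deviations remain, and these are bounded by the deficit. The powers of 8 come from `B = 8 * W`,
-- the bound on all `y i`.
power-sum≤ : ∀ k → 1 ≤ k → (y : Fin k → ℕ) (W : ℕ) → 1 ≤ W → ∑ (fins k) y ≡ k * W → W ^ k ≤ 2 * ∏ k y →
             ∀ Δ → Δ + ∏ k y ≡ W ^ k → ∑[ i ∈ fins k ] (y i ^ k) ≤ k * W ^ k + 8 * (k * k * k) * 8 ^ k * Δ
power-sum≤ k@(suc m) 1≤k y W 1≤W mean large Δ deficit =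
  cancel-≤ (64 * (W * W) * W ^ k) (*-mono-≤ (*-mono-≤ (s≤s (z≤n {63})) (*-mono-≤ 1≤W 1≤W)) (1≤m^n k 1≤W)) (+-cancelʳ-≤ (64 * (W * W) * W ^ k * (k * (m * W ^ k))) _ _ (begin
    64 * (W * W) * W ^ k * S + 64 * (W * W) * W ^ k * (k * (m * W ^ k))
      ≡⟨ e₁ (W * W) (W ^ k) S (k * (m * W ^ k)) ⟩
    W ^ k * (64 * (W * W) * (S + k * (m * W ^ k)))
      ≡⟨ cong (λ z → W ^ k * (64 * (W * W) * z)) (sym (trans (∑-+ (fins k) (λ i → y i ^ k) (λ _ → m * W ^ k)) (cong (S +_) (∑-const k _)))) ⟩
    W ^ k * (64 * (W * W) * ∑[ i ∈ fins k ] (y i ^ k + m * W ^ k))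
      ≡⟨ cong (W ^ k *_) (trans (cong (_* ∑ (fins k) (λ i → y i ^ k + m * W ^ k)) (e₂ W)) (sym (∑-*ˡ (fins k) (B * B) _))) ⟩
    W ^ k * ∑[ i ∈ fins k ] (B * B * (y i ^ k + m * W ^ k))
      ≤⟨ *-monoʳ-≤ (W ^ k) (∑-mono (fins k) (λ i → taylor-^ (y i) W B (sq (y i) W) m (bounded i) (m≤m+n W _) (sq-expand (y i) W))) ⟩
    W ^ k * ∑[ i ∈ fins k ] (B * B * (k * (y i * W ^ m)) + k * k * (B ^ k * sq (y i) W))
      ≡⟨ cong (W ^ k *_) (trans (∑-+ (fins k) (λ i → B * B * (k * (y i * W ^ m))) (λ i → k * k * (B ^ k * sq (y i) W))) (cong₂ _+_ first second)) ⟩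
    W ^ k * (B * B * (k * (k * W * W ^ m)) + k * k * (B ^ k * D))
      ≡⟨ e₃ (W ^ k) W k (W ^ m) (B ^ k) D ⟩
    64 * (W * W) * W ^ k * (k * (k * (W * W ^ m))) + k * k * B ^ k * (D * W ^ k)
      ≤⟨ +-monoʳ-≤ _ (*-monoʳ-≤ (k * k * B ^ k) D≤) ⟩
    64 * (W * W) * W ^ k * (k * (k * W ^ k)) + k * k * B ^ k * (k * (512 * (W * W) * Δ))
      ≡⟨ cong (λ z → 64 * (W * W) * W ^ k * (k * (k * W ^ k)) + k * k * z * (k * (512 * (W * W) * Δ))) (^-distrib-* 8 W k) ⟩
    64 * (W * W) * W ^ k * (k * (k * W ^ k)) + k * k * (8 ^ k * W ^ k) * (k * (512 * (W * W) * Δ))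
      ≡⟨ e₄ (W * W) (W ^ k) m (8 ^ k) Δ ⟩
    64 * (W * W) * W ^ k * (k * W ^ k + 8 * (k * k * k) * 8 ^ k * Δ) + 64 * (W * W) * W ^ k * (k * (m * W ^ k)) ∎))
  where
  open Balanced k 1≤k y W 1≤W mean large
  S = ∑[ i ∈ fins k ] (y i ^ k)
  D = ∑[ i ∈ fins k ] sq (y i) W
  B = 8 * W
  e₁ : ∀ w x s t → 64 * w * x * s + 64 * w * x * t ≡ x * (64 * w * (s + t))
  e₁ = solve-∀
  e₂ : ∀ W → 64 * (W * W) ≡ 8 * W * (8 * W)
  e₂ = solve-∀
  e₃ : ∀ x W k v b D → x * (8 * W * (8 * W) * (k * (k * W * v)) + k * k * (b * D))
       ≡ 64 * (W * W) * x * (k * (k * (W * v))) + k * k * b * (D * x)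
  e₃ = solve-∀
  e₄ : ∀ w x m p Δ → 64 * w * x * (suc m * (suc m * x)) + suc m * suc m * (p * x) * (suc m * (512 * w * Δ))
       ≡ 64 * w * x * (suc m * x + 8 * (suc m * suc m * suc m) * p * Δ) + 64 * w * x * (suc m * (m * x))
  e₄ = solve-∀
  first : ∑[ i ∈ fins k ] (B * B * (k * (y i * W ^ m))) ≡ B * B * (k * (k * W * W ^ m))
  first = trans (∑-*ˡ (fins k) (B * B) _) (cong (B * B *_) (trans (∑-*ˡ (fins k) k _)
            (cong (k *_) (trans (∑-*ʳ (fins k) (W ^ m) y) (cong (_* W ^ m) mean)))))
  second : ∑[ i ∈ fins k ] (k * k * (B ^ k * sq (y i) W)) ≡ k * k * (B ^ k * D)
  second = trans (∑-*ˡ (fins k) (k * k) _) (cong (k * k *_) (∑-*ˡ (fins k) (B ^ k) _))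
  D≤ : D * W ^ k ≤ k * (512 * (W * W) * Δ)
  D≤ = begin
    D * W ^ k                                 ≡⟨ sym (∑-*ʳ (fins k) (W ^ k) (λ i → sq (y i) W)) ⟩
    ∑[ i ∈ fins k ] (sq (y i) W * W ^ k)      ≤⟨ ∑-mono (fins k) (deviation Δ deficit) ⟩
    ∑[ i ∈ fins k ] (512 * (W * W) * Δ)       ≡⟨ ∑-const k _ ⟩
    k * (512 * (W * W) * Δ)                   ∎

-- Weighted counts of embeddings

upair-injective : ∀ {k} {i j a b : Fin k} → upair i j ≡ upair a b → (i ≡ a × j ≡ b) ⊎ (i ≡ b × j ≡ a)
upair-injective {i = i} {j} {a} {b} eq with i FinP.≤? j | a FinP.≤? b
... | yes _ | yes _ = inj₁ (cong proj₁ eq , cong proj₂ eq)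
... | yes _ | no _  = inj₂ (cong proj₁ eq , cong proj₂ eq)
... | no _  | yes _ = inj₂ (cong proj₂ eq , cong proj₁ eq)
... | no _  | no _  = inj₁ (cong proj₂ eq , cong proj₁ eq)

-- The rainbow property: an edge colour determines its two endpoints, though not their order. The
-- common colour of the non-edges determines nothing, hence the premise that `i j` is an edge.
χ-injective : ∀ {k} (R : Graph k) {i j a b} → adj R i j ≡ true → χ R i j ≡ χ R a b →
              (i ≡ a × j ≡ b) ⊎ (i ≡ b × j ≡ a)
χ-injective R {i} {j} {a} {b} ij eq with adj R i j | adj R a b
χ-injective R refl eq | true | true  = upair-injective (just-injective eq)
χ-injective R refl () | true | false

edge-≢ : ∀ {k} (R : Graph k) {i j} → adj R i j ≡ true → i ≢ j
edge-≢ R {i} ij refl with trans (sym ij) (irrefl R i)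
... | ()

-- Turns a degree into the product gained by doubling the weight on the neighbours.
∏-2^∣∣ : ∀ k (f : Fin k → Bool) → ∏ k (λ l → if f l then 2 else 1) ≡ 2 ^ ∣ tabulate f ∣
∏-2^∣∣ zero    f = refl
∏-2^∣∣ (suc k) f with f zero
... | true  = cong (2 *_) (∏-2^∣∣ k (f ∘ suc))
... | false = trans (+-identityʳ _) (∏-2^∣∣ k (f ∘ suc))

module Weighted {k n : ℕ} (R : Graph k) (G : TGraph R n) where

  Emb : Vec (Fin n) k → Set
  Emb σ = (∀ i j → lookup σ i ≡ lookup σ j → i ≡ j)
        × (∀ i j → i ≢ j → col G (lookup σ i) (lookup σ j) ≡ χ R i j)

  abstract
    emb? : ∀ σ → Dec (Emb σ)
    emb? σ = all? (λ i → all? (λ j → (lookup σ i ≟ lookup σ j) →-dec (i ≟ j)))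
       ×-dec all? (λ i → all? (λ j → ¬? (i ≟ j) →-dec (col G (lookup σ i) (lookup σ j) ≟Col χ R i j)))

  maps : List (Vec (Fin n) k)
  maps = vecs (fins n) k

  wt : (Fin n → ℕ) → Vec (Fin n) k → Fin k → ℕ
  wt w σ l = w (lookup σ l)

  tot : (Fin n → ℕ) → ℕ
  tot w = ∑ (fins n) w

  h : (Fin n → ℕ) → ℕ
  h w = ∑[ σ ∈ maps ] (𝟙 (emb? σ) * ∏ k (wt w σ))

  -- The partial derivatives of h: by the weight of x in role i, and by those
  -- of x in role i and y in role j.
  E₁ : (Fin n → ℕ) → Fin k → Fin n → ℕ
  E₁ w i x = ∑[ σ ∈ maps ] (𝟙 (emb? σ) * (𝟙 (x ≟ lookup σ i) * ∏ k (wt w σ ∖ i)))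

  E₂ : (Fin n → ℕ) → Fin k → Fin k → Fin n → Fin n → ℕ
  E₂ w i j x y = ∑[ σ ∈ maps ] (𝟙 (emb? σ) * (𝟙 (x ≟ lookup σ i) * (𝟙 (y ≟ lookup σ j) * ∏ k (wt w σ ∖ i ∖ j))))

  Valid : ℕ → ℕ → Set
  Valid P Q = ∀ w → Q * h w ≤ P * tot w ^ k

  h-scale : ∀ c w → h (λ x → c * w x) ≡ c ^ k * h w
  h-scale c w = trans (∑-cong maps pointwise) (∑-*ˡ maps (c ^ k) _)
    where
    e : ∀ a b c → a * (b * c) ≡ b * (a * c)
    e = solve-∀
    pointwise : ∀ σ → 𝟙 (emb? σ) * ∏ k (λ l → c * wt w σ l) ≡ c ^ k * (𝟙 (emb? σ) * ∏ k (wt w σ))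
    pointwise σ = trans (cong (𝟙 (emb? σ) *_) (∏-scale k c (wt w σ))) (e (𝟙 (emb? σ)) (c ^ k) _)

  tot-scale : ∀ c w → tot (λ x → c * w x) ≡ c * tot w
  tot-scale c w = ∑-*ˡ (fins n) c w

  h≤tot^k : ∀ w → h w ≤ tot w ^ k
  h≤tot^k w = begin
    h w                                  ≤⟨ ∑-mono maps (λ σ → 𝟙-*-≤ (emb? σ) (λ _ → ≤-refl)) ⟩
    ∑[ σ ∈ maps ] ∏ k (wt w σ)           ≡⟨ ∑-∏ n k (λ _ → w) ⟩
    ∏ k (λ _ → tot w)                    ≡⟨ ∏-const k (tot w) ⟩
    tot w ^ k                            ∎

  -- For testing validity: `w` will be a modified weight vector whose products dominate the terms
  -- `F` along embeddings.
  emb-sum≤h : ∀ c d (F : Vec (Fin n) k → ℕ) w → (∀ σ → Emb σ → c * F σ ≤ d * ∏ k (wt w σ)) →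
            c * ∑[ σ ∈ maps ] (𝟙 (emb? σ) * F σ) ≤ d * h w
  emb-sum≤h c d F w le = begin
    c * ∑[ σ ∈ maps ] (𝟙 (emb? σ) * F σ)               ≡⟨ sym (∑-*ˡ maps c _) ⟩
    ∑[ σ ∈ maps ] (c * (𝟙 (emb? σ) * F σ))             ≡⟨ ∑-cong maps (λ σ → e c (𝟙 (emb? σ)) (F σ)) ⟩
    ∑[ σ ∈ maps ] (𝟙 (emb? σ) * (c * F σ))             ≤⟨ ∑-mono maps (λ σ → 𝟙-*-mono (emb? σ) (le σ)) ⟩
    ∑[ σ ∈ maps ] (𝟙 (emb? σ) * (d * ∏ k (wt w σ)))    ≡⟨ ∑-cong maps (λ σ → e (𝟙 (emb? σ)) d _) ⟩
    ∑[ σ ∈ maps ] (d * (𝟙 (emb? σ) * ∏ k (wt w σ)))    ≡⟨ ∑-*ˡ maps d _ ⟩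
    d * h w                                            ∎
    where
    e : ∀ a b c → a * (b * c) ≡ b * (a * c)
    e = solve-∀

  -- Euler's identity for the second derivative, with a coefficient on pairs: an embedding occurs
  -- exactly for `x` and `y` its values at `i` and `j`, where `w x * w y` restores the two omitted
  -- factors.
  ∑∑-E₂ : ∀ w {i j} → i ≢ j → (c : Fin n → Fin n → ℕ) →
          ∑[ x ∈ fins n ] ∑[ y ∈ fins n ] (c x y * (w x * (w y * E₂ w i j x y)))
          ≡ ∑[ σ ∈ maps ] (𝟙 (emb? σ) * (c (lookup σ i) (lookup σ j) * ∏ k (wt w σ)))
  ∑∑-E₂ w {i} {j} i≢j c = begin-equality
    ∑[ x ∈ fins n ] ∑[ y ∈ fins n ] (c x y * (w x * (w y * E₂ w i j x y)))
      ≡⟨ ∑-cong (fins n) (λ x → ∑-cong (fins n) (λ y → inward x y)) ⟩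
    ∑[ x ∈ fins n ] ∑[ y ∈ fins n ] ∑[ σ ∈ maps ] t x y σ
      ≡⟨ ∑-cong (fins n) (λ x → ∑-swap (fins n) maps (t x)) ⟩
    ∑[ x ∈ fins n ] ∑[ σ ∈ maps ] ∑[ y ∈ fins n ] t x y σ
      ≡⟨ ∑-swap (fins n) maps (λ x σ → ∑[ y ∈ fins n ] t x y σ) ⟩
    ∑[ σ ∈ maps ] ∑[ x ∈ fins n ] ∑[ y ∈ fins n ] t x y σ
      ≡⟨ ∑-cong maps collapse ⟩
    ∑[ σ ∈ maps ] (𝟙 (emb? σ) * (c (lookup σ i) (lookup σ j) * ∏ k (wt w σ))) ∎
    where
    p : Vec (Fin n) k → ℕ
    p σ = ∏ k (wt w σ ∖ i ∖ j)
    u : Fin n → Fin n → Vec (Fin n) k → ℕ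
    u x y σ = 𝟙 (emb? σ) * (c x y * (w x * (w y * p σ)))
    t : Fin n → Fin n → Vec (Fin n) k → ℕ
    t x y σ = 𝟙 (x ≟ lookup σ i) * (𝟙 (y ≟ lookup σ j) * u x y σ)
    e : ∀ c a b m d₁ d₂ p → c * (a * (b * (m * (d₁ * (d₂ * p))))) ≡ d₁ * (d₂ * (m * (c * (a * (b * p)))))
    e = solve-∀
    inward : ∀ x y → c x y * (w x * (w y * E₂ w i j x y)) ≡ ∑[ σ ∈ maps ] t x y σ
    inward x y = sym (trans (∑-cong maps (λ σ → sym (e (c x y) (w x) (w y) (𝟙 (emb? σ)) (𝟙 (x ≟ lookup σ i)) (𝟙 (y ≟ lookup σ j)) (p σ))))
      (trans (∑-*ˡ maps (c x y) _) (cong (c x y *_) (trans (∑-*ˡ maps (w x) _) (cong (w x *_) (∑-*ˡ maps (w y) _))))))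
    collapse : ∀ σ → ∑[ x ∈ fins n ] ∑[ y ∈ fins n ] t x y σ ≡ 𝟙 (emb? σ) * (c (lookup σ i) (lookup σ j) * ∏ k (wt w σ))
    collapse σ = begin-equality
      ∑[ x ∈ fins n ] ∑[ y ∈ fins n ] t x y σ
        ≡⟨ ∑-cong (fins n) (λ x → ∑-*ˡ (fins n) (𝟙 (x ≟ lookup σ i)) (λ y → 𝟙 (y ≟ lookup σ j) * u x y σ)) ⟩
      ∑[ x ∈ fins n ] (𝟙 (x ≟ lookup σ i) * ∑[ y ∈ fins n ] (𝟙 (y ≟ lookup σ j) * u x y σ))
        ≡⟨ ∑-δ n (lookup σ i) _ ⟩
      ∑[ y ∈ fins n ] (𝟙 (y ≟ lookup σ j) * u (lookup σ i) y σ)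
        ≡⟨ ∑-δ n (lookup σ j) _ ⟩
      u (lookup σ i) (lookup σ j) σ
        ≡⟨ cong (λ z → 𝟙 (emb? σ) * (c (lookup σ i) (lookup σ j) * z)) (sym (∏-split₂ k (wt w σ) i≢j)) ⟩
      𝟙 (emb? σ) * (c (lookup σ i) (lookup σ j) * ∏ k (wt w σ)) ∎

  measure : {Z : Fin n → Set} → (∀ z → Dec (Z z)) → (Fin n → ℕ) → ℕ
  measure Z? w = ∑[ z ∈ fins n ] (𝟙 (Z? z) * w z)

  private
    complement : {Z : Fin n → Set} (Z? : ∀ z → Dec (Z z)) (w : Fin n → ℕ) →
                 measure (λ z → ¬? (Z? z)) w + measure Z? w ≡ tot w
    complement Z? w = trans (sym (∑-+ (fins n) (λ z → 𝟙 (¬? (Z? z)) * w z) (λ z → 𝟙 (Z? z) * w z))) (∑-cong (fins n) pointwise)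
      where
      pointwise : ∀ z → 𝟙 (¬? (Z? z)) * w z + 𝟙 (Z? z) * w z ≡ w z
      pointwise z with Z? z
      ... | yes _ = +-identityʳ (w z)
      ... | no _  = trans (+-identityʳ _) (+-identityʳ (w z))

  -- Remove Z and give x and y the extra weight gW: the total weight drops from
  -- kW to (k-g)W, so validity of P/Q makes copies through x and y avoiding Z rare.
  avoiding-rare : ∀ {P Q} → Valid P Q → ∀ g T w {Z : Fin n → Set} (Z? : ∀ z → Dec (Z z)) {i j} x y → i ≢ j →
    1 ≤ k → 1 ≤ g → k * k * T ≤ 2 ^ g →
    (∀ σ → Emb σ → x ≡ lookup σ i → ∀ l → l ≢ i → ¬ Z (lookup σ l)) →
    3 * (g * tot w) ≤ k * measure Z? w →
    Q * (T * (tot w * tot w * E₂ w i j x y)) ≤ P * tot w ^ k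
  avoiding-rare {P} {Q} valid g T w Z? {i} {j} x y i≢j 1≤k 1≤g kkT≤2^g avoids big =
    cancel-≤ (k * k * k ^ k) (*-mono-≤ (*-mono-≤ 1≤k 1≤k) (1≤k^k k)) (begin
      k * k * k ^ k * (Q * (T * (W * W * E)))           ≡⟨ e₁ (k * k) (k ^ k) Q T (W * W) E ⟩
      k * k * T * (Q * (W * W * k ^ k * E))             ≤⟨ *-mono-≤ kkT≤2^g (*-monoʳ-≤ Q (*-monoˡ-≤ E (*-monoˡ-≤ (k ^ k) (*-mono-≤ W≤ W≤)))) ⟩
      2 ^ g * (Q * (g * W * (g * W) * k ^ k * E))       ≤⟨ *-monoʳ-≤ (2 ^ g) (*-monoʳ-≤ Q (emb-sum≤h (g * W * (g * W) * k ^ k) (k * k) _ w″ pointwise)) ⟩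
      2 ^ g * (Q * (k * k * h w″))                      ≡⟨ e₂ (2 ^ g) Q (k * k) (h w″) ⟩
      2 ^ g * (k * k) * (Q * h w″)                      ≤⟨ *-monoʳ-≤ (2 ^ g * (k * k)) (valid w″) ⟩
      2 ^ g * (k * k) * (P * tot w″ ^ k)                ≡⟨ e₃ (2 ^ g) (k * k) P (tot w″ ^ k) ⟩
      k * k * P * (2 ^ g * tot w″ ^ k)                  ≤⟨ *-monoʳ-≤ (k * k * P) gain ⟩
      k * k * P * (k * W) ^ k                           ≡⟨ cong (k * k * P *_) (^-distrib-* k W k) ⟩
      k * k * P * (k ^ k * W ^ k)                       ≡⟨ e₄ (k * k) P (k ^ k) (W ^ k) ⟩
      k * k * k ^ k * (P * W ^ k)                       ∎)
    where
    W = tot w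
    E = E₂ w i j x y
    w″ : Fin n → ℕ
    w″ z = k * (𝟙 (¬? (Z? z)) * w z) + (𝟙 (z ≟ x) * (g * W) + 𝟙 (z ≟ y) * (g * W))
    e₁ : ∀ a b Q T w E → a * b * (Q * (T * (w * E))) ≡ a * T * (Q * (w * b * E))
    e₁ = solve-∀
    e₂ : ∀ a Q b h → a * (Q * (b * h)) ≡ a * b * (Q * h)
    e₂ = solve-∀
    e₃ : ∀ a b P h → a * b * (P * h) ≡ b * P * (a * h)
    e₃ = solve-∀
    e₄ : ∀ a P b h → a * P * (b * h) ≡ a * b * (P * h)
    e₄ = solve-∀
    W≤ : W ≤ g * W
    W≤ = ≤-trans (≤-reflexive (sym (+-identityʳ W))) (*-monoˡ-≤ W 1≤g)
    -- After scaling by `k` the set `Z` frees at least `3 * g * W`; two thirds of this return to `x`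
    -- and `y`, and the last third is the drop.
    total : tot w″ + g * W ≤ k * W
    total = begin
      tot w″ + g * W
        ≡⟨ cong (_+ g * W) (trans (∑-+ (fins n) _ _) (cong₂ _+_ (∑-*ˡ (fins n) k _)
             (trans (∑-+ (fins n) _ _) (cong₂ _+_ (∑-δ n x (λ _ → g * W)) (∑-δ n y (λ _ → g * W)))))) ⟩
      k * N + (g * W + g * W) + g * W      ≡⟨ e (k * N) (g * W) ⟩
      k * N + 3 * (g * W)                  ≤⟨ +-monoʳ-≤ (k * N) big ⟩
      k * N + k * measure Z? w             ≡⟨ sym (*-distribˡ-+ k N _) ⟩
      k * (N + measure Z? w)               ≡⟨ cong (k *_) (complement Z? w) ⟩
      k * W                                ∎
      where
      N = measure (λ z → ¬? (Z? z)) w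
      e : ∀ a b → a + (b + b) + b ≡ a + 3 * b
      e = solve-∀
    gain : 2 ^ g * tot w″ ^ k ≤ (k * W) ^ k
    gain = go k 1≤k total
      where
      go : ∀ k → 1 ≤ k → tot w″ + g * W ≤ k * W → 2 ^ g * tot w″ ^ k ≤ (k * W) ^ k
      go (suc m) _ le = ≤-trans (power-gain (tot w″) W m g le) (^-monoˡ-≤ (suc m) le)
    at-x : g * W ≤ w″ x
    at-x = ≤-trans (≤-𝟙-* (x ≟ x) refl) (≤-trans (m≤m+n _ _) (m≤n+m _ (k * (𝟙 (¬? (Z? x)) * w x))))
    at-y : g * W ≤ w″ y
    at-y = ≤-trans (≤-𝟙-* (y ≟ y) refl) (≤-trans (m≤n+m _ (𝟙 (y ≟ x) * (g * W))) (m≤n+m _ (k * (𝟙 (¬? (Z? y)) * w y))))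
    elsewhere : ∀ z → ¬ _ → k * w z ≤ w″ z
    elsewhere z ¬Z = ≤-trans (*-monoʳ-≤ k (≤-𝟙-* (¬? (Z? z)) ¬Z)) (m≤m+n _ _)
    -- The values at `i` and `j` weigh at least `g * W`, the other `k - 2` weights are multiplied by
    -- `k`; the factor `k * k` compensates for writing `k ^ k`.
    pointwise : ∀ σ → Emb σ → g * W * (g * W) * k ^ k * (𝟙 (x ≟ lookup σ i) * (𝟙 (y ≟ lookup σ j) * ∏ k (wt w σ ∖ i ∖ j)))
                              ≤ k * k * ∏ k (wt w″ σ)
    pointwise σ em = begin
      c * (𝟙 (x ≟ lookup σ i) * (𝟙 (y ≟ lookup σ j) * p))   ≡⟨ f c (𝟙 (x ≟ lookup σ i)) (𝟙 (y ≟ lookup σ j)) p ⟩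
      𝟙 (x ≟ lookup σ i) * (𝟙 (y ≟ lookup σ j) * (c * p))   ≤⟨ 𝟙-*-≤ (x ≟ lookup σ i) (λ x≡ → 𝟙-*-≤ (y ≟ lookup σ j) (λ y≡ → main x≡ y≡)) ⟩
      k * k * ∏ k (wt w″ σ)                                 ∎
      where
      c = g * W * (g * W) * k ^ k
      p = ∏ k (wt w σ ∖ i ∖ j)
      f : ∀ c a b p → c * (a * (b * p)) ≡ a * (b * (c * p))
      f = solve-∀
      f₁ : ∀ a b p → a * a * b * p ≡ a * (a * (b * p))
      f₁ = solve-∀
      f₂ : ∀ a k q → a * (a * (k * k * q)) ≡ k * k * (a * (a * q))
      f₂ = solve-∀
      main : x ≡ lookup σ i → y ≡ lookup σ j → c * p ≤ k * k * ∏ k (wt w″ σ)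
      main x≡ y≡ = begin
        c * p                                                        ≡⟨ f₁ (g * W) (k ^ k) p ⟩
        g * W * (g * W * (k ^ k * p))                                ≡⟨ cong (λ z → g * W * (g * W * z)) (sym (∏-∖∖-scale k k (wt w σ) i≢j)) ⟩
        g * W * (g * W * (k * k * ∏ k ((λ l → k * wt w σ l) ∖ i ∖ j))) ≡⟨ f₂ (g * W) k _ ⟩
        k * k * (g * W * (g * W * ∏ k ((λ l → k * wt w σ l) ∖ i ∖ j)))
          ≤⟨ *-monoʳ-≤ (k * k) (*-mono-≤ (subst (λ z → g * W ≤ w″ z) x≡ at-x) (*-mono-≤ (subst (λ z → g * W ≤ w″ z) y≡ at-y)
               (∏-mono k (∖-mono j (λ l _ → ∖-mono i (λ m m≢i → elsewhere (lookup σ m) (avoids σ em x≡ m m≢i)) l))))) ⟩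
        k * k * (wt w″ σ i * (wt w″ σ j * ∏ k (wt w″ σ ∖ i ∖ j)))     ≡⟨ cong (k * k *_) (sym (∏-split₂ k (wt w″ σ) i≢j)) ⟩
        k * k * ∏ k (wt w″ σ)                                        ∎

  -- Double the weight of Z and give x the extra weight W: the total weight grows
  -- at most by the factor 1 + (3g+1)/k, while copies with x in role r gain about 2^deg.
  concentrated-rare : ∀ {P Q} → Valid P Q → ∀ g w {Z : Fin n → Set} (Z? : ∀ z → Dec (Z z)) r i x → 1 ≤ k →
    32 * k * 4 ^ (3 * g + 1) ≤ 2 ^ degree R r →
    (∀ σ → Emb σ → x ≡ lookup σ r → ∀ l → adj R r l ≡ true → l ≢ i → Z (lookup σ l)) →
    k * measure Z? w ≤ 3 * (g * tot w) →
    16 * (Q * (tot w * E₁ w r x)) ≤ P * tot w ^ k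
  concentrated-rare {P} {Q} valid g w Z? r i x 1≤k degree-large meets light =
    cancel-≤ (2 * k * 4 ^ s * k ^ k) (*-mono-≤ (*-mono-≤ (*-mono-≤ (s≤s (z≤n {1})) 1≤k) (1≤m^n s (s≤s z≤n))) (1≤k^k k)) (begin
      2 * k * 4 ^ s * k ^ k * (16 * (Q * (W * E)))           ≡⟨ e₁ k (4 ^ s) (k ^ k) Q W E ⟩
      32 * k * 4 ^ s * (Q * (W * k ^ k * E))                 ≤⟨ *-monoˡ-≤ _ degree-large ⟩
      2 ^ D * (Q * (W * k ^ k * E))                          ≡⟨ e₂ (2 ^ D) Q (W * k ^ k) E ⟩
      Q * (W * k ^ k * 2 ^ D * E)                            ≤⟨ *-monoʳ-≤ Q (emb-sum≤h (W * k ^ k * 2 ^ D) (2 * k) _ w″ pointwise) ⟩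
      Q * (2 * k * h w″)                                     ≡⟨ e₃ Q (2 * k) (h w″) ⟩
      2 * k * (Q * h w″)                                     ≤⟨ *-monoʳ-≤ (2 * k) (valid w″) ⟩
      2 * k * (P * tot w″ ^ k)                               ≤⟨ *-monoʳ-≤ (2 * k) (*-monoʳ-≤ P (^-monoˡ-≤ k total)) ⟩
      2 * k * (P * ((k + s) * W) ^ k)                        ≡⟨ cong (λ z → 2 * k * (P * z)) (^-distrib-* (k + s) W k) ⟩
      2 * k * (P * ((k + s) ^ k * W ^ k))                    ≤⟨ *-monoʳ-≤ (2 * k) (*-monoʳ-≤ P (*-monoˡ-≤ (W ^ k) (power≤4^ k s))) ⟩
      2 * k * (P * (4 ^ s * k ^ k * W ^ k))                  ≡⟨ e₄ (2 * k) P (4 ^ s) (k ^ k) (W ^ k) ⟩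
      2 * k * 4 ^ s * k ^ k * (P * W ^ k)                    ∎)
    where
    W = tot w
    D = degree R r
    E = E₁ w r x
    s = 3 * g + 1
    w″ : Fin n → ℕ
    w″ z = k * (w z + 𝟙 (Z? z) * w z) + 𝟙 (z ≟ x) * W
    e₁ : ∀ k a b Q W E → 2 * k * a * b * (16 * (Q * (W * E))) ≡ 32 * k * a * (Q * (W * b * E))
    e₁ = solve-∀
    e₂ : ∀ a Q b E → a * (Q * (b * E)) ≡ Q * (b * a * E)
    e₂ = solve-∀
    e₃ : ∀ Q a h → Q * (a * h) ≡ a * (Q * h)
    e₃ = solve-∀
    e₄ : ∀ a P b c d → a * (P * (b * c * d)) ≡ a * b * c * (P * d)
    e₄ = solve-∀
    total : tot w″ ≤ (k + s) * W
    total = begin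
      tot w″                                 ≡⟨ trans (∑-+ (fins n) _ _) (cong₂ _+_ (trans (∑-*ˡ (fins n) k _) (cong (k *_) (∑-+ (fins n) w _))) (∑-δ n x (λ _ → W))) ⟩
      k * (W + measure Z? w) + W             ≡⟨ cong (_+ W) (*-distribˡ-+ k W _) ⟩
      k * W + k * measure Z? w + W           ≤⟨ +-monoˡ-≤ W (+-monoʳ-≤ (k * W) light) ⟩
      k * W + 3 * (g * W) + W                ≡⟨ e k g W ⟩
      (k + s) * W                            ∎
      where
      e : ∀ k g W → k * W + 3 * (g * W) + W ≡ (k + (3 * g + 1)) * W
      e = solve-∀
    -- The factors by which the weights of the neighbours of role `r` grow. Role `i` is left out
    -- since its image need not lie in `Z`; this loses at most a factor 2.
    c′ c : Fin k → ℕ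
    c′ l = if adj R r l then 2 else 1
    c = c′ ∖ i
    c′≤2 : ∀ l → c′ l ≤ 2
    c′≤2 l with adj R r l
    ... | true  = ≤-refl
    ... | false = s≤s z≤n
    c-r : c r ≡ 1
    c-r with r ≟ i
    ... | yes _ = refl
    ... | no _ rewrite irrefl R r = refl
    2^D≤ : 2 ^ D ≤ 2 * ∏ k (c ∖ r)
    2^D≤ = begin
      2 ^ D                          ≡⟨ sym (∏-2^∣∣ k (adj R r)) ⟩
      ∏ k c′                         ≡⟨ ∏-split k c′ i ⟩
      c′ i * ∏ k c                   ≤⟨ *-monoˡ-≤ (∏ k c) (c′≤2 i) ⟩
      2 * ∏ k c                      ≡⟨ cong (2 *_) (trans (∏-split k c r) (trans (cong (_* ∏ k (c ∖ r)) c-r) (+-identityʳ _))) ⟩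
      2 * ∏ k (c ∖ r)                ∎
    at-x : W ≤ w″ x
    at-x = ≤-trans (≤-𝟙-* (x ≟ x) refl) (m≤n+m _ (k * (w x + 𝟙 (Z? x) * w x)))
    pointwise : ∀ σ → Emb σ → W * k ^ k * 2 ^ D * (𝟙 (x ≟ lookup σ r) * ∏ k (wt w σ ∖ r)) ≤ 2 * k * ∏ k (wt w″ σ)
    pointwise σ em = begin
      W * k ^ k * 2 ^ D * (𝟙 (x ≟ lookup σ r) * p)    ≡⟨ e₃ (W * k ^ k * 2 ^ D) (𝟙 (x ≟ lookup σ r)) p ⟩
      𝟙 (x ≟ lookup σ r) * (W * k ^ k * 2 ^ D * p)    ≤⟨ 𝟙-*-≤ (x ≟ lookup σ r) main ⟩
      2 * k * ∏ k (wt w″ σ)                           ∎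
      where
      p = ∏ k (wt w σ ∖ r)
      f₁ : ∀ W K c p → W * K * (2 * c) * p ≡ 2 * (W * (K * (c * p)))
      f₁ = solve-∀
      f₂ : ∀ W k q → 2 * (W * (k * q)) ≡ 2 * k * (W * q)
      f₂ = solve-∀
      merge : ∀ l → (c ∖ r) l * (wt w σ ∖ r) l ≡ ((λ l → c l * wt w σ l) ∖ r) l
      merge l with l ≟ r
      ... | yes _ = refl
      ... | no _  = refl
      main : x ≡ lookup σ r → W * k ^ k * 2 ^ D * p ≤ 2 * k * ∏ k (wt w″ σ)
      main x≡ = begin
        W * k ^ k * 2 ^ D * p                               ≤⟨ *-monoˡ-≤ p (*-monoʳ-≤ (W * k ^ k) 2^D≤) ⟩
        W * k ^ k * (2 * ∏ k (c ∖ r)) * p                   ≡⟨ f₁ W (k ^ k) (∏ k (c ∖ r)) p ⟩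
        2 * (W * (k ^ k * (∏ k (c ∖ r) * p)))               ≡⟨ cong (λ z → 2 * (W * (k ^ k * z))) (trans (sym (∏-* k (c ∖ r) (wt w σ ∖ r))) (∏-cong k merge)) ⟩
        2 * (W * (k ^ k * ∏ k ((λ l → c l * wt w σ l) ∖ r))) ≡⟨ cong (λ z → 2 * (W * z)) (sym (∏-∖-scale k k (λ l → c l * wt w σ l) r)) ⟩
        2 * (W * (k * ∏ k ((λ l → k * (c l * wt w σ l)) ∖ r))) ≡⟨ f₂ W k _ ⟩
        2 * k * (W * ∏ k ((λ l → k * (c l * wt w σ l)) ∖ r))
          ≤⟨ *-monoʳ-≤ (2 * k) (*-mono-≤ (subst (λ z → W ≤ w″ z) x≡ at-x) (∏-mono k (∖-mono r (λ l _ → ≤-trans (*-monoʳ-≤ k (elsewhere l)) (m≤m+n _ _))))) ⟩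
        2 * k * (wt w″ σ r * ∏ k (wt w″ σ ∖ r))             ≡⟨ cong (2 * k *_) (sym (∏-split k (wt w″ σ) r)) ⟩
        2 * k * ∏ k (wt w″ σ)                               ∎
        where
        elsewhere : ∀ l → c l * wt w σ l ≤ wt w σ l + 𝟙 (Z? (lookup σ l)) * wt w σ l
        elsewhere l with l ≟ i
        ... | yes _ = ≤-trans (≤-reflexive (+-identityʳ _)) (m≤m+n _ _)
        ... | no l≢i with adj R r l in eq
        ...   | false = ≤-trans (≤-reflexive (+-identityʳ _)) (m≤m+n _ _)
        ...   | true  = +-monoʳ-≤ (wt w σ l) (≤-trans (≤-reflexive (+-identityʳ _)) (≤-𝟙-* (Z? (lookup σ l)) (meets σ em x≡ l eq l≢i)))

-- Roles and funky pairs

-- If `p` collapses every edge, connectedness makes it constant. Otherwise some edge has two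
-- distinct images and, its colour being unique, is mapped to itself; a second neighbour excludes
-- that it is flipped, and fixedness then spreads along paths.
rigid : ∀ {k} (R : Graph k) → Connected R → (∀ i j → ∃ λ l → adj R i l ≡ true × l ≢ j) →
        (p : Fin k → Fin k) → (∀ i j → p i ≢ p j → χ R i j ≡ χ R (p i) (p j)) →
        (∀ i → p i ≡ i) ⊎ (∀ i j → p i ≡ p j)
rigid {k} R connected other p preserves with any? (λ i → any? (λ j → (adj R i j Bool≟ true) ×-dec ¬? (p i ≟ p j)))
... | no none = inj₂ (λ i j → along (connected i j))
  where
  along : ∀ {i j} → Reach R i j → p i ≡ p j
  along here = refl
  along (step {i} {j} ij path) with p i ≟ p j
  ... | yes eq = trans eq (along path)
  ... | no ≢   = ⊥-elim (none (i , j , ij , ≢))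
... | yes (i , j , ij , pi≢pj) with χ-injective R ij (preserves i j pi≢pj)
...   | inj₁ (i≡ , j≡) = inj₁ (λ l → along (connected i l) (sym i≡) (adj-sym ij) (sym j≡))
  where
  adj-sym : ∀ {a b} → adj R a b ≡ true → adj R b a ≡ true
  adj-sym {a} {b} ab = trans (Graph.sym R b a) ab
  -- A fixed neighbour `c` of `a` is carried along: if the next edge `a d` were collapsed, then
  -- `c d` would have the colour of `c a`, which is impossible.
  along : ∀ {a b c} → Reach R a b → p a ≡ a → adj R c a ≡ true → p c ≡ c → p b ≡ b
  along here pa _ _ = pa
  along {a} {b} {c} (step {j = d} ad path) pa ca pc with p a ≟ p d
  ... | yes eq = ⊥-elim (clash (χ-injective R ca (trans (cong₂ (χ R) (sym pc) (trans (sym pa) eq)) (sym (preserves c d pc≢pd)))))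
    where
    pc≢pd : p c ≢ p d
    pc≢pd eq′ = edge-≢ R ca (trans (sym pc) (trans eq′ (trans (sym eq) pa)))
    clash : (c ≡ c × a ≡ d) ⊎ (c ≡ d × a ≡ c) → _
    clash (inj₁ (_ , a≡d)) = edge-≢ R ad a≡d
    clash (inj₂ (_ , a≡c)) = edge-≢ R ca (sym a≡c)
  ... | no ≢ with χ-injective R ad (preserves a d ≢)
  ...   | inj₁ (_ , d≡) = along path (sym d≡) ad pa
  ...   | inj₂ (a≡ , d≡) = ⊥-elim (edge-≢ R ad (sym (trans d≡ pa)))
-- The flipped case. With `l` a neighbour of `i` other than `j`, either `i l` keeps its colour and
-- must contain `j = p i`, or it is collapsed and then `j l` would have the colour of `i j`.
...   | inj₂ (i≡pj , j≡pi) with other i j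
...     | l , il , l≢j with p i ≟ p l
...       | no ≢ with χ-injective R il (preserves i l ≢)
...         | inj₁ (i≡pi , _) = ⊥-elim (edge-≢ R ij (trans i≡pi (sym j≡pi)))
...         | inj₂ (_ , l≡pi) = ⊥-elim (l≢j (trans l≡pi (sym j≡pi)))
rigid R connected other p preserves | yes (i , j , ij , pi≢pj) | inj₂ (i≡pj , j≡pi) | l , il , l≢j | yes eq =
  ⊥-elim (clash (χ-injective R ij (trans (cong₂ (χ R) i≡pj (trans j≡pi eq)) (sym (preserves j l pj≢pl)))))
  where
  pj≢pl : p j ≢ p l
  pj≢pl eq′ = pi≢pj (trans eq (sym eq′))
  clash : (i ≡ j × j ≡ l) ⊎ (i ≡ l × j ≡ j) → _
  clash (inj₁ (i≡j , _)) = edge-≢ R ij i≡j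
  clash (inj₂ (i≡l , _)) = edge-≢ R il i≡l

∑-swap₂ : ∀ {A B C D : Set} (as : List A) (bs : List B) (cs : List C) (ds : List D) (t : A → B → C → D → ℕ) →
          ∑[ a ∈ as ] ∑[ b ∈ bs ] ∑[ c ∈ cs ] ∑[ d ∈ ds ] t a b c d
          ≡ ∑[ c ∈ cs ] ∑[ d ∈ ds ] ∑[ a ∈ as ] ∑[ b ∈ bs ] t a b c d
∑-swap₂ as bs cs ds t = begin-equality
  ∑[ a ∈ as ] ∑[ b ∈ bs ] ∑[ c ∈ cs ] ∑[ d ∈ ds ] t a b c d ≡⟨ ∑-cong as (λ a → ∑-swap bs cs _) ⟩
  ∑[ a ∈ as ] ∑[ c ∈ cs ] ∑[ b ∈ bs ] ∑[ d ∈ ds ] t a b c d ≡⟨ ∑-swap as cs _ ⟩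
  ∑[ c ∈ cs ] ∑[ a ∈ as ] ∑[ b ∈ bs ] ∑[ d ∈ ds ] t a b c d ≡⟨ ∑-cong cs (λ c → ∑-cong as (λ a → ∑-swap bs ds _)) ⟩
  ∑[ c ∈ cs ] ∑[ a ∈ as ] ∑[ d ∈ ds ] ∑[ b ∈ bs ] t a b c d ≡⟨ ∑-cong cs (λ c → ∑-swap as ds _) ⟩
  ∑[ c ∈ cs ] ∑[ d ∈ ds ] ∑[ a ∈ as ] ∑[ b ∈ bs ] t a b c d ∎

-- A coefficient depending on two coordinates is no product, so the sum is split over their values:
-- with delta functions in these coordinates, `∑-∏` applies to each pair of values.
∑-∏₂ : ∀ n k (u : Fin k → Fin n → ℕ) {i j} → i ≢ j → (c : Fin n → Fin n → ℕ) →
       ∑[ σ ∈ vecs (fins n) k ] (c (lookup σ i) (lookup σ j) * ∏ k (λ l → u l (lookup σ l)))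
       ≡ ∑[ x ∈ fins n ] ∑[ y ∈ fins n ] (c x y * (u i x * u j y)) * ∏ k ((λ l → ∑ (fins n) (u l)) ∖ i ∖ j)
∑-∏₂ n k u {i} {j} i≢j c = begin-equality
  ∑[ σ ∈ V ] (c (lookup σ i) (lookup σ j) * ∏ k (λ l → u l (lookup σ l)))
    ≡⟨ ∑-cong V expand ⟩
  ∑[ σ ∈ V ] ∑[ x ∈ F ] ∑[ y ∈ F ] (b x y * s x y σ)
    ≡⟨ trans (∑-swap V F _) (∑-cong F (λ x → ∑-swap V F _)) ⟩
  ∑[ x ∈ F ] ∑[ y ∈ F ] ∑[ σ ∈ V ] (b x y * s x y σ)
    ≡⟨ ∑-cong F (λ x → ∑-cong F (λ y → trans (∑-*ˡ V (b x y) (s x y)) (cong (b x y *_) (inner x y)))) ⟩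
  ∑[ x ∈ F ] ∑[ y ∈ F ] (b x y * p)
    ≡⟨ trans (∑-cong F (λ x → ∑-*ʳ F p (b x))) (∑-*ʳ F p _) ⟩
  ∑[ x ∈ F ] ∑[ y ∈ F ] b x y * p ∎
  where
  F = fins n
  V = vecs F k
  p = ∏ k ((λ l → ∑ F (u l)) ∖ i ∖ j)
  b : Fin n → Fin n → ℕ
  b x y = c x y * (u i x * u j y)
  uσ : Vec (Fin n) k → Fin k → ℕ
  uσ σ l = u l (lookup σ l)
  s : Fin n → Fin n → Vec (Fin n) k → ℕ
  s x y σ = 𝟙 (x ≟ lookup σ i) * (𝟙 (y ≟ lookup σ j) * ∏ k (uσ σ ∖ i ∖ j))
  f₁ : ∀ c a b q → c * (a * (b * q)) ≡ c * (a * b) * q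
  f₁ = solve-∀
  f₂ : ∀ b d₁ d₂ q → d₁ * (d₂ * (b * q)) ≡ b * (d₁ * (d₂ * q))
  f₂ = solve-∀
  expand : ∀ σ → c (lookup σ i) (lookup σ j) * ∏ k (uσ σ) ≡ ∑[ x ∈ F ] ∑[ y ∈ F ] (b x y * s x y σ)
  expand σ = sym (begin-equality
    ∑[ x ∈ F ] ∑[ y ∈ F ] (b x y * s x y σ)
      ≡⟨ ∑-cong F (λ x → trans (∑-cong F (λ y → sym (f₂ (b x y) (𝟙 (x ≟ lookup σ i)) (𝟙 (y ≟ lookup σ j)) q)))
                               (∑-*ˡ F (𝟙 (x ≟ lookup σ i)) (λ y → 𝟙 (y ≟ lookup σ j) * (b x y * q)))) ⟩
    ∑[ x ∈ F ] (𝟙 (x ≟ lookup σ i) * ∑[ y ∈ F ] (𝟙 (y ≟ lookup σ j) * (b x y * q)))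
      ≡⟨ trans (∑-δ n (lookup σ i) _) (∑-δ n (lookup σ j) _) ⟩
    b (lookup σ i) (lookup σ j) * q
      ≡⟨ sym (f₁ (c (lookup σ i) (lookup σ j)) (uσ σ i) (uσ σ j) q) ⟩
    c (lookup σ i) (lookup σ j) * (uσ σ i * (uσ σ j * q))
      ≡⟨ cong (c (lookup σ i) (lookup σ j) *_) (sym (∏-split₂ k (uσ σ) i≢j)) ⟩
    c (lookup σ i) (lookup σ j) * ∏ k (uσ σ) ∎)
    where q = ∏ k (uσ σ ∖ i ∖ j)
  δ : Fin n → Fin n → ℕ
  δ x z = 𝟙 (x ≟ z)
  ∑δ : ∀ x → ∑ F (δ x) ≡ 1
  ∑δ x = trans (∑-cong F flip) (∑-δ n x (λ _ → 1))
    where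
    flip : ∀ z → 𝟙 (x ≟ z) ≡ 𝟙 (z ≟ x) * 1
    flip z with x ≟ z
    ... | yes refl = sym (trans (*-identityʳ _) (𝟙-yes (x ≟ x) refl))
    ... | no x≢z   = sym (trans (*-identityʳ _) (𝟙-no (z ≟ x) (x≢z ∘ sym)))
  inner : ∀ x y → ∑[ σ ∈ V ] s x y σ ≡ p
  inner x y = begin-equality
    ∑[ σ ∈ V ] s x y σ                         ≡⟨ ∑-cong V (λ σ → sym (v-product σ)) ⟩
    ∑[ σ ∈ V ] ∏ k (λ l → v l (lookup σ l))    ≡⟨ ∑-∏ n k v ⟩
    ∏ k (λ l → ∑ F (v l))                      ≡⟨ ∏-cong k v-sum ⟩
    p                                          ∎
    where
    v : Fin k → Fin n → ℕ
    v l z = if does (l ≟ j) then δ y z else (if does (l ≟ i) then δ x z else u l z)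
    v-i : ∀ z → v i z ≡ δ x z
    v-i z with i ≟ j | i ≟ i
    ... | yes eq | _      = ⊥-elim (i≢j eq)
    ... | no _   | yes _  = refl
    ... | no _   | no ≢   = ⊥-elim (≢ refl)
    v-j : ∀ z → v j z ≡ δ y z
    v-j z with j ≟ j
    ... | yes _ = refl
    ... | no ≢  = ⊥-elim (≢ refl)
    v-rest : ∀ σ l → ((λ l → v l (lookup σ l)) ∖ i ∖ j) l ≡ (uσ σ ∖ i ∖ j) l
    v-rest σ l with l ≟ j | l ≟ i
    ... | yes _ | _     = refl
    ... | no _  | yes _ = refl
    ... | no _  | no _  = refl
    v-product : ∀ σ → ∏ k (λ l → v l (lookup σ l)) ≡ s x y σ
    v-product σ = trans (∏-split₂ k _ i≢j) (cong₂ _*_ (v-i (lookup σ i)) (cong₂ _*_ (v-j (lookup σ j)) (∏-cong k (v-rest σ))))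
    v-sum : ∀ l → ∑ F (v l) ≡ ((λ l → ∑ F (u l)) ∖ i ∖ j) l
    v-sum l with l ≟ j | l ≟ i
    ... | yes _ | _     = ∑δ y
    ... | no _  | yes _ = ∑δ x
    ... | no _  | no _  = refl

module Roles {k n : ℕ} (R : Graph k) (G : TGraph R n)
             (connected : Connected R) (other : ∀ i j → ∃ λ l → adj R i l ≡ true × l ≢ j)
             (o : Fin k) (w : Fin n → ℕ) (r : Fin n → Fin k) where

  open Weighted R G

  W : ℕ
  W = tot w

  part : Fin k → Fin n → ℕ
  part i x = 𝟙 (i ≟ r x) * w x

  N : Fin k → ℕ
  N i = tot (part i)

  ∑N : ∑ (fins k) N ≡ W
  ∑N = trans (∑-swap (fins k) (fins n) part) (∑-cong (fins n) (λ x → ∑-δ k (r x) (λ _ → w x)))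

  N≤W : ∀ i → N i ≤ W
  N≤W i = ∑-mono (fins n) (λ x → 𝟙-*-≤ (i ≟ r x) (λ _ → ≤-refl))

  Transversal : Vec (Fin n) k → Set
  Transversal σ = ∀ l → l ≡ r (lookup σ l)

  abstract
    transversal? : ∀ σ → Dec (Transversal σ)
    transversal? σ = all? (λ l → l ≟ r (lookup σ l))

  part-product : ∀ σ → ∏ k (λ l → part l (lookup σ l)) ≡ 𝟙 (transversal? σ) * ∏ k (wt w σ)
  part-product σ = trans (∏-* k (λ l → 𝟙 (l ≟ r (lookup σ l))) (wt w σ))
                         (cong (_* ∏ k (wt w σ)) (∏-𝟙 k (λ l → l ≟ r (lookup σ l)) (transversal? σ)))

  -- `missing` is the reserve from which embeddings containing a funky pair are paid.
  good missing : ℕ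
  good    = ∑[ σ ∈ maps ] (𝟙 (emb? σ) * (𝟙 (transversal? σ) * ∏ k (wt w σ)))
  missing = ∑[ σ ∈ maps ] (𝟙 (¬? (emb? σ)) * (𝟙 (transversal? σ) * ∏ k (wt w σ)))

  good+missing : good + missing ≡ ∏ k N
  good+missing = begin-equality
    good + missing                                           ≡⟨ sym (∑-+ maps _ _) ⟩
    ∑[ σ ∈ maps ] (𝟙 (emb? σ) * t σ + 𝟙 (¬? (emb? σ)) * t σ) ≡⟨ ∑-cong maps both ⟩
    ∑[ σ ∈ maps ] t σ                                        ≡⟨ ∑-cong maps (λ σ → sym (part-product σ)) ⟩
    ∑[ σ ∈ maps ] ∏ k (λ l → part l (lookup σ l))            ≡⟨ ∑-∏ n k part ⟩
    ∏ k N                                                    ∎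
    where
    t : Vec (Fin n) k → ℕ
    t σ = 𝟙 (transversal? σ) * ∏ k (wt w σ)
    both : ∀ σ → 𝟙 (emb? σ) * t σ + 𝟙 (¬? (emb? σ)) * t σ ≡ t σ
    both σ with emb? σ
    ... | yes _ = trans (+-identityʳ _) (+-identityʳ _)
    ... | no _  = +-identityʳ _

  Funky : Fin n → Fin n → Set
  Funky x y = r x ≢ r y × col G x y ≢ χ R (r x) (r y)

  abstract
    funky? : ∀ x y → Dec (Funky x y)
    funky? x y = ¬? (r x ≟ r y) ×-dec ¬? (col G x y ≟Col χ R (r x) (r y))

  -- The weight of ordered funky pairs mediates between the two quantities: `bad` is bounded above
  -- by it, `missing` below.
  Φ : ℕ
  Φ = ∑[ x ∈ fins n ] ∑[ y ∈ fins n ] (𝟙 (funky? x y) * (w x * w y))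

  offRole : Fin k → ℕ
  offRole i = ∑[ σ ∈ maps ] (𝟙 (emb? σ) * (𝟙 (¬? (i ≟ r (lookup σ i))) * ∏ k (wt w σ)))

  bad : Fin k → Fin k → ℕ
  bad i j = ∑[ σ ∈ maps ] (𝟙 (emb? σ) * (𝟙 (funky? (lookup σ i) (lookup σ j)) * ∏ k (wt w σ)))

  -- A preliminary bound that serves to show that `∏ k N` is large; copies inside one part are not
  -- yet separated from the errors.
  h≤good+offRole : h w ≤ good + ∑ (fins k) offRole
  h≤good+offRole = begin
    h w
      ≤⟨ ∑-mono maps (λ σ → 𝟙-*-mono (emb? σ) (λ _ → pointwise σ)) ⟩
    ∑[ σ ∈ maps ] (𝟙 (emb? σ) * (𝟙 (transversal? σ) * ∏ k (wt w σ) + ∑[ i ∈ fins k ] (t i σ)))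
      ≡⟨ trans (∑-cong maps (λ σ → *-distribˡ-+ (𝟙 (emb? σ)) _ _)) (∑-+ maps _ _) ⟩
    good + ∑[ σ ∈ maps ] (𝟙 (emb? σ) * ∑[ i ∈ fins k ] (t i σ))
      ≡⟨ cong (good +_) (trans (∑-cong maps (λ σ → sym (∑-*ˡ (fins k) (𝟙 (emb? σ)) _))) (∑-swap maps (fins k) _)) ⟩
    good + ∑ (fins k) offRole ∎
    where
    t : Fin k → Vec (Fin n) k → ℕ
    t i σ = 𝟙 (¬? (i ≟ r (lookup σ i))) * ∏ k (wt w σ)
    pointwise : ∀ σ → ∏ k (wt w σ) ≤ 𝟙 (transversal? σ) * ∏ k (wt w σ) + ∑[ i ∈ fins k ] (t i σ)
    pointwise σ with transversal? σ
    ... | yes _ = ≤-trans (≤-reflexive (sym (+-identityʳ _))) (m≤m+n _ _)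
    ... | no ¬t with FinP.¬∀⟶∃¬ k _ (λ l → l ≟ r (lookup σ l)) ¬t
    ...   | i , ≢ = ≤-trans (≤-𝟙-* (¬? (i ≟ r (lookup σ i))) ≢) (∑-term k i (λ i → t i σ))

  -- An embedding without funky pairs is transversal or lies inside one part.
  h≤good+parts+bad : h w ≤ good + ∑[ i ∈ fins k ] h (part i) + ∑[ i ∈ fins k ] ∑[ j ∈ fins k ] bad i j
  h≤good+parts+bad = begin
    h w
      ≤⟨ ∑-mono maps (λ σ → 𝟙-*-mono (emb? σ) (pointwise σ)) ⟩
    ∑[ σ ∈ maps ] (e σ * (a σ + b σ + c σ))
      ≡⟨ ∑-cong maps (λ σ → distrib (e σ) (a σ) (b σ) (c σ)) ⟩
    ∑[ σ ∈ maps ] (e σ * a σ + e σ * b σ + e σ * c σ)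
      ≡⟨ trans (∑-+ maps _ _) (cong (_+ ∑[ σ ∈ maps ] (e σ * c σ)) (∑-+ maps _ _)) ⟩
    good + ∑[ σ ∈ maps ] (e σ * b σ) + ∑[ σ ∈ maps ] (e σ * c σ)
      ≡⟨ cong₂ (λ p q → good + p + q)
           (trans (∑-cong maps (λ σ → sym (∑-*ˡ (fins k) (e σ) _))) (∑-swap maps (fins k) _))
           (trans (∑-cong maps (λ σ → trans (sym (∑-*ˡ (fins k) (e σ) _)) (∑-cong (fins k) (λ i → sym (∑-*ˡ (fins k) (e σ) _)))))
                  (trans (∑-swap maps (fins k) _) (∑-cong (fins k) (λ i → ∑-swap maps (fins k) _)))) ⟩
    good + ∑[ i ∈ fins k ] h (part i) + ∑[ i ∈ fins k ] ∑[ j ∈ fins k ] bad i j ∎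
    where
    e a b c : Vec (Fin n) k → ℕ
    e σ = 𝟙 (emb? σ)
    a σ = 𝟙 (transversal? σ) * ∏ k (wt w σ)
    b σ = ∑[ i ∈ fins k ] ∏ k (wt (part i) σ)
    c σ = ∑[ i ∈ fins k ] ∑[ j ∈ fins k ] (𝟙 (funky? (lookup σ i) (lookup σ j)) * ∏ k (wt w σ))
    distrib : ∀ e a b c → e * (a + b + c) ≡ e * a + e * b + e * c
    distrib = solve-∀
    pointwise : ∀ σ → Emb σ → ∏ k (wt w σ) ≤ a σ + b σ + c σ
    pointwise σ (inj , colours) with any? (λ i → any? (λ j → funky? (lookup σ i) (lookup σ j)))
    ... | yes (i , j , fu) = begin
      ∏ k (wt w σ)                                                                 ≤⟨ ≤-𝟙-* (funky? (lookup σ i) (lookup σ j)) fu ⟩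
      𝟙 (funky? (lookup σ i) (lookup σ j)) * ∏ k (wt w σ)                          ≤⟨ ∑-term k j _ ⟩
      ∑[ j ∈ fins k ] (𝟙 (funky? (lookup σ i) (lookup σ j)) * ∏ k (wt w σ))        ≤⟨ ∑-term k i (λ i → ∑[ j ∈ fins k ] (𝟙 (funky? (lookup σ i) (lookup σ j)) * ∏ k (wt w σ))) ⟩
      c σ                                                                          ≤⟨ m≤n+m (c σ) (a σ + b σ) ⟩
      a σ + b σ + c σ                                                              ∎
    ... | no none with rigid R connected other (r ∘ lookup σ) preserves
      where
      preserves : ∀ i j → r (lookup σ i) ≢ r (lookup σ j) → χ R i j ≡ χ R (r (lookup σ i)) (r (lookup σ j))
      preserves i j ≢ with col G (lookup σ i) (lookup σ j) ≟Col χ R (r (lookup σ i)) (r (lookup σ j))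
      ... | yes eq = trans (sym (colours i j (λ i≡j → ≢ (cong (r ∘ lookup σ) i≡j)))) eq
      ... | no ≢′  = ⊥-elim (none (i , j , ≢ , ≢′))
    ...   | inj₁ id = ≤-trans (≤-𝟙-* (transversal? σ) (λ l → sym (id l))) (≤-trans (m≤m+n (a σ) (b σ)) (m≤m+n _ (c σ)))
    ...   | inj₂ const = begin
      ∏ k (wt w σ)             ≤⟨ ∏-mono k (λ l → ≤-𝟙-* (r (lookup σ o) ≟ r (lookup σ l)) (const o l)) ⟩
      ∏ k (wt (part (r (lookup σ o))) σ) ≤⟨ ∑-term k (r (lookup σ o)) (λ i → ∏ k (wt (part i) σ)) ⟩
      b σ                      ≤⟨ ≤-trans (m≤n+m (b σ) (a σ)) (m≤m+n _ (c σ)) ⟩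
      a σ + b σ + c σ          ∎

  E₂-swap : ∀ i j x y → E₂ w i j x y ≡ E₂ w j i y x
  E₂-swap i j x y = ∑-cong maps (λ σ → cong (𝟙 (emb? σ) *_) (trans (comm (𝟙 (x ≟ lookup σ i)) (𝟙 (y ≟ lookup σ j)) _)
      (cong (λ z → 𝟙 (y ≟ lookup σ j) * (𝟙 (x ≟ lookup σ i) * z)) (∏-cong k (pointwise σ)))))
    where
    comm : ∀ a b c → a * (b * c) ≡ b * (a * c)
    comm = solve-∀
    pointwise : ∀ σ l → (wt w σ ∖ i ∖ j) l ≡ (wt w σ ∖ j ∖ i) l
    pointwise σ l with l ≟ i | l ≟ j
    ... | yes _ | yes _ = refl
    ... | yes _ | no _  = refl
    ... | no _  | yes _ = refl
    ... | no _  | no _  = refl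

  E₂-zero : ∀ {i j x y} → i ≢ j → col G x y ≢ χ R i j → E₂ w i j x y ≡ 0
  E₂-zero {i} {j} {x} {y} i≢j ≢ = trans (∑-cong maps pointwise) (∑-zero maps)
    where
    pointwise : ∀ σ → 𝟙 (emb? σ) * (𝟙 (x ≟ lookup σ i) * (𝟙 (y ≟ lookup σ j) * ∏ k (wt w σ ∖ i ∖ j))) ≡ 0
    pointwise σ with emb? σ | x ≟ lookup σ i | y ≟ lookup σ j
    ... | no _         | _        | _        = refl
    ... | yes _        | no _     | _        = refl
    ... | yes _        | yes _    | no _     = refl
    ... | yes (_ , cs) | yes refl | yes refl = ⊥-elim (≢ (cs i j i≢j))

  module Rare (P Q T : ℕ) (1≤W : 1 ≤ W)
              (tiny : ∀ x y i j → 1 ≤ w x → i ≢ r x → i ≢ j → Q * (T * (W * W * E₂ w i j x y)) ≤ P * W ^ k) where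

    rare-sum : ∀ {i j} → i ≢ j → {C : Fin n → Fin n → Set} (C? : ∀ x y → Dec (C x y)) →
      (∀ x y → C x y → 1 ≤ w x → 1 ≤ w y → Q * (T * (W * W * E₂ w i j x y)) ≤ P * W ^ k) →
      Q * (T * (W * W * ∑[ σ ∈ maps ] (𝟙 (emb? σ) * (𝟙 (C? (lookup σ i) (lookup σ j)) * ∏ k (wt w σ)))))
      ≤ ∑[ x ∈ fins n ] ∑[ y ∈ fins n ] (𝟙 (C? x y) * (w x * w y)) * (P * W ^ k)
    rare-sum {i} {j} i≢j C? le = begin
      Q * (T * (W * W * ∑[ σ ∈ maps ] (𝟙 (emb? σ) * (𝟙 (C? (lookup σ i) (lookup σ j)) * ∏ k (wt w σ)))))
        ≡⟨ cong (λ z → Q * (T * (W * W * z))) (sym (∑∑-E₂ w i≢j (λ x y → 𝟙 (C? x y)))) ⟩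
      Q * (T * (W * W * ∑[ x ∈ fins n ] ∑[ y ∈ fins n ] (𝟙 (C? x y) * (w x * (w y * E₂ w i j x y)))))
        ≡⟨ f₁ Q T (W * W) _ ⟩
      Q * T * (W * W) * ∑[ x ∈ fins n ] ∑[ y ∈ fins n ] (𝟙 (C? x y) * (w x * (w y * E₂ w i j x y)))
        ≡⟨ sym (trans (∑-cong (fins n) (λ x → ∑-*ˡ (fins n) (Q * T * (W * W)) _)) (∑-*ˡ (fins n) (Q * T * (W * W)) _)) ⟩
      ∑[ x ∈ fins n ] ∑[ y ∈ fins n ] (Q * T * (W * W) * (𝟙 (C? x y) * (w x * (w y * E₂ w i j x y))))
        ≤⟨ ∑-mono (fins n) (λ x → ∑-mono (fins n) (pointwise x)) ⟩
      ∑[ x ∈ fins n ] ∑[ y ∈ fins n ] (𝟙 (C? x y) * (w x * w y) * (P * W ^ k))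
        ≡⟨ trans (∑-cong (fins n) (λ x → ∑-*ʳ (fins n) (P * W ^ k) (λ y → 𝟙 (C? x y) * (w x * w y)))) (∑-*ʳ (fins n) (P * W ^ k) _) ⟩
      ∑[ x ∈ fins n ] ∑[ y ∈ fins n ] (𝟙 (C? x y) * (w x * w y)) * (P * W ^ k) ∎
      where
      f₁ : ∀ Q T v z → Q * (T * (v * z)) ≡ Q * T * v * z
      f₁ = solve-∀
      f₂ : ∀ Q T v d a b E → Q * T * v * (d * (a * (b * E))) ≡ d * (a * b * (Q * (T * (v * E))))
      f₂ = solve-∀
      pointwise : ∀ x y → Q * T * (W * W) * (𝟙 (C? x y) * (w x * (w y * E₂ w i j x y))) ≤ 𝟙 (C? x y) * (w x * w y) * (P * W ^ k)
      pointwise x y = begin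
        Q * T * (W * W) * (𝟙 (C? x y) * (w x * (w y * E₂ w i j x y)))   ≡⟨ f₂ Q T (W * W) (𝟙 (C? x y)) (w x) (w y) _ ⟩
        𝟙 (C? x y) * (w x * w y * (Q * (T * (W * W * E₂ w i j x y))))   ≤⟨ 𝟙-*-mono (C? x y) supported ⟩
        𝟙 (C? x y) * (w x * w y * (P * W ^ k))                          ≡⟨ sym (*-assoc (𝟙 (C? x y)) (w x * w y) _) ⟩
        𝟙 (C? x y) * (w x * w y) * (P * W ^ k)                          ∎
        where
        supported : _ → w x * w y * (Q * (T * (W * W * E₂ w i j x y))) ≤ w x * w y * (P * W ^ k)
        -- A vertex of weight 0 may have an arbitrary role, but its pairs contribute nothing.
        supported cxy with 1 ≤? w x | 1 ≤? w y
        ... | yes 1≤x | yes 1≤y = *-monoʳ-≤ (w x * w y) (le x y cxy 1≤x 1≤y)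
        ... | no 1≰x  | _       rewrite n<1⇒n≡0 (≰⇒> 1≰x) = z≤n
        ... | yes _   | no 1≰y  rewrite n<1⇒n≡0 (≰⇒> 1≰y) | *-zeroʳ (w x) = z≤n

    -- The neighbour `j` of `i` only supplies the second coordinate that `tiny` asks for; all pairs
    -- together weigh at most `W * W`.
    offRole≤ : ∀ i → Q * (T * offRole i) ≤ P * W ^ k
    offRole≤ i with other i i
    ... | j , ij , _ = cancel-≤ (W * W) (*-mono-≤ 1≤W 1≤W) (begin
      W * W * (Q * (T * offRole i))                ≡⟨ f (W * W) Q T (offRole i) ⟩
      Q * (T * (W * W * offRole i))                ≤⟨ rare-sum (edge-≢ R ij) (λ x y → ¬? (i ≟ r x)) (λ x y i≢ 1≤x _ → tiny x y i j 1≤x i≢ (edge-≢ R ij)) ⟩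
      ∑[ x ∈ fins n ] ∑[ y ∈ fins n ] (𝟙 (¬? (i ≟ r x)) * (w x * w y)) * (P * W ^ k)
        ≤⟨ *-monoˡ-≤ (P * W ^ k) (∑-mono (fins n) (λ x → ∑-mono (fins n) (λ y → 𝟙-*-≤ (¬? (i ≟ r x)) (λ _ → ≤-refl)))) ⟩
      ∑[ x ∈ fins n ] ∑[ y ∈ fins n ] (w x * w y) * (P * W ^ k)
        ≡⟨ cong (_* (P * W ^ k)) (trans (∑-cong (fins n) (λ x → ∑-*ˡ (fins n) (w x) w)) (∑-*ʳ (fins n) W w)) ⟩
      W * W * (P * W ^ k) ∎)
      where
      f : ∀ v Q T z → v * (Q * (T * z)) ≡ Q * (T * (v * z))
      f = solve-∀

    -- In an embedding, a funky pair cannot have both members in their own roles, since its colour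
    -- would then be right. So one member is off its role and `tiny` applies, after `E₂-swap` if it
    -- is the second.
    bad≤ : ∀ i j → Q * (T * (W * W * bad i j)) ≤ Φ * (P * W ^ k)
    bad≤ i j with i ≟ j
    ... | yes refl = ≤-trans (≤-reflexive (trans (cong (λ z → Q * (T * (W * W * z))) bad-diagonal) (f Q T (W * W)))) z≤n
      where
      f : ∀ Q T v → Q * (T * (v * 0)) ≡ 0
      f = solve-∀
      bad-diagonal : bad i i ≡ 0
      bad-diagonal = trans (∑-cong maps (λ σ → trans (cong (λ z → 𝟙 (emb? σ) * (z * ∏ k (wt w σ))) (𝟙-no (funky? (lookup σ i) (lookup σ i)) (λ fu → proj₁ fu refl))) (*-zeroʳ (𝟙 (emb? σ))))) (∑-zero maps)
    ... | no i≢j = rare-sum i≢j funky? tiny-funky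
      where
      f : ∀ Q T v → Q * (T * (v * 0)) ≡ 0
      f = solve-∀
      tiny-funky : ∀ x y → Funky x y → 1 ≤ w x → 1 ≤ w y → Q * (T * (W * W * E₂ w i j x y)) ≤ P * W ^ k
      tiny-funky x y (_ , wrong) 1≤x 1≤y with i ≟ r x | j ≟ r y
      ... | no i≢   | _        = tiny x y i j 1≤x i≢ i≢j
      ... | yes _   | no j≢    = subst (λ z → Q * (T * (W * W * z)) ≤ P * W ^ k) (sym (E₂-swap i j x y)) (tiny y x j i 1≤y j≢ (i≢j ∘ sym))
      ... | yes refl | yes refl = ≤-trans (≤-reflexive (trans (cong (λ z → Q * (T * (W * W * z))) (E₂-zero i≢j wrong)) (f Q T (W * W)))) z≤n

  funkyTransversal : Fin k → Fin k → ℕ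
  funkyTransversal i j = ∑[ σ ∈ maps ] (𝟙 (funky? (lookup σ i) (lookup σ j)) * ∏ k (λ l → part l (lookup σ l)))

  Φ-part : Fin k → Fin k → ℕ
  Φ-part i j = ∑[ x ∈ fins n ] ∑[ y ∈ fins n ] (𝟙 (funky? x y) * (part i x * part j y))

  Φ-split : ∑[ i ∈ fins k ] ∑[ j ∈ fins k ] Φ-part i j ≡ Φ
  Φ-split = trans (∑-swap₂ (fins k) (fins k) (fins n) (fins n) (λ i j x y → 𝟙 (funky? x y) * (part i x * part j y)))
                  (∑-cong (fins n) (λ x → ∑-cong (fins n) (λ y → collapse x y)))
    where
    f : ∀ c d₁ a d₂ b → c * ((d₁ * a) * (d₂ * b)) ≡ d₁ * (d₂ * (c * (a * b)))
    f = solve-∀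
    collapse : ∀ x y → ∑[ i ∈ fins k ] ∑[ j ∈ fins k ] (𝟙 (funky? x y) * (part i x * part j y)) ≡ 𝟙 (funky? x y) * (w x * w y)
    collapse x y = begin-equality
      ∑[ i ∈ fins k ] ∑[ j ∈ fins k ] (𝟙 (funky? x y) * (part i x * part j y))
        ≡⟨ ∑-cong (fins k) (λ i → trans (∑-cong (fins k) (λ j → f (𝟙 (funky? x y)) (𝟙 (i ≟ r x)) (w x) (𝟙 (j ≟ r y)) (w y))) (∑-*ˡ (fins k) (𝟙 (i ≟ r x)) _)) ⟩
      ∑[ i ∈ fins k ] (𝟙 (i ≟ r x) * ∑[ j ∈ fins k ] (𝟙 (j ≟ r y) * (𝟙 (funky? x y) * (w x * w y))))
        ≡⟨ trans (∑-δ k (r x) _) (∑-δ k (r y) _) ⟩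
      𝟙 (funky? x y) * (w x * w y) ∎

  -- A funky pair between parts `i` and `j` extends to a transversal tuple by arbitrary choices in
  -- the other parts; `N i` and `N j` are at most `W`.
  Φ-part≤ : ∀ i j → Φ-part i j * ∏ k N ≤ W * W * funkyTransversal i j
  Φ-part≤ i j with i ≟ j
  ... | yes refl = ≤-trans (≤-reflexive (cong (_* ∏ k N) vanishes)) z≤n
    where
    term : ∀ x y → 𝟙 (funky? x y) * (part i x * part i y) ≡ 0
    term x y with i ≟ r x | i ≟ r y
    ... | yes refl | yes eq = cong (_* (1 * w x * (1 * w y))) (𝟙-no (funky? x y) (λ fu → proj₁ fu eq))
    ... | yes refl | no _ = trans (cong (𝟙 (funky? x y) *_) (*-zeroʳ (1 * w x))) (*-zeroʳ (𝟙 (funky? x y)))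
    ... | no _ | _ = *-zeroʳ (𝟙 (funky? x y))
    vanishes : Φ-part i i ≡ 0
    vanishes = trans (∑-cong (fins n) (λ x → trans (∑-cong (fins n) (term x)) (∑-zero (fins n)))) (∑-zero (fins n))
  ... | no i≢j = begin
    Φ-part i j * ∏ k N                                   ≡⟨ cong (Φ-part i j *_) (∏-split₂ k N i≢j) ⟩
    Φ-part i j * (N i * (N j * ∏ k (N ∖ i ∖ j)))         ≤⟨ *-monoʳ-≤ (Φ-part i j) (*-mono-≤ (N≤W i) (*-monoˡ-≤ _ (N≤W j))) ⟩
    Φ-part i j * (W * (W * ∏ k (N ∖ i ∖ j)))             ≡⟨ f (Φ-part i j) W _ ⟩
    W * W * (Φ-part i j * ∏ k (N ∖ i ∖ j))               ≡⟨ cong (W * W *_) (sym (∑-∏₂ n k part i≢j (λ x y → 𝟙 (funky? x y)))) ⟩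
    W * W * funkyTransversal i j                         ∎
    where
    f : ∀ a W p → a * (W * (W * p)) ≡ W * W * (a * p)
    f = solve-∀

  -- A transversal tuple containing a funky pair is no embedding, and it can be charged for at most
  -- `k * k` ordered pairs of coordinates.
  Φ≤missing : Φ * ∏ k N ≤ W * W * (k * k * missing)
  Φ≤missing = begin
    Φ * ∏ k N                                                          ≡⟨ cong (_* ∏ k N) (sym Φ-split) ⟩
    ∑[ i ∈ fins k ] ∑[ j ∈ fins k ] Φ-part i j * ∏ k N                 ≡⟨ sym (trans (∑-cong (fins k) (λ i → ∑-*ʳ (fins k) (∏ k N) (Φ-part i))) (∑-*ʳ (fins k) (∏ k N) _)) ⟩
    ∑[ i ∈ fins k ] ∑[ j ∈ fins k ] (Φ-part i j * ∏ k N)               ≤⟨ ∑-mono (fins k) (λ i → ∑-mono (fins k) (λ j → ≤-trans (Φ-part≤ i j) (*-monoʳ-≤ (W * W) (funky-missing i j)))) ⟩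
    ∑[ i ∈ fins k ] ∑[ j ∈ fins k ] (W * W * missing)                  ≡⟨ trans (∑-cong (fins k) (λ i → ∑-const k _)) (∑-const k _) ⟩
    k * (k * (W * W * missing))                                        ≡⟨ f k (W * W) missing ⟩
    W * W * (k * k * missing)                                          ∎
    where
    f : ∀ k v m → k * (k * (v * m)) ≡ v * (k * k * m)
    f = solve-∀
    funky-missing : ∀ i j → funkyTransversal i j ≤ missing
    funky-missing i j = ∑-mono maps pointwise
      where
      pointwise : ∀ σ → 𝟙 (funky? (lookup σ i) (lookup σ j)) * ∏ k (λ l → part l (lookup σ l))
                  ≤ 𝟙 (¬? (emb? σ)) * (𝟙 (transversal? σ) * ∏ k (wt w σ))
      pointwise σ = 𝟙-*-≤ (funky? (lookup σ i) (lookup σ j)) (λ fu → ≤-trans (≤-reflexive (part-product σ)) (𝟙-*-≤ (transversal? σ) (λ tr →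
        ≤-trans (≤-𝟙-* (transversal? σ) tr) (≤-𝟙-* (¬? (emb? σ)) (λ em → conflict fu tr em)))))
        where
        conflict : Funky (lookup σ i) (lookup σ j) → Transversal σ → ¬ Emb σ
        conflict (≢ , wrong) tr (_ , colours) =
          wrong (trans (colours i j (λ { refl → ≢ refl })) (cong₂ (χ R) (tr i) (tr j)))

-- One improvement step

m≤m^suc : ∀ m j → 1 ≤ m → m ≤ m ^ suc j
m≤m^suc m j 1≤m = ≤-trans (≤-reflexive (sym (*-identityʳ m))) (*-monoʳ-≤ m (1≤m^n j 1≤m))

module Step {m n : ℕ} (R : Graph (suc m)) (G : TGraph R n)
            (connected : Connected R) (other : ∀ i j → ∃ λ l → adj R i l ≡ true × l ≢ j)
            (g : ℕ) (1≤g : 1 ≤ g) (g-large : suc m * suc m * (8 * (suc m * suc m * (suc m * suc m))) ≤ 2 ^ g)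
            (degree-large : ∀ r → 32 * suc m * 4 ^ (3 * g + 1) ≤ 2 ^ degree R r) where

  open Weighted R G

  private
    k = suc m
    -- What `B≤missing` needs: `k * k` pairs of roles in `B`, another `k * k` from `Φ≤missing`, and
    -- 8 from `PW≤`.
    T = 8 * (k * k * (k * k))

  -- The 16 is 4 times 4: one factor for `P ≤ 4 * P′`, one for replacing `tot w` by its predecessor
  -- in the power `m`.
  Heavy : ℕ → ℕ → (Fin n → ℕ) → Fin k → Fin n → Set
  Heavy P Q w r x = P * tot w ^ k < 16 * (Q * (tot w * E₁ w r x))

  -- `Z` consists of the vertices joined to `x` by the colour of an edge at `r` other than `r i`.
  -- With `x` in role `i` no such colour occurs at `x`, so copies avoid `Z`; with `x` in role `r`
  -- every neighbour except possibly `i` lands in `Z`. A light `Z` would contradict heaviness by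
  -- `concentrated-rare`, so `avoiding-rare` applies.
  heavy⇒others-tiny : ∀ {P Q} → Valid P Q → ∀ w r x → Heavy P Q w r x → ∀ y i j → i ≢ r → i ≢ j →
                      Q * (T * (tot w * tot w * E₂ w i j x y)) ≤ P * tot w ^ k
  heavy⇒others-tiny {P} {Q} valid w r x heavy y i j i≢r i≢j =
    avoiding-rare {P} {Q} valid g T w Z? x y i≢j (s≤s z≤n) 1≤g g-large avoids Z-large
    where
    Z : Fin n → Set
    Z z = ∃ λ l → adj R r l ≡ true × l ≢ i × col G x z ≡ χ R r l
    Z? : ∀ z → Dec (Z z)
    Z? z = any? (λ l → (adj R r l Bool≟ true) ×-dec ¬? (l ≟ i) ×-dec (col G x z ≟Col χ R r l))
    avoids : ∀ σ → Emb σ → x ≡ lookup σ i → ∀ l → l ≢ i → ¬ Z (lookup σ l)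
    avoids σ (_ , colours) refl l l≢i (l′ , rl′ , l′≢i , eq) with χ-injective R rl′ (trans (sym eq) (colours i l (l≢i ∘ sym)))
    ... | inj₁ (r≡i , _)  = i≢r (sym r≡i)
    ... | inj₂ (_ , l′≡i) = l′≢i l′≡i
    meets : ∀ σ → Emb σ → x ≡ lookup σ r → ∀ l → adj R r l ≡ true → l ≢ i → Z (lookup σ l)
    meets σ (_ , colours) refl l rl l≢i = l , rl , l≢i , colours r l (edge-≢ R rl)
    Z-large : 3 * (g * tot w) ≤ k * measure Z? w
    Z-large with k * measure Z? w ≤? 3 * (g * tot w)
    ... | yes le = ⊥-elim (<⇒≱ heavy (concentrated-rare {P} {Q} valid g w Z? r i x (s≤s z≤n) (degree-large r) meets le))
    ... | no ≰   = <⇒≤ (≰⇒> ≰)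

  reduce : (Fin n → ℕ) → Fin n → Fin n → ℕ
  reduce w x z = w z ∸ 𝟙 (z ≟ x)

  reduce-+ : ∀ w x → 1 ≤ w x → ∀ z → w z ≡ reduce w x z + 𝟙 (z ≟ x)
  reduce-+ w x 1≤ z with z ≟ x
  ... | yes refl = sym (m∸n+n≡m 1≤)
  ... | no _     = sym (+-identityʳ _)

  reduce-other : ∀ w x z → z ≢ x → reduce w x z ≡ w z
  reduce-other w x z z≢x = cong (w z ∸_) (𝟙-no (z ≟ x) z≢x)

  tot-reduce : ∀ w x → 1 ≤ w x → tot w ≡ suc (tot (reduce w x))
  tot-reduce w x 1≤ = begin-equality
    tot w                                              ≡⟨ ∑-cong (fins n) (λ z → trans (reduce-+ w x 1≤ z) (cong (reduce w x z +_) (sym (*-identityʳ _)))) ⟩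
    ∑[ z ∈ fins n ] (reduce w x z + 𝟙 (z ≟ x) * 1)     ≡⟨ ∑-+ (fins n) (reduce w x) _ ⟩
    tot (reduce w x) + ∑[ z ∈ fins n ] (𝟙 (z ≟ x) * 1) ≡⟨ cong (tot (reduce w x) +_) (∑-δ n x (λ _ → 1)) ⟩
    tot (reduce w x) + 1                               ≡⟨ +-comm _ 1 ⟩
    suc (tot (reduce w x))                             ∎

  E : (Fin n → ℕ) → Fin n → ℕ
  E w x = ∑[ i ∈ fins k ] E₁ w i x

  -- Embeddings are injective, so `h` is of degree at most one in the weight of `x`, and a unit of
  -- it is worth the derivative.
  h-reduce : ∀ w x → 1 ≤ w x → h w ≤ h (reduce w x) + E w x
  h-reduce w x 1≤ = begin
    h w
      ≤⟨ ∑-mono maps (λ σ → 𝟙-*-mono (emb? σ) (pointwise σ)) ⟩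
    ∑[ σ ∈ maps ] (𝟙 (emb? σ) * (∏ k (wt w⁻ σ) + ∑[ i ∈ fins k ] t i σ))
      ≡⟨ trans (∑-cong maps (λ σ → *-distribˡ-+ (𝟙 (emb? σ)) _ _)) (∑-+ maps _ _) ⟩
    h w⁻ + ∑[ σ ∈ maps ] (𝟙 (emb? σ) * ∑[ i ∈ fins k ] t i σ)
      ≡⟨ cong (h w⁻ +_) (trans (∑-cong maps (λ σ → sym (∑-*ˡ (fins k) (𝟙 (emb? σ)) (λ i → t i σ)))) (∑-swap maps (fins k) _)) ⟩
    h w⁻ + E w x ∎
    where
    w⁻ = reduce w x
    t : Fin k → Vec (Fin n) k → ℕ
    t i σ = 𝟙 (x ≟ lookup σ i) * ∏ k (wt w σ ∖ i)
    pointwise : ∀ σ → Emb σ → ∏ k (wt w σ) ≤ ∏ k (wt w⁻ σ) + ∑[ i ∈ fins k ] t i σ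
    pointwise σ (inj , _) with any? (λ i → x ≟ lookup σ i)
    ... | no none = ≤-trans (≤-reflexive (∏-cong k (λ l → sym (reduce-other w x (lookup σ l) (λ eq → none (l , sym eq)))))) (m≤m+n _ _)
    ... | yes (i , x≡) = begin
      ∏ k (wt w σ)                                    ≡⟨ ∏-split k (wt w σ) i ⟩
      w (lookup σ i) * p                              ≡⟨ cong (_* p) (trans (reduce-+ w x 1≤ (lookup σ i)) (cong (w⁻ (lookup σ i) +_) (𝟙-yes (lookup σ i ≟ x) (sym x≡)))) ⟩
      (w⁻ (lookup σ i) + 1) * p                       ≡⟨ trans (*-distribʳ-+ p (w⁻ (lookup σ i)) 1) (cong (w⁻ (lookup σ i) * p +_) (+-identityʳ p)) ⟩
      w⁻ (lookup σ i) * p + p                         ≡⟨ cong (λ z → w⁻ (lookup σ i) * z + p) (∏-cong k (∖-cong i unchanged)) ⟩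
      w⁻ (lookup σ i) * ∏ k (wt w⁻ σ ∖ i) + p         ≡⟨ cong (_+ p) (sym (∏-split k (wt w⁻ σ) i)) ⟩
      ∏ k (wt w⁻ σ) + p                               ≤⟨ +-monoʳ-≤ (∏ k (wt w⁻ σ)) (≤-trans (≤-𝟙-* (x ≟ lookup σ i) x≡) (∑-term k i (λ i → t i σ))) ⟩
      ∏ k (wt w⁻ σ) + ∑[ i ∈ fins k ] t i σ           ∎
      where
      p = ∏ k (wt w σ ∖ i)
      unchanged : ∀ l → l ≢ i → wt w σ l ≡ wt w⁻ σ l
      unchanged l l≢i = sym (reduce-other w x (lookup σ l) (λ eq → l≢i (inj l i (trans eq x≡))))

  -- What is left of an improvement once the roles are known. The premise on `∏ k N` may be assumed
  -- because `roles-bound` derives it when the new bound fails; it makes the inequality vacuous for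
  -- coarse bounds and yields near-equality of the parts for fine ones.
  PartBound : ℕ → ℕ → ℕ → Set
  PartBound P P′ Q = ∀ (N : Fin k → ℕ) → 1 ≤ ∑ (fins k) N → P′ * (∑ (fins k) N) ^ k ≤ 2 * (Q * ∏ k N) →
                     Q * ∏ k N + P * ∑[ i ∈ fins k ] (N i ^ k) ≤ P′ * (∑ (fins k) N) ^ k

  module _ {P P′ Q : ℕ} (valid : Valid P Q) (1≤Q : 1 ≤ Q) (P≤4P′ : P ≤ 4 * P′) (partBound : PartBound P P′ Q) where

    roles-bound : ∀ w (r : Fin n → Fin k) → 1 ≤ tot w → (∀ x → 1 ≤ w x → Heavy P Q w (r x) x) → Q * h w ≤ P′ * tot w ^ k
    roles-bound w r 1≤W heavy with Q * h w ≤? P′ * tot w ^ k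
    ... | yes le = le
    ... | no ≰   = begin
      Q * h w
        ≤⟨ *-monoʳ-≤ Q h≤good+parts+bad ⟩
      Q * (good + Hs + B)
        -- Exchanging `B` for `missing` completes `good` to the full product of part sizes, so no
        -- error term survives.
        ≤⟨ *-monoʳ-≤ Q (+-monoʳ-≤ (good + Hs) B≤missing) ⟩
      Q * (good + Hs + missing)
        ≡⟨ e₁ Q good Hs missing ⟩
      Q * (good + missing) + Q * Hs
        ≡⟨ cong₂ _+_ (cong (Q *_) good+missing) (sym (∑-*ˡ (fins k) Q _)) ⟩
      Q * ∏ k N + ∑[ i ∈ fins k ] (Q * h (part i))
        ≤⟨ +-monoʳ-≤ (Q * ∏ k N) (≤-trans (∑-mono (fins k) (λ i → valid (part i))) (≤-reflexive (∑-*ˡ (fins k) P _))) ⟩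
      Q * ∏ k N + P * ∑[ i ∈ fins k ] (N i ^ k)
        ≤⟨ partBound N (subst (1 ≤_) (sym ∑N) 1≤W) (subst (λ z → P′ * z ^ k ≤ 2 * (Q * ∏ k N)) (sym ∑N) product-large) ⟩
      P′ * (∑ (fins k) N) ^ k
        ≡⟨ cong (λ z → P′ * z ^ k) ∑N ⟩
      P′ * W ^ k ∎
      where
      open Roles R G connected other zero w r
      open Rare P Q T 1≤W (λ x y i j 1≤x → heavy⇒others-tiny {P} {Q} valid w (r x) x (heavy x 1≤x) y i j)
      Hs B off : ℕ
      Hs = ∑[ i ∈ fins k ] h (part i)
      B = ∑[ i ∈ fins k ] ∑[ j ∈ fins k ] bad i j
      off = ∑ (fins k) offRole
      e₁ : ∀ Q a b c → Q * (a + b + c) ≡ Q * (a + c) + Q * b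
      e₁ = solve-∀
      off≤ : 2 * (Q * off) ≤ P′ * W ^ k
      off≤ = cancel-≤ (4 * k) (s≤s z≤n) (begin
        4 * k * (2 * (Q * off))             ≤⟨ ≤-reflexive (e₂ k (Q * off)) ⟩
        8 * k * (Q * off)                   ≤⟨ *-monoˡ-≤ (Q * off) 8k≤T ⟩
        T * (Q * off)                       ≡⟨ e₃ T Q off ⟩
        Q * T * off                         ≡⟨ sym (∑-*ˡ (fins k) (Q * T) offRole) ⟩
        ∑[ i ∈ fins k ] (Q * T * offRole i) ≤⟨ ∑-mono (fins k) (λ i → ≤-trans (≤-reflexive (*-assoc Q T (offRole i))) (offRole≤ i)) ⟩
        ∑[ i ∈ fins k ] (P * W ^ k)         ≡⟨ ∑-const k _ ⟩
        k * (P * W ^ k)                     ≤⟨ *-monoʳ-≤ k (*-monoˡ-≤ (W ^ k) P≤4P′) ⟩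
        k * (4 * P′ * W ^ k)                ≡⟨ e₄ k P′ (W ^ k) ⟩
        4 * k * (P′ * W ^ k)                ∎)
        where
        e₂ : ∀ k a → 4 * k * (2 * a) ≡ 8 * k * a
        e₂ = solve-∀
        e₃ : ∀ T Q o → T * (Q * o) ≡ Q * T * o
        e₃ = solve-∀
        e₄ : ∀ k P w → k * (4 * P * w) ≡ 4 * k * (P * w)
        e₄ = solve-∀
        8k≤T : 8 * k ≤ T
        8k≤T = *-monoʳ-≤ 8 (≤-trans (m≤m*n k k) (m≤m*n (k * k) (k * k)))
      -- As the new bound fails, `Q * h w` exceeds `P′ * W ^ k`; embeddings off their roles make up
      -- at most half of that, so transversal ones supply the other half.
      product-large : P′ * W ^ k ≤ 2 * (Q * ∏ k N)
      product-large = +-cancelʳ-≤ (P′ * W ^ k) _ _ (begin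
        P′ * W ^ k + P′ * W ^ k                  ≤⟨ +-mono-≤ (<⇒≤ (≰⇒> ≰)) (<⇒≤ (≰⇒> ≰)) ⟩
        Q * h w + Q * h w                        ≡⟨ e₂ (Q * h w) ⟩
        2 * (Q * h w)                            ≤⟨ *-monoʳ-≤ 2 (*-monoʳ-≤ Q h≤good+offRole) ⟩
        2 * (Q * (good + off))                   ≡⟨ e₃ Q good off ⟩
        2 * (Q * good) + 2 * (Q * off)           ≤⟨ +-mono-≤ (*-monoʳ-≤ 2 (*-monoʳ-≤ Q (≤-trans (m≤m+n good missing) (≤-reflexive good+missing)))) off≤ ⟩
        2 * (Q * ∏ k N) + P′ * W ^ k             ∎)
        where
        e₂ : ∀ a → a + a ≡ 2 * a
        e₂ = solve-∀
        e₃ : ∀ Q a b → 2 * (Q * (a + b)) ≡ 2 * (Q * a) + 2 * (Q * b)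
        e₃ = solve-∀
      B≤missing : B ≤ missing
      B≤missing = cancel-≤ (Q * T * (W * W)) (*-mono-≤ (*-mono-≤ 1≤Q (s≤s z≤n)) (*-mono-≤ 1≤W 1≤W)) (begin
        Q * T * (W * W) * B
          ≡⟨ sym (trans (∑-cong (fins k) (λ i → ∑-*ˡ (fins k) (Q * T * (W * W)) (bad i))) (∑-*ˡ (fins k) (Q * T * (W * W)) _)) ⟩
        ∑[ i ∈ fins k ] ∑[ j ∈ fins k ] (Q * T * (W * W) * bad i j)
          ≤⟨ ∑-mono (fins k) (λ i → ∑-mono (fins k) (λ j → ≤-trans (≤-reflexive (e₂ Q T (W * W) (bad i j))) (bad≤ i j))) ⟩
        ∑[ i ∈ fins k ] ∑[ j ∈ fins k ] (Φ * (P * W ^ k))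
          ≡⟨ trans (∑-cong (fins k) (λ i → ∑-const k _)) (∑-const k _) ⟩
        k * (k * (Φ * (P * W ^ k)))
          ≤⟨ *-monoʳ-≤ k (*-monoʳ-≤ k (*-monoʳ-≤ Φ PW≤)) ⟩
        k * (k * (Φ * (8 * (Q * ∏ k N))))
          ≡⟨ e₃ k Φ Q (∏ k N) ⟩
        8 * (k * k) * Q * (Φ * ∏ k N)
          ≤⟨ *-monoʳ-≤ (8 * (k * k) * Q) Φ≤missing ⟩
        8 * (k * k) * Q * (W * W * (k * k * missing))
          ≡⟨ e₄ (k * k) Q (W * W) missing ⟩
        Q * T * (W * W) * missing ∎)
        where
        e₂ : ∀ Q T v b → Q * T * v * b ≡ Q * (T * (v * b))
        e₂ = solve-∀
        e₃ : ∀ k f Q p → k * (k * (f * (8 * (Q * p)))) ≡ 8 * (k * k) * Q * (f * p)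
        e₃ = solve-∀
        e₄ : ∀ kk Q v x → 8 * kk * Q * (v * (kk * x)) ≡ Q * (8 * (kk * kk)) * v * x
        e₄ = solve-∀
        PW≤ : P * W ^ k ≤ 8 * (Q * ∏ k N)
        PW≤ = begin
          P * W ^ k                ≤⟨ *-monoˡ-≤ (W ^ k) P≤4P′ ⟩
          4 * P′ * W ^ k           ≡⟨ *-assoc 4 P′ _ ⟩
          4 * (P′ * W ^ k)         ≤⟨ *-monoʳ-≤ 4 product-large ⟩
          4 * (2 * (Q * ∏ k N))    ≡⟨ sym (*-assoc 4 2 (Q * ∏ k N)) ⟩
          8 * (Q * ∏ k N)          ∎

    -- Induction on the total weight. Deleting a unit whose derivative is small costs at most the
    -- increment of `P′ * W ^ k`; if no such unit exists, every vertex of positive weight is heavy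
    -- in some role. The constant `Q * k ^ k` absorbs the totals up to `k`, where consecutive powers
    -- are not comparable by a fixed factor.
    additive-bound : ∀ W w → tot w ≡ W → Q * h w ≤ P′ * W ^ k + Q * k ^ k
    additive-bound W w eq with W ≤? k
    ... | yes W≤k = ≤-trans (*-monoʳ-≤ Q (≤-trans (h≤tot^k w) (^-monoˡ-≤ k (subst (_≤ k) (sym eq) W≤k)))) (m≤n+m _ (P′ * W ^ k))
    additive-bound zero w eq    | no W≰k = ⊥-elim (W≰k z≤n)
    additive-bound (suc V) w eq | no W≰k with any? (λ x → (1 ≤? w x) ×-dec (Q * E w x ≤? P′ * (k * V ^ m)))
    ... | yes (x , 1≤x , light) = begin
      Q * h w                                         ≤⟨ *-monoʳ-≤ Q (h-reduce w x 1≤x) ⟩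
      Q * (h (reduce w x) + E w x)                    ≡⟨ *-distribˡ-+ Q _ _ ⟩
      Q * h (reduce w x) + Q * E w x                  ≤⟨ +-mono-≤ (additive-bound V (reduce w x) (suc-injective (trans (sym (tot-reduce w x 1≤x)) eq))) light ⟩
      P′ * V ^ k + Q * k ^ k + P′ * (k * V ^ m)       ≡⟨ e P′ (V ^ k) (Q * k ^ k) k (V ^ m) ⟩
      P′ * (V ^ k + k * (1 * V ^ m)) + Q * k ^ k      ≤⟨ +-monoˡ-≤ (Q * k ^ k) (*-monoʳ-≤ P′ (bernoulli-+ V 1 m)) ⟩
      P′ * (V + 1) ^ k + Q * k ^ k                    ≡⟨ cong (λ z → P′ * z ^ k + Q * k ^ k) (+-comm V 1) ⟩
      P′ * suc V ^ k + Q * k ^ k                      ∎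
      where
      e : ∀ p a b k c → p * a + b + p * (k * c) ≡ p * (a + k * (1 * c)) + b
      e = solve-∀
    ... | no none = ≤-trans (subst (λ z → Q * h w ≤ P′ * z ^ k) eq (roles-bound w role (subst (1 ≤_) (sym eq) (s≤s z≤n)) role-heavy)) (m≤m+n _ _)
      where
      heavy? : ∀ x → Dec (∃ λ r → Heavy P Q w r x)
      heavy? x = any? (λ r → P * tot w ^ k <? 16 * (Q * (tot w * E₁ w r x)))
      roleOf : ∀ x → Dec (∃ λ r → Heavy P Q w r x) → Fin k
      roleOf x (yes (r , _)) = r
      -- A default: by `roleOf-heavy` it can occur only at vertices of weight 0.
      roleOf x (no _)        = zero
      role : Fin n → Fin k
      role x = roleOf x (heavy? x)
      m≤V : m ≤ V
      m≤V = ≤-trans (n≤1+n m) (s≤s⁻¹ (≰⇒> W≰k))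
      contradictory : ∀ x → 1 ≤ w x → ¬ (∀ i → 16 * (Q * (suc V * E₁ w i x)) ≤ P * suc V ^ k)
      contradictory x 1≤x all-light = <⇒≱ (begin-strict
        P * (suc V * suc V ^ m) * k                        ≤⟨ *-monoˡ-≤ k (*-mono-≤ P≤4P′ (*-monoʳ-≤ (suc V) (suc-power≤4 V m m≤V))) ⟩
        4 * P′ * (suc V * (4 * V ^ m)) * k                 ≡⟨ e₁ P′ V (V ^ m) k ⟩
        16 * suc V * (P′ * (k * V ^ m))                    <⟨ *-monoʳ-< (16 * suc V) (≰⇒> (λ le → none (x , 1≤x , le))) ⟩
        16 * suc V * (Q * E w x)                           ∎) (begin
        16 * suc V * (Q * E w x)                           ≡⟨ trans (e₂ (16 * suc V) Q (E w x)) (sym (∑-*ˡ (fins k) (16 * suc V * Q) (λ i → E₁ w i x))) ⟩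
        ∑[ i ∈ fins k ] (16 * suc V * Q * E₁ w i x)        ≤⟨ ∑-mono (fins k) (λ i → ≤-trans (≤-reflexive (e₃ V Q (E₁ w i x))) (all-light i)) ⟩
        ∑[ i ∈ fins k ] (P * suc V ^ k)                    ≡⟨ trans (∑-const k _) (*-comm k _) ⟩
        P * (suc V * suc V ^ m) * k                        ∎)
        where
        e₁ : ∀ p V v k → 4 * p * (suc V * (4 * v)) * k ≡ 16 * suc V * (p * (k * v))
        e₁ = solve-∀
        e₂ : ∀ a Q b → a * (Q * b) ≡ a * Q * b
        e₂ = solve-∀
        e₃ : ∀ V Q b → 16 * suc V * Q * b ≡ 16 * (Q * (suc V * b))
        e₃ = solve-∀
      roleOf-heavy : ∀ x → 1 ≤ w x → (d : Dec (∃ λ r → Heavy P Q w r x)) → Heavy P Q w (roleOf x d) x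
      roleOf-heavy x 1≤x (yes (_ , hv)) = hv
      roleOf-heavy x 1≤x (no light)     = ⊥-elim (contradictory x 1≤x (λ i →
        subst (λ z → 16 * (Q * (z * E₁ w i x)) ≤ P * z ^ k) eq (≮⇒≥ (λ hv → light (i , hv)))))
      role-heavy : ∀ x → 1 ≤ w x → Heavy P Q w (role x) x
      role-heavy x 1≤x = roleOf-heavy x 1≤x (heavy? x)

    -- Scaling `w` by `t` multiplies a violation, which is at least 1 by integrality, by `t ^ k`,
    -- while the additive constant stays `Q * k ^ k`; any `t` above that constant gives a
    -- contradiction.
    improve : Valid P′ Q
    improve w with Q * h w ≤? P′ * tot w ^ k
    ... | yes le = le
    ... | no ≰   = ⊥-elim (<⇒≱ (n<1+n (Q * k ^ k)) (≤-trans (m≤m^suc t m (s≤s z≤n)) (+-cancelˡ-≤ (t ^ k * (P′ * tot w ^ k)) _ _ (begin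
      t ^ k * (P′ * tot w ^ k) + t ^ k           ≡⟨ e₁ (t ^ k) (P′ * tot w ^ k) ⟩
      t ^ k * suc (P′ * tot w ^ k)               ≤⟨ *-monoʳ-≤ (t ^ k) (≰⇒> ≰) ⟩
      t ^ k * (Q * h w)                          ≡⟨ e₂ (t ^ k) Q (h w) ⟩
      Q * (t ^ k * h w)                          ≡⟨ cong (Q *_) (sym (h-scale t w)) ⟩
      Q * h (λ x → t * w x)                      ≤⟨ additive-bound _ (λ x → t * w x) refl ⟩
      P′ * tot (λ x → t * w x) ^ k + Q * k ^ k   ≡⟨ cong (λ z → P′ * z + Q * k ^ k) (trans (cong (_^ k) (tot-scale t w)) (^-distrib-* t (tot w) k)) ⟩
      P′ * (t ^ k * tot w ^ k) + Q * k ^ k       ≡⟨ cong (_+ Q * k ^ k) (e₂ P′ (t ^ k) (tot w ^ k)) ⟩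
      t ^ k * (P′ * tot w ^ k) + Q * k ^ k       ∎))))
      where
      t = suc (Q * k ^ k)
      e₁ : ∀ a b → a * b + a ≡ a * suc b
      e₁ = solve-∀
      e₂ : ∀ a b c → a * (b * c) ≡ b * (a * c)
      e₂ = solve-∀

-- The upper bound

n<2^n : ∀ n → n < 2 ^ n
n<2^n zero    = s≤s z≤n
n<2^n (suc n) = begin
  suc (suc n)         ≤⟨ s≤s (n<2^n n) ⟩
  suc (2 ^ n)         ≤⟨ +-monoˡ-≤ (2 ^ n) (1≤m^n n (s≤s z≤n)) ⟩
  2 ^ n + 2 ^ n       ≡⟨ cong (2 ^ n +_) (sym (+-identityʳ _)) ⟩
  2 * 2 ^ n           ∎

module UpperBound {m n : ℕ} (R : Graph (suc m)) (G : TGraph R n)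
            (connected : Connected R) (other : ∀ i j → ∃ λ l → adj R i l ≡ true × l ≢ j)
            (g : ℕ) (1≤g : 1 ≤ g) (g-large : suc m * suc m * (8 * (suc m * suc m * (suc m * suc m))) ≤ 2 ^ g)
            (degree-large : ∀ r → 32 * suc m * 4 ^ (3 * g + 1) ≤ 2 ^ degree R r)
            (1≤m : 1 ≤ m) (k-large : 32 * (suc m * suc m * suc m) * 8 ^ suc m ≤ suc m ^ suc m) where

  open Weighted R G
  open Step R G connected other g 1≤g g-large degree-large

  private
    k = suc m

  -- Written as 3 times a power of two so that repeated halving ends exactly at 3.
  valid-trivial : Valid (3 * 2 ^ (k * k)) (k ^ k)
  valid-trivial w = *-mono-≤ k^k≤ (h≤tot^k w)
    where
    k^k≤ : k ^ k ≤ 3 * 2 ^ (k * k)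
    k^k≤ = begin
      k ^ k              ≤⟨ ^-monoˡ-≤ k (<⇒≤ (n<2^n k)) ⟩
      (2 ^ k) ^ k        ≡⟨ ^-*-assoc 2 k k ⟩
      2 ^ (k * k)        ≤⟨ m≤m+n _ _ ⟩
      3 * 2 ^ (k * k)    ∎

  -- By AM-GM, twice the product term is at most `2 * S ^ k`, below the target as `3 > 2`; so the
  -- premise of `PartBound` never holds.
  valid-halve : ∀ t → Valid (3 * 2 ^ suc t) (k ^ k) → Valid (3 * 2 ^ t) (k ^ k)
  valid-halve t valid = improve {P = 3 * 2 ^ suc t} {3 * 2 ^ t} {k ^ k} valid (1≤k^k k) P≤4P′ vacuous
    where
    e : ∀ a → 3 * (2 * a) + 6 * a ≡ 4 * (3 * a)
    e = solve-∀
    P≤4P′ : 3 * 2 ^ suc t ≤ 4 * (3 * 2 ^ t)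
    P≤4P′ = ≤-trans (m≤m+n _ (6 * 2 ^ t)) (≤-reflexive (e (2 ^ t)))
    vacuous : PartBound (3 * 2 ^ suc t) (3 * 2 ^ t) (k ^ k)
    vacuous N 1≤S large = ⊥-elim (<⇒≱ (≤-refl {3}) (cancel-≤ (S ^ k) (1≤m^n k 1≤S) (begin
      S ^ k * 3                ≡⟨ *-comm (S ^ k) 3 ⟩
      3 * S ^ k                ≤⟨ *-monoˡ-≤ (S ^ k) (*-monoʳ-≤ 3 (1≤m^n t (s≤s z≤n))) ⟩
      3 * 2 ^ t * S ^ k        ≤⟨ large ⟩
      2 * (k ^ k * ∏ k N)      ≤⟨ *-monoʳ-≤ 2 (am-gm k N) ⟩
      2 * S ^ k                ≡⟨ *-comm 2 (S ^ k) ⟩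
      S ^ k * 2                ∎)))
      where S = ∑ (fins k) N

  valid-crude : Valid 3 (k ^ k)
  valid-crude = descend (k * k) valid-trivial
    where
    descend : ∀ t → Valid (3 * 2 ^ t) (k ^ k) → Valid 3 (k ^ k)
    descend zero    valid = valid
    descend (suc t) valid = descend t (valid-halve t valid)

  -- Unequal parts cost `Q * Δ` in the product term and gain at most `P * 8 * k³ * 8 ^ k * Δ` in the
  -- power sum. With `P / Q` at most `4 / k ^ k`, `k-large` makes the cost dominate, so equal parts
  -- are the worst case.
  valid-refine : ∀ {P Q} → 1 ≤ Q → P * k ^ k ≤ 4 * Q → Valid P Q → Valid (Q + k * P) (k ^ k * Q)
  valid-refine {P} {Q} 1≤Q Pk^k≤4Q valid =
    improve {P = k ^ k * P} {Q + k * P} {k ^ k * Q} scaled (*-mono-≤ (1≤k^k k) 1≤Q) P≤4P′ refined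
    where
    scaled : Valid (k ^ k * P) (k ^ k * Q)
    scaled w = begin
      k ^ k * Q * h w             ≡⟨ *-assoc (k ^ k) Q _ ⟩
      k ^ k * (Q * h w)           ≤⟨ *-monoʳ-≤ (k ^ k) (valid w) ⟩
      k ^ k * (P * tot w ^ k)     ≡⟨ sym (*-assoc (k ^ k) P _) ⟩
      k ^ k * P * tot w ^ k       ∎
    P≤4P′ : k ^ k * P ≤ 4 * (Q + k * P)
    P≤4P′ = ≤-trans (≤-reflexive (*-comm (k ^ k) P)) (≤-trans Pk^k≤4Q (*-monoʳ-≤ 4 (m≤m+n Q (k * P))))
    P-small : P * (8 * (k * k * k) * 8 ^ k) ≤ Q
    P-small = *-cancelˡ-≤ 4 (begin
      4 * (P * (8 * (k * k * k) * 8 ^ k))   ≡⟨ e P (k * k * k) (8 ^ k) ⟩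
      P * (32 * (k * k * k) * 8 ^ k)        ≤⟨ *-monoʳ-≤ P k-large ⟩
      P * k ^ k                             ≤⟨ Pk^k≤4Q ⟩
      4 * Q                                 ∎)
      where
      e : ∀ P c d → 4 * (P * (8 * c * d)) ≡ P * (32 * c * d)
      e = solve-∀
    refined : PartBound (k ^ k * P) (Q + k * P) (k ^ k * Q)
    refined N 1≤S large = begin
      k ^ k * Q * ∏ k N + k ^ k * P * ∑[ i ∈ fins k ] (N i ^ k)
        ≡⟨ e₁ (k ^ k) Q (∏ k N) P _ ⟩
      Q * (k ^ k * ∏ k N) + P * (k ^ k * ∑[ i ∈ fins k ] (N i ^ k))
        ≡⟨ cong₂ (λ a b → Q * a + P * b) (sym ∏y) (sym ∑y^k) ⟩
      Q * ∏ k y + P * ∑[ i ∈ fins k ] (y i ^ k)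
        ≤⟨ +-monoʳ-≤ (Q * ∏ k y) (*-monoʳ-≤ P (power-sum≤ k (s≤s z≤n) y S 1≤S (∑-*ˡ (fins k) k N) y-large Δ deficit)) ⟩
      Q * ∏ k y + P * (k * S ^ k + 8 * (k * k * k) * 8 ^ k * Δ)
        ≡⟨ e₂ (Q * ∏ k y) P k (S ^ k) (8 * (k * k * k) * 8 ^ k) Δ ⟩
      Q * ∏ k y + k * P * S ^ k + P * (8 * (k * k * k) * 8 ^ k) * Δ
        ≤⟨ +-monoʳ-≤ (Q * ∏ k y + k * P * S ^ k) (*-monoˡ-≤ Δ P-small) ⟩
      Q * ∏ k y + k * P * S ^ k + Q * Δ
        ≡⟨ e₃ Q (∏ k y) (k * P * S ^ k) Δ ⟩
      Q * (Δ + ∏ k y) + k * P * S ^ k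
        ≡⟨ cong (λ z → Q * z + k * P * S ^ k) deficit ⟩
      Q * S ^ k + k * P * S ^ k
        ≡⟨ sym (*-distribʳ-+ (S ^ k) Q (k * P)) ⟩
      (Q + k * P) * S ^ k ∎
      where
      S = ∑ (fins k) N
      -- Scaled by `k` so that the mean is the integer `S`.
      y : Fin k → ℕ
      y i = k * N i
      ∏y : ∏ k y ≡ k ^ k * ∏ k N
      ∏y = ∏-scale k k N
      ∑y^k : ∑[ i ∈ fins k ] (y i ^ k) ≡ k ^ k * ∑[ i ∈ fins k ] (N i ^ k)
      ∑y^k = trans (∑-cong (fins k) (λ i → ^-distrib-* k (N i) k)) (∑-*ˡ (fins k) (k ^ k) (λ i → N i ^ k))
      e₁ : ∀ a Q p P s → a * Q * p + a * P * s ≡ Q * (a * p) + P * (a * s)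
      e₁ = solve-∀
      e₂ : ∀ a P k s c d → a + P * (k * s + c * d) ≡ a + k * P * s + P * c * d
      e₂ = solve-∀
      e₃ : ∀ Q p a d → Q * p + a + Q * d ≡ Q * (d + p) + a
      e₃ = solve-∀
      e₄ : ∀ a Q p → 2 * (a * Q * p) ≡ Q * (2 * (a * p))
      e₄ = solve-∀
      y-large : S ^ k ≤ 2 * ∏ k y
      y-large = cancel-≤ Q 1≤Q (begin
        Q * S ^ k                   ≤⟨ *-monoˡ-≤ (S ^ k) (m≤m+n Q (k * P)) ⟩
        (Q + k * P) * S ^ k         ≤⟨ large ⟩
        2 * (k ^ k * Q * ∏ k N)     ≡⟨ e₄ (k ^ k) Q (∏ k N) ⟩
        Q * (2 * (k ^ k * ∏ k N))   ≡⟨ cong (λ z → Q * (2 * z)) (sym ∏y) ⟩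
        Q * (2 * ∏ k y)             ∎)
      Δ : ℕ
      Δ = S ^ k ∸ ∏ k y
      deficit : Δ + ∏ k y ≡ S ^ k
      deficit = m∸n+n≡m (subst (_≤ S ^ k) (sym ∏y) (am-gm k N))

  private
    K = k ^ k ∸ k

  k≤k^k : k ≤ k ^ k
  k≤k^k = m≤m^suc k m (s≤s z≤n)

  -- M ↦ k^{-k} + M k^{1-k} contracts towards its fixed point 1/(k^k - k).
  numerator : ℕ → ℕ
  denominator : ℕ → ℕ
  denominator t = k ^ k * (k ^ k) ^ t
  numerator zero    = 3
  numerator (suc t) = denominator t + k * numerator t

  1≤denominator : ∀ t → 1 ≤ denominator t
  1≤denominator t = *-mono-≤ (1≤k^k k) (1≤m^n t (1≤k^k k))

  -- The invariant that `valid-refine` requires at every step. After the first step it holds even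
  -- with 2, since `k * p ≤ d`.
  numerator≤ : ∀ t → numerator t * k ^ k ≤ 4 * denominator t
  numerator≤ zero    = begin
    3 * k ^ k             ≤⟨ *-monoˡ-≤ (k ^ k) (n≤1+n 3) ⟩
    4 * k ^ k             ≡⟨ cong (4 *_) (sym (*-identityʳ (k ^ k))) ⟩
    4 * (k ^ k * 1)       ∎
  numerator≤ (suc t) = begin
    (d + k * p) * k ^ k                   ≤⟨ *-monoˡ-≤ (k ^ k) (+-monoʳ-≤ d kp≤d) ⟩
    (d + d) * k ^ k                       ≤⟨ m≤m+n _ ((d + d) * k ^ k) ⟩
    (d + d) * k ^ k + (d + d) * k ^ k     ≡⟨ e (k ^ k) ((k ^ k) ^ t) ⟩
    4 * (k ^ k * (k ^ k * (k ^ k) ^ t))   ∎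
    where
    d = denominator t
    p = numerator t
    e : ∀ a b → (a * b + a * b) * a + (a * b + a * b) * a ≡ 4 * (a * (a * b))
    e = solve-∀
    4k≤k^k : 4 * k ≤ k ^ k
    4k≤k^k = ≤-trans (*-mono-≤ (m≤m+n 4 28) (≤-trans (m≤m*n k k) (m≤m*n (k * k) k))) (≤-trans (m≤m*n (32 * (k * k * k)) (8 ^ k) {{m^n≢0 8 k}}) k-large)
    e′ : ∀ k p → 4 * (k * p) ≡ p * (4 * k)
    e′ = solve-∀
    kp≤d : k * p ≤ d
    kp≤d = *-cancelˡ-≤ 4 (≤-trans (≤-reflexive (e′ k p)) (≤-trans (*-monoʳ-≤ p 4k≤k^k) (numerator≤ t)))

  valid-numerator : ∀ t → Valid (numerator t) (denominator t)
  valid-numerator zero    = subst (Valid 3) (sym (*-identityʳ (k ^ k))) valid-crude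
  valid-numerator (suc t) = valid-refine {numerator t} {denominator t} (1≤denominator t) (numerator≤ t) (valid-numerator t)

  -- The estimate for the excess of `K * numerator t` over `denominator t` grows by a factor `k` per
  -- step, the denominator by `k ^ k`.
  numerator-limit : ∀ t → K * numerator t ≤ denominator t + k ^ t * (2 * k ^ k)
  numerator-limit zero    = begin
    K * 3                               ≤⟨ *-monoˡ-≤ 3 (m∸n≤m (k ^ k) k) ⟩
    k ^ k * 3                           ≡⟨ e (k ^ k) ⟩
    k ^ k * 1 + 1 * (2 * k ^ k)         ∎
    where
    e : ∀ a → a * 3 ≡ a * 1 + 1 * (2 * a)
    e = solve-∀
  numerator-limit (suc t) = begin
    K * (d + k * p)                              ≡⟨ e₁ K d k p ⟩
    K * d + k * (K * p)                          ≤⟨ +-monoʳ-≤ (K * d) (*-monoʳ-≤ k (numerator-limit t)) ⟩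
    K * d + k * (d + k ^ t * (2 * k ^ k))        ≡⟨ e₂ K d k (k ^ t) (k ^ k) ⟩
    (K + k) * d + k * k ^ t * (2 * k ^ k)        ≡⟨ cong (λ z → z * d + k * k ^ t * (2 * k ^ k)) (m∸n+n≡m k≤k^k) ⟩
    k ^ k * d + k * k ^ t * (2 * k ^ k)          ∎
    where
    d = denominator t
    p = numerator t
    e₁ : ∀ K d k p → K * (d + k * p) ≡ K * d + k * (K * p)
    e₁ = solve-∀
    e₂ : ∀ K d k a b → K * d + k * (d + a * (2 * b)) ≡ (K + k) * d + k * a * (2 * b)
    e₂ = solve-∀

  -- A violation is at least 1 by integrality, whereas the relative error after `t` steps allows
  -- only `t / (k ^ m) ^ t`, less than 1 for `t = 2 * tot w ^ k`.
  upper-bound : ∀ w → K * h w ≤ tot w ^ k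
  upper-bound w with K * h w ≤? tot w ^ k
  ... | yes le = le
  ... | no ≰   = ⊥-elim (<⇒≱ too-large (cancel-≤ (k ^ k * k ^ t) (*-mono-≤ (1≤k^k k) (1≤m^n t (s≤s z≤n))) (+-cancelˡ-≤ (d * tot w ^ k) _ _ (begin
    d * tot w ^ k + k ^ k * k ^ t * (k ^ m) ^ t         ≡⟨ cong (d * tot w ^ k +_) (trans (*-assoc (k ^ k) _ _) (cong (k ^ k *_) (sym (^-distrib-* k (k ^ m) t)))) ⟩
    d * tot w ^ k + d                                   ≡⟨ e₁ d (tot w ^ k) ⟩
    d * suc (tot w ^ k)                                 ≤⟨ *-monoʳ-≤ d (≰⇒> ≰) ⟩
    d * (K * h w)                                       ≡⟨ e₂ d K (h w) ⟩
    K * (d * h w)                                       ≤⟨ *-monoʳ-≤ K (valid-numerator t w) ⟩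
    K * (numerator t * tot w ^ k)                       ≡⟨ sym (*-assoc K _ _) ⟩
    K * numerator t * tot w ^ k                         ≤⟨ *-monoˡ-≤ (tot w ^ k) (numerator-limit t) ⟩
    (d + k ^ t * (2 * k ^ k)) * tot w ^ k               ≡⟨ e₃ d (k ^ t) (k ^ k) (tot w ^ k) ⟩
    d * tot w ^ k + k ^ k * k ^ t * t                   ∎))))
    where
    t = 2 * tot w ^ k
    d = denominator t
    e₁ : ∀ a b → a * b + a ≡ a * suc b
    e₁ = solve-∀
    e₂ : ∀ a b c → a * (b * c) ≡ b * (a * c)
    e₂ = solve-∀
    e₃ : ∀ d a b c → (d + a * (2 * b)) * c ≡ d * c + b * a * (2 * c)
    e₃ = solve-∀
    too-large : t < (k ^ m) ^ t
    too-large = ≤-trans (n<2^n t) (^-monoˡ-≤ t (2≤k^m m 1≤m))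
      where
      2≤k^m : ∀ j → 1 ≤ j → 2 ≤ k ^ j
      2≤k^m (suc j) _ = *-mono-≤ (s≤s 1≤m) (1≤m^n j (s≤s z≤n))

-- Copies and embeddings

-- Every `y` is listed exactly once, phrased as the collapse of a delta sum so that it can be used
-- under nested sums.
Enumerates : {A : Set} → DecidableEquality A → List A → Set
Enumerates {A} _≈?_ xs = ∀ y (f : A → ℕ) → ∑[ x ∈ xs ] (𝟙 (x ≈? y) * f x) ≡ f y

vecs-enumerates : ∀ {A : Set} (_≈?_ : DecidableEquality A) {xs} → Enumerates _≈?_ xs →
                  ∀ k → Enumerates (VecP.≡-dec _≈?_) (vecs xs k)
vecs-enumerates _≈?_ en zero [] f = trans (+-identityʳ _) (+-identityʳ (f []))
vecs-enumerates _≈?_ {xs} en (suc k) (y ∷ v) f = begin-equality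
  ∑[ u ∈ vecs xs (suc k) ] (𝟙 (u ≈ᵛ? (y ∷ v)) * f u)
    ≡⟨ ∑-vecs-suc xs k _ ⟩
  ∑[ x ∈ xs ] ∑[ u ∈ vecs xs k ] (𝟙 ((x ∷ u) ≈ᵛ? (y ∷ v)) * f (x ∷ u))
    ≡⟨ ∑-cong xs (λ x → trans (∑-cong (vecs xs k) (λ u → trans (cong (_* f (x ∷ u)) (split x u)) (*-assoc (𝟙 (x ≈? y)) _ _)))
                              (∑-*ˡ (vecs xs k) (𝟙 (x ≈? y)) _)) ⟩
  ∑[ x ∈ xs ] (𝟙 (x ≈? y) * ∑[ u ∈ vecs xs k ] (𝟙 (u ≈ᵛ? v) * f (x ∷ u)))
    ≡⟨ trans (en y _) (vecs-enumerates _≈?_ en k v (λ u → f (y ∷ u))) ⟩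
  f (y ∷ v) ∎
  where
  _≈ᵛ?_ : ∀ {k} → DecidableEquality (Vec _ k)
  _≈ᵛ?_ = VecP.≡-dec _≈?_
  split : ∀ x u → 𝟙 ((x ∷ u) ≈ᵛ? (y ∷ v)) ≡ 𝟙 (x ≈? y) * 𝟙 (u ≈ᵛ? v)
  split x u with x ≈? y | u ≈ᵛ? v
  ... | yes refl | yes refl = refl
  ... | yes refl | no _     = refl
  ... | no _     | yes _    = refl
  ... | no _     | no _     = refl

bools : List Bool
bools = inside ∷ outside ∷ []

bools-enumerates : Enumerates _Bool≟_ bools
bools-enumerates true  f = e (f true)
  where
  e : ∀ a → 1 * a + (0 + 0) ≡ a
  e = solve-∀
bools-enumerates false f = e (f false)
  where
  e : ∀ a → 0 + (1 * a + 0) ≡ a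
  e = solve-∀

subsets : ∀ n → List (Subset n)
subsets = vecs bools

countSub-∑ : ∀ {n} {P : Subset n → Set} (P? : Decidable P) → countSub P? ≡ ∑[ S ∈ subsets n ] 𝟙 (P? S)
countSub-∑ {zero}  P? = trans (isYes-𝟙 (P? [])) (sym (+-identityʳ _))
  where
  isYes-𝟙 : ∀ {A : Set} (d : Dec A) → (if isYes d then 1 else 0) ≡ 𝟙 d
  isYes-𝟙 (yes _) = refl
  isYes-𝟙 (no _)  = refl
countSub-∑ {suc n} P? = begin-equality
  countSub (λ S → P? (inside ∷ S)) + countSub (λ S → P? (outside ∷ S))
    ≡⟨ cong₂ _+_ (countSub-∑ (λ S → P? (inside ∷ S))) (countSub-∑ (λ S → P? (outside ∷ S))) ⟩
  ∑[ S ∈ subsets n ] 𝟙 (P? (inside ∷ S)) + ∑[ S ∈ subsets n ] 𝟙 (P? (outside ∷ S))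
    ≡⟨ cong (∑[ S ∈ subsets n ] 𝟙 (P? (inside ∷ S)) +_) (sym (+-identityʳ _)) ⟩
  ∑[ b ∈ bools ] ∑[ S ∈ subsets n ] 𝟙 (P? (b ∷ S))
    ≡⟨ sym (∑-vecs-suc bools n (λ S → 𝟙 (P? S))) ⟩
  ∑[ S ∈ subsets (suc n) ] 𝟙 (P? S) ∎

∣∣-∑ : ∀ {n} (S : Subset n) → ∣ S ∣ ≡ ∑[ x ∈ fins n ] (if lookup S x then 1 else 0)
∣∣-∑ []          = refl
∣∣-∑ {suc n} (true ∷ S)  = trans (cong suc (∣∣-∑ S)) (sym (∑-fins-suc n (λ x → if lookup (true ∷ S) x then 1 else 0)))
∣∣-∑ {suc n} (false ∷ S) = trans (∣∣-∑ S) (sym (∑-fins-suc n (λ x → if lookup (false ∷ S) x then 1 else 0)))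

vec-ext : ∀ {A : Set} {k} (u v : Vec A k) → (∀ i → lookup u i ≡ lookup v i) → u ≡ v
vec-ext u v eq = trans (sym (VecP.tabulate∘lookup u)) (trans (VecP.tabulate-cong eq) (VecP.tabulate∘lookup v))

module Copies {k n : ℕ} (R : Graph k) (G : TGraph R n) where

  open Weighted R G

  embs : ℕ
  embs = ∑[ σ ∈ maps ] 𝟙 (emb? σ)

  h-ones : h (λ _ → 1) ≡ embs
  h-ones = ∑-cong maps (λ σ → trans (cong (𝟙 (emb? σ) *_) (trans (∏-const k 1) (^-zeroˡ k))) (*-identityʳ _))

  tot-ones : tot (λ _ → 1) ≡ n
  tot-ones = trans (∑-const n 1) (*-identityʳ n)

  IsIso⇒Emb : ∀ {S σ} → IsIso R G S σ → Emb σ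
  IsIso⇒Emb (inj , _ , _ , colours) = inj , colours

  inImage? : ∀ (σ : Vec (Fin n) k) (x : Fin n) → Dec (∃ λ i → lookup σ i ≡ x)
  inImage? σ x = any? (λ i → lookup σ i ≟ x)

  image : Vec (Fin n) k → Subset n
  image σ = tabulate (λ x → does (inImage? σ x))

  ∈-image : ∀ (σ : Vec (Fin n) k) {x : Fin n} → (∃ λ i → lookup σ i ≡ x) → x ∈ image σ
  ∈-image σ {x} ex = VecP.lookup⇒[]= x _ (trans (VecP.lookup∘tabulate _ x) (dec-true (inImage? σ x) ex))

  image-∈ : ∀ (σ : Vec (Fin n) k) {x : Fin n} → x ∈ image σ → ∃ λ i → lookup σ i ≡ x
  image-∈ σ {x} x∈ = from-does (inImage? σ x) (trans (sym (VecP.lookup∘tabulate _ x)) (VecP.[]=⇒lookup x∈))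
    where
    from-does : ∀ {A : Set} (d : Dec A) → does d ≡ true → A
    from-does (yes a) _ = a

  image-unique : ∀ {S σ} → IsIso R G S σ → S ≡ image σ
  image-unique {S} {σ} (_ , into , onto , _) =
    ⊆-antisym (λ {x} x∈ → ∈-image σ (onto x x∈)) (λ {x} x∈ → into′ (image-∈ σ x∈))
    where
    into′ : ∀ {x} → (∃ λ i → lookup σ i ≡ x) → x ∈ S
    into′ (i , refl) = into i

  Emb⇒IsIso : ∀ {σ} → Emb σ → IsIso R G (image σ) σ
  Emb⇒IsIso {σ} (inj , colours) = inj , (λ i → ∈-image σ (i , refl)) , (λ x → image-∈ σ) , colours

  image-size : ∀ {S σ} → IsIso R G S σ → ∣ S ∣ ≡ k
  image-size {S} {σ} (inj , into , onto , _) = begin-equality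
    ∣ S ∣                                                ≡⟨ ∣∣-∑ S ⟩
    ∑[ x ∈ fins n ] (if lookup S x then 1 else 0)        ≡⟨ ∑-cong (fins n) pointwise ⟩
    ∑[ x ∈ fins n ] ∑[ i ∈ fins k ] (𝟙 (x ≟ lookup σ i) * 1) ≡⟨ ∑-swap (fins n) (fins k) _ ⟩
    ∑[ i ∈ fins k ] ∑[ x ∈ fins n ] (𝟙 (x ≟ lookup σ i) * 1) ≡⟨ ∑-cong (fins k) (λ i → ∑-δ n (lookup σ i) (λ _ → 1)) ⟩
    ∑[ i ∈ fins k ] 1                                    ≡⟨ trans (∑-const k 1) (*-identityʳ k) ⟩
    k                                                    ∎
    where
    pointwise : ∀ x → (if lookup S x then 1 else 0) ≡ ∑[ i ∈ fins k ] (𝟙 (x ≟ lookup σ i) * 1)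
    pointwise x with lookup S x in eq
    ... | true with onto x (VecP.lookup⇒[]= x S eq)
    ...   | i₀ , refl = sym (trans (∑-cong (fins k) same) (∑-δ k i₀ (λ _ → 1)))
      where
      same : ∀ i → 𝟙 (lookup σ i₀ ≟ lookup σ i) * 1 ≡ 𝟙 (i ≟ i₀) * 1
      same i with i ≟ i₀
      ... | yes refl = cong (_* 1) (𝟙-yes (lookup σ i ≟ lookup σ i) refl)
      ... | no i≢    = cong (_* 1) (𝟙-no (lookup σ i₀ ≟ lookup σ i) (λ e → i≢ (sym (inj i₀ i e))))
    pointwise x | false = sym (trans (∑-cong (fins k) (λ i → cong (_* 1) (𝟙-no (x ≟ lookup σ i) (missed i)))) (∑-zero (fins k)))
      where
      missed : ∀ i → x ≢ lookup σ i
      missed i refl with trans (sym eq) (VecP.[]=⇒lookup (into i))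
      ... | ()

  private
    _≟ˢ_ : DecidableEquality (Subset n)
    _≟ˢ_ = VecP.≡-dec _Bool≟_
    _≟ᵛ_ : DecidableEquality (Vec (Fin n) k)
    _≟ᵛ_ = VecP.≡-dec _≟_
    en-S : Enumerates _≟ˢ_ (subsets n)
    en-S = vecs-enumerates _Bool≟_ bools-enumerates n
    en-V : Enumerates _≟ᵛ_ maps
    en-V = vecs-enumerates _≟_ (∑-δ n) k

  -- A copy has at least one isomorphism, and a map is an isomorphism onto no set but its image.
  I≤embs : Defs.I R G ≤ embs
  I≤embs = begin
    Defs.I R G
      ≡⟨ countSub-∑ (isCopy? R G) ⟩
    ∑[ S ∈ subsets n ] 𝟙 (isCopy? R G S)
      ≤⟨ ∑-mono (subsets n) some-iso ⟩
    ∑[ S ∈ subsets n ] ∑[ σ ∈ maps ] 𝟙 (isIso? R G S σ)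
      ≡⟨ ∑-swap (subsets n) maps _ ⟩
    ∑[ σ ∈ maps ] ∑[ S ∈ subsets n ] 𝟙 (isIso? R G S σ)
      ≤⟨ ∑-mono maps (λ σ → ∑-mono (subsets n) (one-image σ)) ⟩
    ∑[ σ ∈ maps ] ∑[ S ∈ subsets n ] (𝟙 (S ≟ˢ image σ) * 𝟙 (emb? σ))
      ≡⟨ ∑-cong maps (λ σ → en-S (image σ) (λ _ → 𝟙 (emb? σ))) ⟩
    embs ∎
    where
    some-iso : ∀ S → 𝟙 (isCopy? R G S) ≤ ∑[ σ ∈ maps ] 𝟙 (isIso? R G S σ)
    some-iso S = ≤-trans (≤-reflexive (sym (*-identityʳ _))) (𝟙-*-≤ (isCopy? R G S) exists)
      where
      exists : IsCopy R G S → 1 ≤ ∑[ σ ∈ maps ] 𝟙 (isIso? R G S σ)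
      exists (_ , τ , iso) = begin
        1                                                       ≡⟨ sym (𝟙-yes (isIso? R G S τ) iso) ⟩
        𝟙 (isIso? R G S τ)                                      ≡⟨ sym (en-V τ (λ σ → 𝟙 (isIso? R G S σ))) ⟩
        ∑[ σ ∈ maps ] (𝟙 (σ ≟ᵛ τ) * 𝟙 (isIso? R G S σ))         ≤⟨ ∑-mono maps (λ σ → 𝟙-*-≤ (σ ≟ᵛ τ) (λ _ → ≤-refl)) ⟩
        ∑[ σ ∈ maps ] 𝟙 (isIso? R G S σ)                        ∎
    one-image : ∀ σ S → 𝟙 (isIso? R G S σ) ≤ 𝟙 (S ≟ˢ image σ) * 𝟙 (emb? σ)
    one-image σ S = ≤-trans (≤-reflexive (sym (*-identityʳ _))) (𝟙-*-≤ (isIso? R G S σ) λ iso →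
      ≤-reflexive (sym (cong₂ _*_ (𝟙-yes (S ≟ˢ image σ) (image-unique {S} {σ} iso)) (𝟙-yes (emb? σ) (IsIso⇒Emb {S} {σ} iso)))))

  module _ (connected : Connected R) (other : ∀ i j → ∃ λ l → adj R i l ≡ true × l ≢ j) where

    -- Comparing `σ` and `τ` yields a colour-preserving map of the roles, injective and hence not
    -- constant, so `rigid` makes it the identity: `R` has no nontrivial automorphism.
    iso-unique : ∀ {S σ τ} → IsIso R G S σ → IsIso R G S τ → τ ≡ σ
    iso-unique {S} {σ} {τ} (σ-inj , _ , σ-onto , σ-col) (τ-inj , τ-into , _ , τ-col) =
      vec-ext τ σ (λ i → trans (sym (proj₂ (σ-onto _ (τ-into i)))) (cong (lookup σ) (identity i)))
      where
      p : Fin k → Fin k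
      p i = proj₁ (σ-onto _ (τ-into i))
      σp : ∀ i → lookup σ (p i) ≡ lookup τ i
      σp i = proj₂ (σ-onto _ (τ-into i))
      preserves : ∀ i j → p i ≢ p j → χ R i j ≡ χ R (p i) (p j)
      preserves i j ≢ = trans (sym (τ-col i j (λ i≡j → ≢ (cong p i≡j))))
                              (trans (cong₂ (col G) (sym (σp i)) (sym (σp j))) (σ-col (p i) (p j) ≢))
      identity : ∀ i → p i ≡ i
      identity i with rigid R connected other p preserves
      ... | inj₁ id    = id i
      ... | inj₂ const with other i i
      ...   | j , _ , j≢i = ⊥-elim (j≢i (τ-inj j i (trans (sym (σp j)) (trans (cong (lookup σ) (const j i)) (σp i)))))

    embs≤I : embs ≤ Defs.I R G
    embs≤I = begin
      embs
        ≡⟨ ∑-cong maps (λ σ → sym (en-S (image σ) (λ _ → 𝟙 (emb? σ)))) ⟩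
      ∑[ σ ∈ maps ] ∑[ S ∈ subsets n ] (𝟙 (S ≟ˢ image σ) * 𝟙 (emb? σ))
        ≤⟨ ∑-mono maps (λ σ → ∑-mono (subsets n) (image-iso σ)) ⟩
      ∑[ σ ∈ maps ] ∑[ S ∈ subsets n ] 𝟙 (isIso? R G S σ)
        ≡⟨ ∑-swap maps (subsets n) _ ⟩
      ∑[ S ∈ subsets n ] ∑[ σ ∈ maps ] 𝟙 (isIso? R G S σ)
        ≤⟨ ∑-mono (subsets n) one-iso ⟩
      ∑[ S ∈ subsets n ] 𝟙 (isCopy? R G S)
        ≡⟨ sym (countSub-∑ (isCopy? R G)) ⟩
      Defs.I R G ∎
      where
      image-iso : ∀ σ S → 𝟙 (S ≟ˢ image σ) * 𝟙 (emb? σ) ≤ 𝟙 (isIso? R G S σ)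
      image-iso σ S = 𝟙-*-≤ (S ≟ˢ image σ) (λ { refl → ≤-trans (≤-reflexive (sym (*-identityʳ _))) (𝟙-*-≤ (emb? σ) λ em →
        ≤-reflexive (sym (𝟙-yes (isIso? R G (image σ) σ) (Emb⇒IsIso {σ} em)))) })
      one-iso : ∀ S → ∑[ σ ∈ maps ] 𝟙 (isIso? R G S σ) ≤ 𝟙 (isCopy? R G S)
      one-iso S = bound (isCopy? R G S)
        where
        bound : (d : Dec (IsCopy R G S)) → ∑[ σ ∈ maps ] 𝟙 (isIso? R G S σ) ≤ 𝟙 d
        bound (yes (_ , τ , iso)) = begin
          ∑[ σ ∈ maps ] 𝟙 (isIso? R G S σ)       ≤⟨ ∑-mono maps (λ σ → ≤-trans (≤-reflexive (sym (*-identityʳ _))) (𝟙-*-≤ (isIso? R G S σ)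
                                                      (λ iso′ → ≤-𝟙-* (σ ≟ᵛ τ) (iso-unique {S} {τ} {σ} iso iso′)))) ⟩
          ∑[ σ ∈ maps ] (𝟙 (σ ≟ᵛ τ) * 1)         ≡⟨ en-V τ (λ _ → 1) ⟩
          1                                      ∎
        bound (no ¬copy) = ≤-reflexive (trans (∑-cong maps (λ σ → 𝟙-no (isIso? R G S σ) (λ iso → ¬copy (image-size {S} {σ} iso , σ , iso)))) (∑-zero maps))

-- The iterated blow-up

χ-sym : ∀ {k} (R : Graph k) i j → χ R i j ≡ χ R j i
χ-sym R i j rewrite Graph.sym R i j with adj R j i
... | false = refl
... | true  = cong just (upair-sym i j)
  where
  upair-sym : ∀ {k} (i j : Fin k) → upair i j ≡ upair j i
  upair-sym i j with i FinP.≤? j | j FinP.≤? i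
  ... | yes i≤j | yes j≤i = cong₂ _,_ (FinP.≤-antisym i≤j j≤i) (FinP.≤-antisym j≤i i≤j)
  ... | yes _   | no _    = refl
  ... | no _    | yes _   = refl
  ... | no i≰j  | no j≰i  with FinP.≤-total i j
  ...   | inj₁ i≤j = ⊥-elim (i≰j i≤j)
  ...   | inj₂ j≤i = ⊥-elim (j≰i j≤i)

χ-InT : ∀ {k} (R : Graph k) i j → InT R (χ R i j)
χ-InT R i j with adj R i j in eq
... | false = inj₁ refl
... | true  = inj₂ (i , j , eq , sym (cong (λ b → if b then just (upair i j) else nothing) eq))

∑-injection : ∀ {q n} (e : Fin q → Fin n) → (∀ a b → e a ≡ e b → a ≡ b) → (f : Fin n → ℕ) →
              ∑[ a ∈ fins q ] f (e a) ≤ ∑ (fins n) f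
∑-injection {q} {n} e e-inj f = begin
  ∑[ a ∈ fins q ] f (e a)                                      ≡⟨ ∑-cong (fins q) (λ a → sym (∑-δ n (e a) f)) ⟩
  ∑[ a ∈ fins q ] ∑[ x ∈ fins n ] (𝟙 (x ≟ e a) * f x)          ≡⟨ ∑-swap (fins q) (fins n) _ ⟩
  ∑[ x ∈ fins n ] ∑[ a ∈ fins q ] (𝟙 (x ≟ e a) * f x)          ≡⟨ ∑-cong (fins n) (λ x → ∑-*ʳ (fins q) (f x) (λ a → 𝟙 (x ≟ e a))) ⟩
  ∑[ x ∈ fins n ] (∑[ a ∈ fins q ] 𝟙 (x ≟ e a) * f x)          ≤⟨ ∑-mono (fins n) (λ x → ≤-trans (*-monoˡ-≤ (f x) (fibre x)) (≤-reflexive (+-identityʳ (f x)))) ⟩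
  ∑ (fins n) f                                                 ∎
  where
  fibre : ∀ x → ∑[ a ∈ fins q ] 𝟙 (x ≟ e a) ≤ 1
  fibre x with any? (λ a → x ≟ e a)
  ... | no none = ≤-trans (≤-reflexive (trans (∑-cong (fins q) (λ a → 𝟙-no (x ≟ e a) (λ eq → none (a , eq)))) (∑-zero (fins q)))) z≤n
  ... | yes (b , refl) = begin
    ∑[ a ∈ fins q ] 𝟙 (e b ≟ e a)      ≤⟨ ∑-mono (fins q) (λ a → ≤-trans (≤-reflexive (sym (*-identityʳ _))) (𝟙-*-≤ (e b ≟ e a) (λ eq → ≤-𝟙-* (a ≟ b) (sym (e-inj b a eq))))) ⟩
    ∑[ a ∈ fins q ] (𝟙 (a ≟ b) * 1)    ≡⟨ ∑-δ q b (λ _ → 1) ⟩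
    1                                  ∎

mapEach : ∀ {q n k} → (Fin k → Fin q → Fin n) → Vec (Fin q) k → Vec (Fin n) k
mapEach e []      = []
mapEach e (a ∷ τ) = e zero a ∷ mapEach (e ∘ suc) τ

lookup-mapEach : ∀ {q n k} (e : Fin k → Fin q → Fin n) τ l → lookup (mapEach e τ) l ≡ e l (lookup τ l)
lookup-mapEach e (a ∷ τ) zero    = refl
lookup-mapEach e (a ∷ τ) (suc l) = lookup-mapEach (e ∘ suc) τ l

∑-mapEach : ∀ {q n} k (e : Fin k → Fin q → Fin n) → (∀ l a b → e l a ≡ e l b → a ≡ b) → (f : Vec (Fin n) k → ℕ) →
            ∑[ τ ∈ vecs (fins q) k ] f (mapEach e τ) ≤ ∑ (vecs (fins n) k) f
∑-mapEach zero    e e-inj f = ≤-refl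
∑-mapEach {q} {n} (suc k) e e-inj f = begin
  ∑[ τ ∈ vecs (fins q) (suc k) ] f (mapEach e τ)
    ≡⟨ ∑-vecs-suc (fins q) k _ ⟩
  ∑[ a ∈ fins q ] ∑[ τ ∈ vecs (fins q) k ] f (e zero a ∷ mapEach (e ∘ suc) τ)
    ≤⟨ ∑-mono (fins q) (λ a → ∑-mapEach k (e ∘ suc) (e-inj ∘ suc) (λ σ → f (e zero a ∷ σ))) ⟩
  ∑[ a ∈ fins q ] ∑[ σ ∈ vecs (fins n) k ] f (e zero a ∷ σ)
    ≤⟨ ∑-injection (e zero) (e-inj zero) (λ x → ∑[ σ ∈ vecs (fins n) k ] f (x ∷ σ)) ⟩
  ∑[ x ∈ fins n ] ∑[ σ ∈ vecs (fins n) k ] f (x ∷ σ)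
    ≡⟨ sym (∑-vecs-suc (fins n) k f) ⟩
  ∑ (vecs (fins n) (suc k)) f ∎

module Fractal {m : ℕ} (R : Graph (suc m)) (1≤m : 1 ≤ m) where

  private
    k = suc m

  residue : ℕ → Fin k
  residue x = x mod k

  toℕ-residue : ∀ x → toℕ (residue x) ≡ x % k
  toℕ-residue x = FinP.toℕ-fromℕ< (m%n<n x k)

  residue-+ : ∀ (i : Fin k) a → residue (toℕ i + a * k) ≡ i
  residue-+ i a = FinP.toℕ-injective (trans (toℕ-residue (toℕ i + a * k)) (trans ([m+kn]%n≡m%n (toℕ i) a k) (m<n⇒m%n≡m (FinP.toℕ<n i))))

  quotient-+ : ∀ (i : Fin k) a → (toℕ i + a * k) / k ≡ a
  quotient-+ i a = trans (+-distrib-/-∣ʳ (toℕ i) (n∣m*n a)) (cong₂ _+_ (m<n⇒m/n≡0 (FinP.toℕ<n i)) (m*n/n≡m a k))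

  -- The infinite iterated blow-up on ℕ, read off base-k digits: compare the last
  -- digits, and recurse when they agree.  The first argument bounds the depth.
  colour : ℕ → ℕ → ℕ → Col k
  colour zero    x y = nothing
  colour (suc f) x y = if does (residue x ≟ residue y) then colour f (x / k) (y / k) else χ R (residue x) (residue y)

  colour-≢ : ∀ f x y → residue x ≢ residue y → colour (suc f) x y ≡ χ R (residue x) (residue y)
  colour-≢ f x y ≢ with residue x ≟ residue y
  ... | yes eq = ⊥-elim (≢ eq)
  ... | no _   = refl

  colour-≡ : ∀ f x y → residue x ≡ residue y → colour (suc f) x y ≡ colour f (x / k) (y / k)
  colour-≡ f x y eq with residue x ≟ residue y
  ... | yes _ = refl
  ... | no ≢  = ⊥-elim (≢ eq)

  colour-+ : ∀ f i a b → colour (suc f) (toℕ i + a * k) (toℕ i + b * k) ≡ colour f a b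
  colour-+ f i a b = trans (colour-≡ f (toℕ i + a * k) (toℕ i + b * k) (trans (residue-+ i a) (sym (residue-+ i b))))
                           (cong₂ (colour f) (quotient-+ i a) (quotient-+ i b))

  colour-sym : ∀ f x y → colour f x y ≡ colour f y x
  colour-sym zero    x y = refl
  colour-sym (suc f) x y with residue x ≟ residue y | residue y ≟ residue x
  ... | yes _  | yes _  = colour-sym f (x / k) (y / k)
  ... | yes eq | no ≢   = ⊥-elim (≢ (sym eq))
  ... | no ≢   | yes eq = ⊥-elim (≢ (sym eq))
  ... | no _   | no _   = χ-sym R (residue x) (residue y)

  colour-InT : ∀ f x y → InT R (colour f x y)
  colour-InT zero    x y = inj₁ refl
  colour-InT (suc f) x y with residue x ≟ residue y
  ... | yes _ = colour-InT f (x / k) (y / k)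
  ... | no _  = χ-InT R (residue x) (residue y)

  fractal : ℕ → ∀ n → TGraph R n
  fractal f n = record
    { col     = λ a b → colour f (toℕ a) (toℕ b)
    ; col-sym = λ a b → colour-sym f (toℕ a) (toℕ b)
    ; col-T   = λ a b _ → colour-InT f (toℕ a) (toℕ b)
    }

  private
    abstract
      remainder? : ∀ n (i : Fin k) → Dec (toℕ i < n % k)
      remainder? n i = toℕ i <? n % k

  -- The number of x < n with residue i.
  size : ℕ → Fin k → ℕ
  size n i = if does (remainder? n i) then suc (n / k) else n / k

  size-bounds : ∀ n i → n / k ≤ size n i × size n i ≤ suc (n / k)
  size-bounds n i with remainder? n i
  ... | yes _ = n≤1+n _ , ≤-refl
  ... | no _  = ≤-refl , n≤1+n _

  <size⇒ : ∀ n i {a} → a < size n i → toℕ i + a * k < n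
  <size⇒ n i {a} a< with remainder? n i
  ... | yes i< = begin-strict
    toℕ i + a * k          <⟨ +-mono-<-≤ i< (*-monoˡ-≤ k (s≤s⁻¹ a<)) ⟩
    n % k + n / k * k      ≡⟨ sym (m≡m%n+[m/n]*n n k) ⟩
    n                      ∎
  ... | no _   = begin-strict
    toℕ i + a * k          <⟨ +-monoˡ-< (a * k) (FinP.toℕ<n i) ⟩
    suc a * k              ≤⟨ *-monoˡ-≤ k a< ⟩
    n / k * k              ≤⟨ m/n*n≤m n k ⟩
    n                      ∎

  <size : ∀ {n x} → x < n → x / k < size n (residue x)
  <size {n} {x} x<n with remainder? n (residue x)
  ... | yes _ = s≤s (/-monoˡ-≤ k (<⇒≤ x<n))
  ... | no ≮  = ≤∧≢⇒< (/-monoˡ-≤ k (<⇒≤ x<n)) (λ eq → <⇒≱ x<n (begin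
    n                        ≡⟨ m≡m%n+[m/n]*n n k ⟩
    n % k + n / k * k        ≤⟨ +-mono-≤ (≤-trans (≮⇒≥ ≮) (≤-reflexive (toℕ-residue x))) (≤-reflexive (cong (_* k) (sym eq))) ⟩
    x % k + x / k * k        ≡⟨ sym (m≡m%n+[m/n]*n x k) ⟩
    x                        ∎))

  -- The recursion into a class terminates because `k` is at least 2: in a class with two or more
  -- elements, the last one, `toℕ i + a * k`, already exceeds the class size less one.
  size<n : ∀ n i → 2 ≤ n → size n i < n
  size<n n i 2≤n with size n i in eq
  ... | zero  = ≤-trans (s≤s z≤n) 2≤n
  ... | suc zero = 2≤n
  ... | suc (suc a) = begin-strict
    suc (suc a)              <⟨ s≤s (s≤s (≤-trans (s≤s (m≤m+n a a)) (≤-reflexive (sym (+-suc a a))))) ⟩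
    suc (suc a + suc a)      ≡⟨ cong suc (e (suc a)) ⟩
    suc (suc a * 2)          ≤⟨ s≤s (≤-trans (*-monoʳ-≤ (suc a) (s≤s 1≤m)) (m≤n+m _ (toℕ i))) ⟩
    suc (toℕ i + suc a * k)  ≤⟨ <size⇒ n i (subst (suc a <_) (sym eq) ≤-refl) ⟩
    n                        ∎
    where
    e : ∀ a → a + a ≡ a * 2
    e = solve-∀

  vertex : ∀ {n} (i : Fin k) a → .(toℕ i + a * k < n) → Fin n
  vertex i a lt = fromℕ< lt

  toℕ-vertex : ∀ {n} i a (lt : toℕ i + a * k < n) → toℕ (vertex i a lt) ≡ toℕ i + a * k
  toℕ-vertex i a lt = FinP.toℕ-fromℕ< lt

  vertex-injective : ∀ {n} i a b (lt : toℕ i + a * k < n) (lt′ : toℕ i + b * k < n) → vertex i a lt ≡ vertex i b lt′ → a ≡ b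
  vertex-injective i a b lt lt′ eq =
    trans (sym (quotient-+ i a)) (trans (cong (_/ k) (trans (sym (toℕ-vertex i a lt)) (trans (cong toℕ eq) (toℕ-vertex i b lt′)))) (quotient-+ i b))

  -- Stated for any `G` agreeing with `colour` so that it applies to the graph pulled back to a
  -- class: enumerating class `i` by `a ↦ toℕ i + a * k` strips the last digit, leaving `colour` of
  -- one depth less.
  isBlowUp : ∀ f {n} (G : TGraph R n) → n ≤ f → (∀ a b → a ≢ b → col G a b ≡ colour f (toℕ a) (toℕ b)) → IsBlowUp R G
  isBlowUp f {n} G n≤f agrees with n <? k
  ... | yes n<k = small G n<k
  isBlowUp zero    G z≤n agrees | no n≮k = ⊥-elim (n≮k (s≤s z≤n))
  isBlowUp (suc f) {n} G n≤f agrees | no n≮k =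
    blow G k≤n (residue ∘ toℕ) (size n) e e-inj e-in e-onto
         (λ i j → ≤-trans (proj₂ (size-bounds n i)) (s≤s (proj₁ (size-bounds n j)))) cross sub
    where
    k≤n : k ≤ n
    k≤n = ≮⇒≥ n≮k
    e-lt : ∀ i (a : Fin (size n i)) → toℕ i + toℕ a * k < n
    e-lt i a = <size⇒ n i (FinP.toℕ<n a)
    e : ∀ i → Fin (size n i) → Fin n
    e i a = vertex i (toℕ a) (e-lt i a)
    toℕ-e : ∀ i a → toℕ (e i a) ≡ toℕ i + toℕ a * k
    toℕ-e i a = toℕ-vertex i (toℕ a) (e-lt i a)
    e-inj : ∀ i a b → e i a ≡ e i b → a ≡ b
    e-inj i a b eq = FinP.toℕ-injective (vertex-injective i (toℕ a) (toℕ b) (e-lt i a) (e-lt i b) eq)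
    e-in : ∀ i a → residue (toℕ (e i a)) ≡ i
    e-in i a = trans (cong residue (toℕ-e i a)) (residue-+ i (toℕ a))
    e-onto : ∀ x → ∃ λ a → e (residue (toℕ x)) a ≡ x
    e-onto x = a , FinP.toℕ-injective (begin-equality
      toℕ (e (residue (toℕ x)) a)                    ≡⟨ toℕ-e (residue (toℕ x)) a ⟩
      toℕ (residue (toℕ x)) + toℕ a * k              ≡⟨ cong₂ (λ u v → u + v * k) (toℕ-residue (toℕ x)) (FinP.toℕ-fromℕ< (<size (FinP.toℕ<n x))) ⟩
      toℕ x % k + toℕ x / k * k                      ≡⟨ sym (m≡m%n+[m/n]*n (toℕ x) k) ⟩
      toℕ x                                          ∎)
      where
      a : Fin (size n (residue (toℕ x)))
      a = fromℕ< (<size (FinP.toℕ<n x))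
    cross : ∀ x y → residue (toℕ x) ≢ residue (toℕ y) → col G x y ≡ χ R (residue (toℕ x)) (residue (toℕ y))
    cross x y ≢ = trans (agrees x y (λ x≡y → ≢ (cong (residue ∘ toℕ) x≡y))) (colour-≢ f (toℕ x) (toℕ y) ≢)
    sub : ∀ i → IsBlowUp R (pull G (e i) (e-inj i))
    sub i = isBlowUp f (pull G (e i) (e-inj i)) (s≤s⁻¹ (≤-trans (size<n n i (≤-trans (s≤s 1≤m) k≤n)) n≤f)) (λ a b a≢b →
      trans (agrees (e i a) (e i b) (λ eq → a≢b (e-inj i a b eq)))
            (trans (cong₂ (colour (suc f)) (toℕ-e i a) (toℕ-e i b)) (colour-+ f i (toℕ a) (toℕ b))))

  copies : ℕ → ℕ → ℕ
  copies f n = Copies.embs R (fractal f n)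

  -- Two families of embeddings: one image in every class in the order of the roles, or all images
  -- in one class. They are disjoint because there are at least two roles; only the first `q`
  -- elements of each class are used.
  copies-step : ∀ f n q → q * k ≤ n → q ^ k + k * copies f q ≤ copies (suc f) n
  copies-step f n q qk≤n = begin
    q ^ k + k * copies f q
      ≤⟨ +-mono-≤ crossing (≤-trans (≤-reflexive (sym (∑-const k (copies f q)))) (∑-mono (fins k) inner)) ⟩
    ∑[ σ ∈ maps ] (𝟙 (emb? σ) * 𝟙 (crossing? σ)) + ∑[ i ∈ fins k ] ∑[ σ ∈ maps ] (𝟙 (emb? σ) * 𝟙 (inside? i σ))
      ≡⟨ cong (∑[ σ ∈ maps ] (𝟙 (emb? σ) * 𝟙 (crossing? σ)) +_) (trans (∑-swap (fins k) maps _) (∑-cong maps (λ σ → ∑-*ˡ (fins k) (𝟙 (emb? σ)) (λ i → 𝟙 (inside? i σ))))) ⟩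
    ∑[ σ ∈ maps ] (𝟙 (emb? σ) * 𝟙 (crossing? σ)) + ∑[ σ ∈ maps ] (𝟙 (emb? σ) * ∑[ i ∈ fins k ] 𝟙 (inside? i σ))
      ≡⟨ sym (trans (∑-cong maps (λ σ → *-distribˡ-+ (𝟙 (emb? σ)) _ _)) (∑-+ maps _ _)) ⟩
    ∑[ σ ∈ maps ] (𝟙 (emb? σ) * (𝟙 (crossing? σ) + ∑[ i ∈ fins k ] 𝟙 (inside? i σ)))
      ≤⟨ ∑-mono maps (λ σ → ≤-trans (*-monoʳ-≤ (𝟙 (emb? σ)) (exclusive σ)) (≤-reflexive (*-identityʳ _))) ⟩
    copies (suc f) n ∎
    where
    open Weighted R (fractal (suc f) n)
    module Q = Weighted R (fractal f q)
    ρ′ : Vec (Fin n) k → Fin k → Fin k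
    ρ′ σ l = residue (toℕ (lookup σ l))
    abstract
      crossing? : ∀ σ → Dec (∀ l → ρ′ σ l ≡ l)
      crossing? σ = all? (λ l → ρ′ σ l ≟ l)
      inside? : ∀ i σ → Dec (∀ l → ρ′ σ l ≡ i)
      inside? i σ = all? (λ l → ρ′ σ l ≟ i)
    one : Fin k
    one = fromℕ< (s≤s 1≤m)
    zero≢one : Fin.zero ≢ one
    zero≢one eq with trans (cong toℕ eq) (FinP.toℕ-fromℕ< (s≤s 1≤m))
    ... | ()
    exclusive : ∀ σ → 𝟙 (crossing? σ) + ∑[ i ∈ fins k ] 𝟙 (inside? i σ) ≤ 1
    exclusive σ with crossing? σ
    ... | yes cr = ≤-reflexive (cong suc (trans (∑-cong (fins k) (λ i → 𝟙-no (inside? i σ) (λ ins →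
                     zero≢one (trans (sym (cr zero)) (trans (ins zero) (trans (sym (ins one)) (cr one))))))) (∑-zero (fins k))))
    ... | no _   = begin
      ∑[ i ∈ fins k ] 𝟙 (inside? i σ)              ≤⟨ ∑-mono (fins k) (λ i → ≤-trans (≤-reflexive (sym (*-identityʳ _))) (𝟙-*-≤ (inside? i σ) (λ ins → ≤-𝟙-* (i ≟ ρ′ σ zero) (sym (ins zero))))) ⟩
      ∑[ i ∈ fins k ] (𝟙 (i ≟ ρ′ σ zero) * 1)      ≡⟨ ∑-δ k (ρ′ σ zero) (λ _ → 1) ⟩
      1                                            ∎
    lt : ∀ (i : Fin k) (a : Fin q) → toℕ i + toℕ a * k < n
    lt i a = begin-strict
      toℕ i + toℕ a * k        <⟨ +-monoˡ-< (toℕ a * k) (FinP.toℕ<n i) ⟩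
      suc (toℕ a) * k          ≤⟨ *-monoˡ-≤ k (FinP.toℕ<n a) ⟩
      q * k                    ≤⟨ qk≤n ⟩
      n                        ∎
    v : Fin k → Fin q → Fin n
    v i a = vertex i (toℕ a) (lt i a)
    toℕ-v : ∀ i a → toℕ (v i a) ≡ toℕ i + toℕ a * k
    toℕ-v i a = toℕ-vertex i (toℕ a) (lt i a)
    v-residue : ∀ i a → residue (toℕ (v i a)) ≡ i
    v-residue i a = trans (cong residue (toℕ-v i a)) (residue-+ i (toℕ a))
    v-inj : ∀ i a b → v i a ≡ v i b → a ≡ b
    v-inj i a b eq = FinP.toℕ-injective (vertex-injective i (toℕ a) (toℕ b) (lt i a) (lt i b) eq)
    crossing : q ^ k ≤ ∑[ σ ∈ maps ] (𝟙 (emb? σ) * 𝟙 (crossing? σ))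
    crossing = begin
      q ^ k                                                 ≡⟨ sym (trans (∏-cong k (λ _ → trans (∑-const q 1) (*-identityʳ q))) (∏-const k q)) ⟩
      ∏ k (λ _ → ∑[ a ∈ fins q ] 1)                         ≡⟨ sym (∑-∏ q k (λ _ _ → 1)) ⟩
      ∑[ τ ∈ vecs (fins q) k ] ∏ k (λ _ → 1)                ≤⟨ ∑-mono (vecs (fins q) k) value ⟩
      ∑[ τ ∈ vecs (fins q) k ] (𝟙 (emb? (mapEach v τ)) * 𝟙 (crossing? (mapEach v τ)))
                                                            ≤⟨ ∑-mapEach k v v-inj (λ σ → 𝟙 (emb? σ) * 𝟙 (crossing? σ)) ⟩
      ∑[ σ ∈ maps ] (𝟙 (emb? σ) * 𝟙 (crossing? σ))          ∎
      where
      value : ∀ τ → ∏ k (λ _ → 1) ≤ 𝟙 (emb? (mapEach v τ)) * 𝟙 (crossing? (mapEach v τ))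
      value τ = ≤-reflexive (trans (trans (∏-const k 1) (^-zeroˡ k)) (sym (cong₂ _*_ (𝟙-yes (emb? (mapEach v τ)) em) (𝟙-yes (crossing? (mapEach v τ)) cr))))
        where
        cr : ∀ l → ρ′ (mapEach v τ) l ≡ l
        cr l = trans (cong (residue ∘ toℕ) (lookup-mapEach v τ l)) (v-residue l (lookup τ l))
        em : Emb (mapEach v τ)
        em = (λ i j eq → trans (sym (cr i)) (trans (cong (residue ∘ toℕ) eq) (cr j)))
           , (λ i j i≢j → trans (colour-≢ f (toℕ (lookup (mapEach v τ) i)) (toℕ (lookup (mapEach v τ) j)) (λ eq → i≢j (trans (sym (cr i)) (trans eq (cr j))))) (cong₂ (χ R) (cr i) (cr j)))
    inner : ∀ i → copies f q ≤ ∑[ σ ∈ maps ] (𝟙 (emb? σ) * 𝟙 (inside? i σ))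
    inner i = begin
      copies f q                                            ≤⟨ ∑-mono Q.maps value ⟩
      ∑[ τ ∈ Q.maps ] (𝟙 (emb? (lift τ)) * 𝟙 (inside? i (lift τ)))
                                                            ≤⟨ ∑-mapEach k (λ _ → v i) (λ _ → v-inj i) (λ σ → 𝟙 (emb? σ) * 𝟙 (inside? i σ)) ⟩
      ∑[ σ ∈ maps ] (𝟙 (emb? σ) * 𝟙 (inside? i σ))          ∎
      where
      lift : Vec (Fin q) k → Vec (Fin n) k
      lift = mapEach (λ _ → v i)
      value : ∀ τ → 𝟙 (Q.emb? τ) ≤ 𝟙 (emb? (lift τ)) * 𝟙 (inside? i (lift τ))
      value τ = ≤-trans (≤-reflexive (sym (*-identityʳ _))) (𝟙-*-≤ (Q.emb? τ) (λ em →
        ≤-reflexive (sym (cong₂ _*_ (𝟙-yes (emb? (lift τ)) (lifted em)) (𝟙-yes (inside? i (lift τ)) ins)))))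
        where
        lk : ∀ l → lookup (lift τ) l ≡ v i (lookup τ l)
        lk = lookup-mapEach (λ _ → v i) τ
        ins : ∀ l → ρ′ (lift τ) l ≡ i
        ins l = trans (cong (residue ∘ toℕ) (lk l)) (v-residue i (lookup τ l))
        lifted : Q.Emb τ → Emb (lift τ)
        lifted (inj , colours) =
            (λ a b eq → inj a b (v-inj i _ _ (trans (sym (lk a)) (trans eq (lk b)))))
          , (λ a b a≢b → trans (cong₂ (λ x y → colour (suc f) (toℕ x) (toℕ y)) (lk a) (lk b))
                         (trans (cong₂ (colour (suc f)) (toℕ-v i (lookup τ a)) (toℕ-v i (lookup τ b)))
                         (trans (colour-+ f i _ _) (colours a b a≢b))))

  -- The recursion of `copies-step` when there are exactly `k ^ d` vertices.
  levels : ℕ → ℕ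
  levels zero    = 0
  levels (suc d) = (k ^ d) ^ k + k * levels d

  -- The added `k ^ d` makes the recursion geometric, as `K * X + k * X = k ^ k * X`.
  levels-closed : ∀ d → (k ^ k ∸ k) * levels d + k ^ d ≡ (k ^ d) ^ k
  levels-closed zero    = trans (cong (_+ 1) (*-zeroʳ (k ^ k ∸ k))) (sym (^-zeroˡ k))
  levels-closed (suc d) = begin-equality
    K * (X + k * levels d) + k * k ^ d       ≡⟨ e₁ K X k (levels d) (k ^ d) ⟩
    K * X + k * (K * levels d + k ^ d)       ≡⟨ cong (λ z → K * X + k * z) (levels-closed d) ⟩
    K * X + k * X                            ≡⟨ sym (*-distribʳ-+ X K k) ⟩
    (K + k) * X                              ≡⟨ cong (_* X) (m∸n+n≡m (m≤m^suc k m (s≤s z≤n))) ⟩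
    k ^ k * X                                ≡⟨ sym (^-distrib-* k (k ^ d) k) ⟩
    (k * k ^ d) ^ k                          ∎
    where
    K = k ^ k ∸ k
    X = (k ^ d) ^ k
    e₁ : ∀ K X k l p → K * (X + k * l) + k * p ≡ K * X + k * (K * l + p)
    e₁ = solve-∀

  -- Induction on `d` with `q` fixed: one step passes from `q * k ^ suc d` vertices to `q * k ^ d`
  -- per class, and both terms of `levels` scale by `q ^ k`.
  copies-levels : ∀ d f n q → d ≤ f → q * k ^ d ≤ n → levels d * q ^ k ≤ copies f n
  copies-levels zero    f       n q _  _  = z≤n
  copies-levels (suc d) (suc f) n q d≤f le = begin
    ((k ^ d) ^ k + k * levels d) * q ^ k       ≡⟨ e ((k ^ d) ^ k) k (levels d) (q ^ k) ⟩
    q ^ k * (k ^ d) ^ k + k * (levels d * q ^ k) ≡⟨ cong (_+ k * (levels d * q ^ k)) (sym (^-distrib-* q (k ^ d) k)) ⟩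
    (q * k ^ d) ^ k + k * (levels d * q ^ k)   ≤⟨ +-monoʳ-≤ ((q * k ^ d) ^ k) (*-monoʳ-≤ k (copies-levels d f (q * k ^ d) q (s≤s⁻¹ d≤f) ≤-refl)) ⟩
    (q * k ^ d) ^ k + k * copies f (q * k ^ d) ≤⟨ copies-step f n (q * k ^ d) (≤-trans (≤-reflexive (e′ q (k ^ d) k)) le) ⟩
    copies (suc f) n                           ∎
    where
    e : ∀ X k l p → (X + k * l) * p ≡ p * X + k * (l * p)
    e = solve-∀
    e′ : ∀ q a k → q * a * k ≡ q * (k * a)
    e′ = solve-∀

  lower-bound : ∀ d f n q → d ≤ f → q * k ^ d ≤ n → (q * k ^ d) ^ k ≤ (k ^ k ∸ k) * copies f n + q ^ k * k ^ d
  lower-bound d f n q d≤f le = begin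
    (q * k ^ d) ^ k                                    ≡⟨ trans (^-distrib-* q (k ^ d) k) (cong (q ^ k *_) (sym (levels-closed d))) ⟩
    q ^ k * (K * levels d + k ^ d)                     ≡⟨ e (q ^ k) K (levels d) (k ^ d) ⟩
    K * (levels d * q ^ k) + q ^ k * k ^ d             ≤⟨ +-monoˡ-≤ (q ^ k * k ^ d) (*-monoʳ-≤ K (copies-levels d f n q d≤f le)) ⟩
    K * copies f n + q ^ k * k ^ d                     ∎
    where
    K = k ^ k ∸ k
    e : ∀ p K l a → p * (K * l + a) ≡ K * (l * p) + p * a
    e = solve-∀

-- Densities

-- Only the denominator of `ε` enters: a positive `ε` is at least 1 over it.
ratio≤ratio+ : ∀ {a b c d} → 1 ≤ b → 1 ≤ d → ∀ ε → ℚ.0ℚ ℚ.< ε →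
               a * d * ℚ.↧ₙ ε ≤ (c * ℚ.↧ₙ ε + d) * b → ratio a b ℚ.≤ ratio c d ℚ.+ ε
ratio≤ratio+ {a} {suc b} {c} {suc d} _ _ ε 0<ε le = go ε (ℚ.positive 0<ε) le
  where
  go : ∀ ε → ℚ.Positive ε → a * suc d * ℚ.↧ₙ ε ≤ (c * ℚ.↧ₙ ε + suc d) * suc b → ratio a (suc b) ℚ.≤ ratio c (suc d) ℚ.+ ε
  go ε@(ℚ.mkℚ ℤ.+[1+ e ] s-1 _) _ le = ℚP.toℚᵘ-cancel-≤
    (ℚᵘP.≤-trans (ℚᵘP.≤-reflexive (ℚP.toℚᵘ-fromℚᵘ (ℚᵘ.mkℚᵘ (ℤ.+ a) b)))
    (ℚᵘP.≤-trans (ℚᵘ.*≤* cross)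
    (ℚᵘP.≤-reflexive (ℚᵘP.≃-sym (ℚᵘP.≃-trans (ℚP.toℚᵘ-homo-+ (ratio c (suc d)) ε)
                                             (ℚᵘP.+-congˡ (ℚ.toℚᵘ ε) (ℚP.toℚᵘ-fromℚᵘ (ℚᵘ.mkℚᵘ (ℤ.+ c) d))))))))
    where
    s = suc s-1
    nat : a * (suc d * s) ≤ (c * s + suc e * suc d) * suc b
    nat = ≤-trans (≤-reflexive (sym (*-assoc a (suc d) s))) (≤-trans le (*-monoˡ-≤ (suc b) (+-monoʳ-≤ (c * s) (m≤n*m (suc d) (suc e)))))
    cross : ℤ.+ a ℤ.* ℤ.+ (suc d * s) ℤ.≤ (ℤ.+ c ℤ.* ℤ.+ s ℤ.+ ℤ.+ suc e ℤ.* ℤ.+ suc d) ℤ.* ℤ.+ suc b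
    cross = subst₂ ℤ._≤_ (ℤP.pos-* a (suc d * s)) eq (ℤ.+≤+ nat)
      where
      eq : ℤ.+ ((c * s + suc e * suc d) * suc b) ≡ (ℤ.+ c ℤ.* ℤ.+ s ℤ.+ ℤ.+ suc e ℤ.* ℤ.+ suc d) ℤ.* ℤ.+ suc b
      eq = trans (ℤP.pos-* (c * s + suc e * suc d) (suc b))
                 (cong (ℤ._* ℤ.+ suc b) (trans (ℤP.pos-+ (c * s) (suc e * suc d)) (cong₂ ℤ._+_ (ℤP.pos-* c s) (ℤP.pos-* (suc e) (suc d)))))

p≤q+r⇒p-r≤q : ∀ p q r → p ℚ.≤ q ℚ.+ r → p ℚ.- r ℚ.≤ q
p≤q+r⇒p-r≤q p q r le = subst (p ℚ.- r ℚ.≤_)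
  (trans (ℚP.+-assoc q r (ℚ.- r)) (trans (cong (q ℚ.+_) (ℚP.+-inverseʳ r)) (ℚP.+-identityʳ q)))
  (ℚP.+-monoˡ-≤ (ℚ.- r) le)

permute′≤^ : ∀ n k → n permute′ k ≤ n ^ k
permute′≤^ n zero    = ≤-refl
permute′≤^ n (suc k) = *-mono-≤ (m∸n≤m n k) (permute′≤^ n k)

^≤permute′ : ∀ n k j → k ≤ j → (n ∸ j) ^ k ≤ n permute′ k
^≤permute′ n zero    j _   = ≤-refl
^≤permute′ n (suc k) j k<j = *-mono-≤ (∸-monoʳ-≤ n (<⇒≤ k<j)) (^≤permute′ n k j (<⇒≤ k<j))

choose-k! : ∀ {n k} → k ≤ n → (n choose k) * k ! ≡ n permute′ k
choose-k! {n} {k} k≤n = begin-equality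
  (n choose k) * k !                          ≡⟨ cong (_* k !) (nCk≡nPk/k! k≤n) ⟩
  (_/_ (n permute k) (k !) {{k !≢0}}) * k !    ≡⟨ cong (λ z → _/_ z (k !) {{k !≢0}} * k !) (trans (nPk≡n!/[n∸k]! k≤n) (sym (nP′k≡n!/[n∸k]! k≤n))) ⟩
  (_/_ (n permute′ k) (k !) {{k !≢0}}) * k !   ≡⟨ m/n*n≡m {{k !≢0}} (k!∣nP′k k≤n) ⟩
  n permute′ k                                 ∎

-- Bernoulli at base `a + d`, looking down to `a`, bounds the increment from above.
power-increment : ∀ a d m → (a + d) ^ suc m ≤ a ^ suc m + suc m * d * (a + d) ^ m
power-increment a d m = +-cancelʳ-≤ (m * (a + d) ^ suc m) _ _ (begin
  (a + d) * X + m * ((a + d) * X)                         ≡⟨ e₁ a d m X ⟩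
  suc m * (a * X) + suc m * d * X                         ≤⟨ +-monoˡ-≤ (suc m * d * X) (bernoulli a (a + d) m) ⟩
  a ^ suc m + m * ((a + d) * X) + suc m * d * X           ≡⟨ e₂ (a ^ suc m) (m * ((a + d) * X)) (suc m * d * X) ⟩
  a ^ suc m + suc m * d * X + m * ((a + d) * X)           ∎)
  where
  X = (a + d) ^ m
  e₁ : ∀ a d m X → (a + d) * X + m * ((a + d) * X) ≡ suc m * (a * X) + suc m * d * X
  e₁ = solve-∀
  e₂ : ∀ a b c → a + b + c ≡ a + c + b
  e₂ = solve-∀

-- From counts to densities, with explicit error terms

module Asymptotics (m : ℕ) (1≤m : 1 ≤ m) (s : ℕ) where

  private
    k = suc m
    K = k ^ k ∸ k
    S = s * k !

  -- `2 ^ depth` exceeds `2 * S`, so cutting the blow-up off at `depth` loses at most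
  -- `n ^ k / (2 * S)`. The summands of `threshold` are separate demands on `n`, added so that each
  -- is met.
  depth threshold : ℕ
  depth     = 2 * S
  threshold = suc S * (k * k) + 2 * (S * (k * k ^ depth) + k * k) + depth + k

  1≤K : 1 ≤ K
  1≤K = m<n⇒0<n∸m (begin-strict
    k                <⟨ m<m*n k k (s≤s 1≤m) ⟩
    k * k            ≤⟨ *-monoʳ-≤ k (k≤k^j m 1≤m) ⟩
    k * k ^ m        ∎)
    where
    k≤k^j : ∀ j → 1 ≤ j → k ≤ k ^ j
    k≤k^j (suc j) _ = m≤m^suc k j (s≤s z≤n)

  module _ (n : ℕ) (n-large : threshold ≤ n) where

    private
      c = n choose k
      F = n permute′ k
      t₁ = suc S * (k * k)
      t₂ = 2 * (S * (k * k ^ depth) + k * k)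

    k≤n : k ≤ n
    k≤n = ≤-trans (m≤n+m k (t₁ + t₂ + depth)) n-large

    depth≤n : depth ≤ n
    depth≤n = ≤-trans (≤-trans (m≤n+m depth (t₁ + t₂)) (m≤m+n _ k)) n-large

    t₂≤n : t₂ ≤ n
    t₂≤n = ≤-trans (≤-trans (m≤n+m t₂ t₁) (≤-trans (m≤m+n _ depth) (m≤m+n _ k))) n-large

    t₁≤n : t₁ ≤ n
    t₁≤n = ≤-trans (≤-trans (m≤m+n t₁ t₂) (≤-trans (m≤m+n _ depth) (m≤m+n _ k))) n-large

    n^k≤F+ : n ^ k ≤ F + k * k * n ^ m
    n^k≤F+ = begin
      n ^ k                                            ≡⟨ cong (_^ k) (sym (m∸n+n≡m k≤n)) ⟩
      (n ∸ k + k) ^ k                                  ≤⟨ power-increment (n ∸ k) k m ⟩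
      (n ∸ k) ^ k + k * k * (n ∸ k + k) ^ m            ≡⟨ cong (λ z → (n ∸ k) ^ k + k * k * z ^ m) (m∸n+n≡m k≤n) ⟩
      (n ∸ k) ^ k + k * k * n ^ m                      ≤⟨ +-monoˡ-≤ (k * k * n ^ m) (^≤permute′ n k k ≤-refl) ⟩
      F + k * k * n ^ m                                ∎

    F≡ : F ≡ c * k !
    F≡ = sym (choose-k! k≤n)

    1≤k! : 1 ≤ k !
    1≤k! = 1≤n! k

    k<n : k < n
    k<n = <-≤-trans (m<m*n k k (s≤s 1≤m)) (≤-trans (m≤n*m (k * k) (suc S)) t₁≤n)

    1≤C : 1 ≤ n choose k
    1≤C = n≢0⇒n>0 (λ c≡0 → <⇒≱ (1≤m^n k (m<n⇒0<n∸m k<n)) (≤-trans (^≤permute′ n k k ≤-refl) (≤-reflexive (trans F≡ (cong (_* k !) c≡0)))))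

    -- Times `suc S`, the gap of order `n ^ m` between `n ^ k` and the falling factorial is still at
    -- most `n ^ k`, so `S * n ^ k` is below `(S + 1) * F`; the extra `F` fits into the allowance
    -- `K * F`.
    upper-estimate : ∀ {I} → K * I ≤ n ^ k → I * K * s ≤ (k ! * s + K) * (n choose k)
    upper-estimate {I} KI≤ = cancel-≤ (k !) 1≤k! (begin
      k ! * (I * K * s)                  ≡⟨ e₁ (k !) I K s ⟩
      S * (K * I)                        ≤⟨ *-monoʳ-≤ S KI≤ ⟩
      S * n ^ k                          ≤⟨ +-cancelʳ-≤ (n ^ k) _ _ (begin
        S * n ^ k + n ^ k                           ≡⟨ +-comm (S * n ^ k) (n ^ k) ⟩
        suc S * n ^ k                               ≤⟨ *-monoʳ-≤ (suc S) n^k≤F+ ⟩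
        suc S * (F + k * k * n ^ m)                 ≡⟨ e₂ S F (k * k) (n ^ m) ⟩
        (S + 1) * F + suc S * (k * k) * n ^ m       ≤⟨ +-monoʳ-≤ ((S + 1) * F) (*-monoˡ-≤ (n ^ m) t₁≤n) ⟩
        (S + 1) * F + n ^ k                         ∎) ⟩
      (S + 1) * F                        ≤⟨ *-monoˡ-≤ F (+-monoʳ-≤ S 1≤K) ⟩
      (S + K) * F                        ≡⟨ cong ((S + K) *_) F≡ ⟩
      (S + K) * (c * k !)                ≡⟨ e₃ s (k !) K c ⟩
      k ! * ((k ! * s + K) * c)          ∎)
      where
      e₁ : ∀ f I K s → f * (I * K * s) ≡ s * f * (K * I)
      e₁ = solve-∀
      e₂ : ∀ S F a b → suc S * (F + a * b) ≡ (S + 1) * F + suc S * a * b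
      e₂ = solve-∀
      e₃ : ∀ s f K c → (s * f + K) * (c * f) ≡ f * ((f * s + K) * c)
      e₃ = solve-∀

    lower-estimate : ∀ {I} → (∀ q → q * k ^ depth ≤ n → (q * k ^ depth) ^ k ≤ K * I + q ^ k * k ^ depth) →
                     k ! * (n choose k) * s ≤ (I * s + n choose k) * K
    lower-estimate {I} bound = cancel-≤ (k !) 1≤k! (begin
      k ! * (k ! * c * s)                ≡⟨ e₁ (k !) c s ⟩
      S * (c * k !)                      ≡⟨ cong (S *_) (sym F≡) ⟩
      S * F                              ≤⟨ *-monoʳ-≤ S (permute′≤^ n k) ⟩
      -- The inequality is doubled because `2 * F` provides two copies of `n ^ k`, up to
      -- `2 * k * k * n ^ m`: one covers the truncation (`qX-small`), the other everything of order
      -- `n ^ m` (`errors`).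
      S * n ^ k                          ≤⟨ *-cancelˡ-≤ 2 (+-cancelʳ-≤ (2 * (k * k * n ^ m) + (2 * (S * (q ^ k * X)) + 2 * (S * (k * X) * n ^ m))) _ _ chain) ⟩
      S * (K * I) + F                    ≤⟨ +-monoʳ-≤ (S * (K * I)) (≤-trans (≤-reflexive (sym (+-identityʳ F))) (*-monoˡ-≤ F 1≤K)) ⟩
      S * (K * I) + K * F                ≡⟨ cong (λ z → S * (K * I) + K * z) F≡ ⟩
      S * (K * I) + K * (c * k !)        ≡⟨ e₂ s (k !) K I c ⟩
      k ! * ((I * s + c) * K)            ∎)
      where
      X = k ^ depth
      1≤X : 1 ≤ X
      1≤X = 1≤m^n depth (s≤s z≤n)
      instance
        X≢0 : NonZero X
        X≢0 = >-nonZero 1≤X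
      q = n / X
      e₁ : ∀ f c s → f * (f * c * s) ≡ s * f * (c * f)
      e₁ = solve-∀
      e₂ : ∀ s f K I c → s * f * (K * I) + K * (c * f) ≡ f * ((I * s + c) * K)
      e₂ = solve-∀
      n≡ : n ≡ q * X + n % X
      n≡ = trans (m≡m%n+[m/n]*n n X) (+-comm (n % X) (q * X))
      -- n^k exceeds (qX)^k by O(n^m), and (qX)^k exceeds K I by q^k X = O(n^k / X^m).
      n^k≤ : n ^ k ≤ K * I + q ^ k * X + k * X * n ^ m
      n^k≤ = begin
        n ^ k                                                    ≡⟨ cong (_^ k) n≡ ⟩
        (q * X + n % X) ^ k                                      ≤⟨ power-increment (q * X) (n % X) m ⟩
        (q * X) ^ k + k * (n % X) * (q * X + n % X) ^ m          ≡⟨ cong (λ z → (q * X) ^ k + k * (n % X) * z ^ m) (sym n≡) ⟩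
        (q * X) ^ k + k * (n % X) * n ^ m                        ≤⟨ +-mono-≤ (bound q (m/n*n≤m n X)) (*-monoˡ-≤ (n ^ m) (*-monoʳ-≤ k (<⇒≤ (m%n<n n X)))) ⟩
        K * I + q ^ k * X + k * X * n ^ m                        ∎
      2S≤X^m : 2 * S ≤ X ^ m
      2S≤X^m = begin
        2 * S              ≤⟨ <⇒≤ (n<2^n (2 * S)) ⟩
        2 ^ depth          ≤⟨ ^-monoˡ-≤ depth (s≤s 1≤m) ⟩
        X                  ≤⟨ X≤X^j m 1≤m ⟩
        X ^ m              ∎
        where
        X≤X^j : ∀ j → 1 ≤ j → X ≤ X ^ j
        X≤X^j (suc j) _ = m≤m^suc X j 1≤X
      qX-small : 2 * (S * (q ^ k * X)) ≤ n ^ k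
      qX-small = begin
        2 * (S * (q ^ k * X))        ≡⟨ f S (q ^ k) X ⟩
        q ^ k * (X * (2 * S))        ≤⟨ *-monoʳ-≤ (q ^ k) (*-monoʳ-≤ X 2S≤X^m) ⟩
        q ^ k * X ^ k                ≡⟨ sym (^-distrib-* q X k) ⟩
        (q * X) ^ k                  ≤⟨ ^-monoˡ-≤ k (m/n*n≤m n X) ⟩
        n ^ k                        ∎
        where
        f : ∀ S a X → 2 * (S * (a * X)) ≡ a * (X * (2 * S))
        f = solve-∀
      errors : 2 * (k * k * n ^ m) + 2 * (S * (k * X) * n ^ m) ≤ n ^ k
      errors = ≤-trans (≤-reflexive (f (k * k) (n ^ m) (S * (k * X)))) (*-monoˡ-≤ (n ^ m) t₂≤n)
        where
        f : ∀ a b c → 2 * (a * b) + 2 * (c * b) ≡ 2 * (c + a) * b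
        f = solve-∀
      chain : 2 * (S * n ^ k) + (2 * (k * k * n ^ m) + (2 * (S * (q ^ k * X)) + 2 * (S * (k * X) * n ^ m)))
              ≤ 2 * (S * (K * I) + F) + (2 * (k * k * n ^ m) + (2 * (S * (q ^ k * X)) + 2 * (S * (k * X) * n ^ m)))
      chain = begin
        2 * (S * n ^ k) + (2 * (k * k * n ^ m) + (2 * (S * (q ^ k * X)) + 2 * (S * (k * X) * n ^ m)))
          ≡⟨ f₁ (2 * (S * n ^ k)) (2 * (k * k * n ^ m)) (2 * (S * (q ^ k * X))) (2 * (S * (k * X) * n ^ m)) ⟩
        2 * (S * n ^ k) + ((2 * (k * k * n ^ m) + 2 * (S * (k * X) * n ^ m)) + 2 * (S * (q ^ k * X)))
          ≤⟨ +-mono-≤ (*-monoʳ-≤ 2 (*-monoʳ-≤ S n^k≤)) (+-mono-≤ errors qX-small) ⟩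
        2 * (S * (K * I + q ^ k * X + k * X * n ^ m)) + (n ^ k + n ^ k)
          ≤⟨ +-monoʳ-≤ (2 * (S * (K * I + q ^ k * X + k * X * n ^ m))) (+-mono-≤ n^k≤F+ n^k≤F+) ⟩
        2 * (S * (K * I + q ^ k * X + k * X * n ^ m)) + ((F + k * k * n ^ m) + (F + k * k * n ^ m))
          ≡⟨ f₂ S (K * I) (q ^ k * X) (k * X) (n ^ m) F (k * k) ⟩
        2 * (S * (K * I) + F) + (2 * (k * k * n ^ m) + (2 * (S * (q ^ k * X)) + 2 * (S * (k * X) * n ^ m))) ∎
        where
        f₁ : ∀ a b c d → a + (b + (c + d)) ≡ a + ((b + d) + c)
        f₁ = solve-∀
        f₂ : ∀ S A B D N F kk → 2 * (S * (A + B + D * N)) + ((F + kk * N) + (F + kk * N))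
             ≡ 2 * (S * A + F) + (2 * (kk * N) + (2 * (S * B) + 2 * (S * D * N)))
        f₂ = solve-∀

-- The degree condition

⌈log₂⌉ : ∀ k → 1 ≤ k → ∃ λ ℓ → k ≤ 2 ^ ℓ × 2 ^ ℓ ≤ 2 * k
⌈log₂⌉ (suc zero)    _ = 0 , ≤-refl , s≤s z≤n
⌈log₂⌉ (suc (suc k)) _ with ⌈log₂⌉ (suc k) (s≤s z≤n)
... | ℓ , lo , hi with suc (suc k) ≤? 2 ^ ℓ
...   | yes le = ℓ , le , ≤-trans hi (*-monoʳ-≤ 2 (n≤1+n (suc k)))
...   | no ≰   = suc ℓ
               , ≤-trans (s≤s (≤-trans (m≤n+m (suc k) k) (≤-reflexive (cong (k +_) (sym (+-identityʳ (suc k))))))) (*-monoʳ-≤ 2 lo)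
               , *-monoʳ-≤ 2 (<⇒≤ (≰⇒> ≰))

-- If `j` were the only possible neighbour of `i`, the product of factors 2 over neighbours would be
-- at most 2.
second-neighbour : ∀ {k} (R : Graph k) i j → 4 ≤ 2 ^ degree R i → ∃ λ l → adj R i l ≡ true × l ≢ j
second-neighbour {k} R i j 4≤ with any? (λ l → (adj R i l Bool≟ true) ×-dec ¬? (l ≟ j))
... | yes found = found
... | no none   = ⊥-elim (<⇒≱ (s≤s (s≤s (s≤s (z≤n {1})))) (≤-trans 4≤ (begin
  2 ^ degree R i        ≡⟨ sym (∏-2^∣∣ k (adj R i)) ⟩
  ∏ k c                 ≡⟨ ∏-split k c j ⟩
  c j * ∏ k (c ∖ j)     ≤⟨ *-mono-≤ (c≤2 j) (∏-mono k others) ⟩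
  2 * ∏ k (λ _ → 1)     ≡⟨ cong (2 *_) (trans (∏-const k 1) (^-zeroˡ k)) ⟩
  2                     ∎)))
  where
  c : Fin k → ℕ
  c l = if adj R i l then 2 else 1
  c≤2 : ∀ l → c l ≤ 2
  c≤2 l with adj R i l
  ... | true  = ≤-refl
  ... | false = s≤s z≤n
  others : ∀ l → (c ∖ j) l ≤ 1
  others l with l ≟ j
  ... | yes _ = ≤-refl
  ... | no l≢j with adj R i l in eq
  ...   | true  = ⊥-elim (none (l , eq , l≢j))
  ...   | false = ≤-refl

module DegreeCondition (k : ℕ) (2≤k : 2 ≤ k) where

  private
    log : ∃ λ ℓ → k ≤ 2 ^ ℓ × 2 ^ ℓ ≤ 2 * k
    log = ⌈log₂⌉ k (<⇒≤ 2≤k)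

  abstract
    ℓ : ℕ
    ℓ = proj₁ log

    k≤2^ℓ : k ≤ 2 ^ ℓ
    k≤2^ℓ = proj₁ (proj₂ log)

    2^ℓ≤2k : 2 ^ ℓ ≤ 2 * k
    2^ℓ≤2k = proj₂ (proj₂ log)

  -- `2 ^ g` has to reach `8 * k ^ 6`: hence six times a binary logarithm, plus 3.
  g : ℕ
  g = ℓ * 6 + 3

  1≤g : 1 ≤ g
  1≤g = ≤-trans (s≤s z≤n) (m≤n+m 3 (ℓ * 6))

  g-large : k * k * (8 * (k * k * (k * k))) ≤ 2 ^ g
  g-large = begin
    k * k * (8 * (k * k * (k * k)))    ≡⟨ e k ⟩
    k ^ 6 * 8                          ≤⟨ *-monoˡ-≤ 8 (^-monoˡ-≤ 6 k≤2^ℓ) ⟩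
    (2 ^ ℓ) ^ 6 * 2 ^ 3                ≡⟨ cong (_* 2 ^ 3) (^-*-assoc 2 ℓ 6) ⟩
    2 ^ (ℓ * 6) * 2 ^ 3                ≡⟨ sym (^-distribˡ-+-* 2 (ℓ * 6) 3) ⟩
    2 ^ g                              ∎
    where
    e : ∀ k → k * k * (8 * (k * k * (k * k))) ≡ (k * (k * (k * (k * (k * (k * 1)))))) * 8
    e = solve-∀

  -- The origin of 98: the exponent `2 * (3 * g + 1)` is `36 * ℓ + 20`, and with `2 ^ ℓ ≤ 2 * k` the
  -- constants multiply to `2 ^ (5 + 36 + 20) = 2 ^ 61 ≤ k ^ 61`, next to `k * k ^ 36 = k ^ 37`.
  degree-threshold : 32 * k * 4 ^ (3 * g + 1) ≤ k ^ 98
  degree-threshold = begin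
    32 * k * 4 ^ (3 * g + 1)                    ≡⟨ cong (32 * k *_) (^-*-assoc 2 2 (3 * g + 1)) ⟩
    32 * k * 2 ^ (2 * (3 * g + 1))              ≡⟨ cong (λ z → 32 * k * 2 ^ z) (e₁ ℓ) ⟩
    32 * k * 2 ^ (ℓ * 36 + 20)                  ≡⟨ cong (32 * k *_) (trans (^-distribˡ-+-* 2 (ℓ * 36) 20) (cong (_* 2 ^ 20) (sym (^-*-assoc 2 ℓ 36)))) ⟩
    32 * k * ((2 ^ ℓ) ^ 36 * 2 ^ 20)            ≤⟨ *-monoʳ-≤ (32 * k) (*-monoˡ-≤ (2 ^ 20) (^-monoˡ-≤ 36 2^ℓ≤2k)) ⟩
    32 * k * ((2 * k) ^ 36 * 2 ^ 20)            ≡⟨ cong (λ z → 32 * k * (z * 2 ^ 20)) (^-distrib-* 2 k 36) ⟩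
    32 * k * (2 ^ 36 * k ^ 36 * 2 ^ 20)         ≡⟨ e₂ k (2 ^ 36) (k ^ 36) (2 ^ 20) ⟩
    32 * 2 ^ 36 * 2 ^ 20 * (k * k ^ 36)         ≤⟨ *-monoˡ-≤ (k ^ 37) (^-monoˡ-≤ 61 2≤k) ⟩
    k ^ 61 * k ^ 37                             ≡⟨ sym (^-distribˡ-+-* k 61 37) ⟩
    k ^ 98                                      ∎
    where
    e₁ : ∀ ℓ → 2 * (3 * (ℓ * 6 + 3) + 1) ≡ ℓ * 36 + 20
    e₁ = solve-∀
    e₂ : ∀ k a b c → 32 * k * (a * b * c) ≡ 32 * a * c * (k * b)
    e₂ = solve-∀

  module _ (k^98≤2^k : k ^ 98 ≤ 2 ^ k) where

    -- `2 ^ 98 ≤ k ^ 98 ≤ 2 ^ k` leaves ample room; 16 is what `2 ^ k * 8 ^ k ≤ k ^ k` calls for.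
    16≤k : 16 ≤ k
    16≤k with 16 ≤? k
    ... | yes le = le
    ... | no ≰   = ⊥-elim (<⇒≱ (^-monoʳ-< 2 (s≤s (s≤s z≤n)) (≤-trans (≰⇒> ≰) (m≤m+n 16 82))) (≤-trans (^-monoˡ-≤ 98 2≤k) k^98≤2^k))

    k-large : 32 * (k * k * k) * 8 ^ k ≤ k ^ k
    k-large = begin
      32 * (k * k * k) * 8 ^ k          ≤⟨ *-monoˡ-≤ (8 ^ k) (begin
        32 * (k * k * k)                     ≤⟨ *-monoˡ-≤ (k * k * k) (^-monoˡ-≤ 5 2≤k) ⟩
        k ^ 5 * (k * k * k)                  ≡⟨ cong (k ^ 5 *_) (e k) ⟩
        k ^ 5 * k ^ 3                        ≡⟨ sym (^-distribˡ-+-* k 5 3) ⟩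
        k ^ 8                                ≤⟨ ^-monoʳ-≤ k {{>-nonZero (<⇒≤ 2≤k)}} (m≤m+n 8 90) ⟩
        k ^ 98                               ≤⟨ k^98≤2^k ⟩
        2 ^ k                                ∎) ⟩
      2 ^ k * 8 ^ k                     ≡⟨ sym (^-distrib-* 2 8 k) ⟩
      16 ^ k                            ≤⟨ ^-monoˡ-≤ k 16≤k ⟩
      k ^ k                             ∎
      where
      e : ∀ k → k * k * k ≡ k * (k * (k * 1))
      e = solve-∀

  4≤k^98 : 4 ≤ k ^ 98
  4≤k^98 = ≤-trans (^-monoˡ-≤ 2 2≤k) (^-monoʳ-≤ k {{>-nonZero (<⇒≤ 2≤k)}} (m≤m+n 2 96))

-- The limits of the maximal densities and the theorem

module Limit {m : ℕ} (R : Graph (suc m)) (connected : Connected R) (other : ∀ i j → ∃ λ l → adj R i l ≡ true × l ≢ j)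
             (g : ℕ) (1≤g : 1 ≤ g) (g-large : suc m * suc m * (8 * (suc m * suc m * (suc m * suc m))) ≤ 2 ^ g)
             (degree-large : ∀ r → 32 * suc m * 4 ^ (3 * g + 1) ≤ 2 ^ degree R r)
             (1≤m : 1 ≤ m) (k-large : 32 * (suc m * suc m * suc m) * 8 ^ suc m ≤ suc m ^ suc m) where

  private
    k = suc m
    K = k ^ k ∸ k

  copies≤ : ∀ {n} (G : TGraph R n) → K * Defs.I R G ≤ n ^ k
  copies≤ {n} G = begin
    K * Defs.I R G                    ≤⟨ *-monoʳ-≤ K I≤embs ⟩
    K * embs                          ≡⟨ cong (K *_) (sym h-ones) ⟩
    K * Weighted.h R G (λ _ → 1)      ≤⟨ upper-bound (λ _ → 1) ⟩
    Weighted.tot R G (λ _ → 1) ^ k    ≡⟨ cong (_^ k) tot-ones ⟩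
    n ^ k                             ∎
    where
    open Copies R G
    open UpperBound R G connected other g 1≤g g-large degree-large 1≤m k-large

  -- One argument for both limits: the upper estimate holds for every colouring, and the lower one
  -- is attained by an iterated blow-up, which lies in any class containing these.
  density-limit : (P : ∀ {n} → TGraph R n → Set) → (∀ {n} (G : TGraph R n) → IsBlowUp R G → P G) →
                  MaxTendsTo R P (ratio (k !) K)
  density-limit P blowUp⇒P ε 0<ε = threshold , λ n n-large →
      (λ G _ → ratio≤ratio+ {b = n choose k} {d = K} (1≤C n n-large) 1≤K ε 0<ε (upper-estimate n n-large (copies≤ G)))
    , (fractal n n , blowUp⇒P (fractal n n) (isBlowUp n (fractal n n) ≤-refl (λ _ _ _ → refl))
      , p≤q+r⇒p-r≤q _ _ ε (ratio≤ratio+ {b = K} {d = n choose k} 1≤K (1≤C n n-large) ε 0<ε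
          (lower-estimate n n-large (λ q le → ≤-trans (lower-bound depth n n q (depth≤n n n-large) le)
             (+-monoˡ-≤ (q ^ k * k ^ depth) (*-monoʳ-≤ K (Copies.embs≤I R (fractal n n) connected other)))))))
    where
    open Asymptotics m 1≤m (ℚ.↧ₙ ε)
    open Fractal R 1≤m

-- The constant `C` is the rational `p / q`: `k ^ p ≤ 2 ^ (q * degree R v)` says that the degree is
-- at least `p / q` times the binary logarithm of `k`.
theorem1p3 : ∃ λ (p : ℕ) → ∃ λ (q : ℕ) → 1 ≤ p × 1 ≤ q ×
    (∀ (k : ℕ) (R : Graph k) → 2 ≤ k → Connected R →
    (∀ (v : Fin k) → k ^ p ≤ 2 ^ (q * degree R v)) →
    Fractalizer R × IndEq R (ratio (k !) (k ^ k ∸ k)))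
theorem1p3 = 98 , 1 , s≤s z≤n , s≤s z≤n , main
  where
  -- `D` stands for `k ^ 98`; only the inequalities listed about it matter.
  limits : ∀ k (R : Graph k) → 2 ≤ k → Connected R → ∀ D → (∀ v → D ≤ 2 ^ degree R v) → 4 ≤ D →
           ∀ g → 1 ≤ g → k * k * (8 * (k * k * (k * k))) ≤ 2 ^ g → 32 * k * 4 ^ (3 * g + 1) ≤ D →
           32 * (k * k * k) * 8 ^ k ≤ k ^ k → Fractalizer R × IndEq R (ratio (k !) (k ^ k ∸ k))
  limits (suc m) R (s≤s 1≤m) connected D D≤ 4≤D g 1≤g g-large g-small k-large =
    (ratio (suc m !) (suc m ^ suc m ∸ suc m) , ind , density-limit (IsBlowUp R) (λ _ b → b)) , ind
    where
    open Limit R connected (λ i j → second-neighbour R i j (≤-trans 4≤D (D≤ i))) g 1≤g g-large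
               (λ r → ≤-trans g-small (D≤ r)) 1≤m k-large
    ind : IndEq R (ratio (suc m !) (suc m ^ suc m ∸ suc m))
    ind = density-limit (λ _ → ⊤) (λ _ _ → tt)
  main : ∀ (k : ℕ) (R : Graph k) → 2 ≤ k → Connected R → (∀ (v : Fin k) → k ^ 98 ≤ 2 ^ (1 * degree R v)) →
         Fractalizer R × IndEq R (ratio (k !) (k ^ k ∸ k))
  main k R 2≤k connected degrees =
    limits k R 2≤k connected (k ^ 98) degrees′ 4≤k^98 g 1≤g g-large degree-threshold (k-large k^98≤2^k)
    where
    open DegreeCondition k 2≤k
    degrees′ : ∀ v → k ^ 98 ≤ 2 ^ degree R v
    degrees′ v = subst (λ d → k ^ 98 ≤ 2 ^ d) (*-identityˡ (degree R v)) (degrees v)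
    -- A degree is at most `k`, so the degree condition at a single vertex already makes `k` large.
    k^98≤2^k : k ^ 98 ≤ 2 ^ k
    k^98≤2^k = ≤-trans (degrees′ v₀) (^-monoʳ-≤ 2 (∣p∣≤n (tabulate (adj R v₀))))
      where v₀ = fromℕ< 2≤k
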